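{- There exists a number $n_0$ such that the following holds. If $M$ is a flag triangulation of a closed $3$-manifold with $f_0\geq n_0$ vertices and $f_1$ edges, and $f_1>\frac14(f_0^2+2f_0+17)$, then $M$ is (simplicially isomorphic to) a join of two polygons; in particular $M$ is homeomorphic to $S^3$.
   Context: A simplicial complex is flag if all its minimal non-faces have dimension $1$, equivalently it is the clique complex of its $1$-skeleton. A closed manifold is a compact manifold without boundary. $f_0$ and $f_1$ denote the numbers of vertices and edges of $M$. A polygon is a triangulated circle (a cycle with at least $3$ vertices, viewed as a $1$-dimensional simplicial complex). The join $K\ast L$ of simplicial complexes with disjoint vertex sets has vertex set $V(K)\cup V(L)$ and faces all unions $\tau\cup\sigma$ with $\tau\in K$, $\sigma\in L$. -}

module Defs where

open import Data.Nat using (ℕ; zero; suc; _+_; _≤_; _≡ᵇ_; _≤ᵇ_)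
open import Data.Bool using (Bool; true; false; _∧_; _∨_; not; if_then_else_)
open import Data.Fin using (Fin; toℕ)
open import Data.Fin.Subset using (Subset; ⁅_⁆; _∪_; ∣_∣; _⊆_)
open import Data.List using (List; []; _∷_; _++_; map; allFin)
open import Data.Bool.ListAction using (any)
open import Data.Vec using (Vec; []; _∷_; lookup; tabulate; take; drop)
open import Data.Product using (Σ; ∃; _×_; _,_)
open import Function.Bundles using (_↔_; Inverse)
open import Relation.Binary.PropositionalEquality using (_≡_)

FacePred : ℕ → Set
FacePred n = Subset n → Bool

-- A finite abstract simplicial complex with vertex set exactly Fin n (so f₀ = n).
record SimplicialComplex (n : ℕ) : Set where
  field
    face        : FacePred n
    down-closed : ∀ {σ τ} → τ ⊆ σ → face σ ≡ true → face τ ≡ true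
    vertices    : ∀ i → face ⁅ i ⁆ ≡ true
open SimplicialComplex public

_⊆ᵇ_ : ∀ {n} → Subset n → Subset n → Bool
[] ⊆ᵇ [] = true
(x ∷ xs) ⊆ᵇ (y ∷ ys) = (not x ∨ y) ∧ (xs ⊆ᵇ ys)

_==ˢ_ : ∀ {n} → Subset n → Subset n → Bool
σ ==ˢ τ = (σ ⊆ᵇ τ) ∧ (τ ⊆ᵇ σ)

allSubsets : ∀ n → List (Subset n)
allSubsets zero = [] ∷ []
allSubsets (suc n) = map (true ∷_) (allSubsets n) ++ map (false ∷_) (allSubsets n)

countᵇ : ∀ {A : Set} → (A → Bool) → List A → ℕ
countᵇ p [] = 0
countᵇ p (x ∷ xs) = if p x then suc (countᵇ p xs) else countᵇ p xs

facesOfSize : ∀ {n} → FacePred n → ℕ → ℕ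
facesOfSize {n} P k = countᵇ (λ σ → P σ ∧ (∣ σ ∣ ≡ᵇ k)) (allSubsets n)

f₁ : ∀ {n} → SimplicialComplex n → ℕ
f₁ K = facesOfSize (face K) 2

edge : ∀ {n} → Fin n → Fin n → Subset n
edge i j = ⁅ i ⁆ ∪ ⁅ j ⁆

IsFlag : ∀ {n} → SimplicialComplex n → Set
IsFlag {n} K = ∀ (σ : Subset n) →
  (∀ i j → lookup σ i ≡ true → lookup σ j ≡ true → face K (edge i j) ≡ true) →
  face K σ ≡ true

link : ∀ {n} → FacePred n → Fin n → FacePred n
link P v σ = not (lookup σ v) ∧ P (σ ∪ ⁅ v ⁆)

data Reach {n : ℕ} (Adj : Fin n → Fin n → Bool) : Fin n → Fin n → Set where
  here : ∀ {x} → Reach Adj x x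
  step : ∀ {x y z} → Adj x y ≡ true → Reach Adj y z → Reach Adj x z

Connected : ∀ {n} → (Fin n → Bool) → (Fin n → Fin n → Bool) → Set
Connected {n} Vx Adj = ∀ (x y : Fin n) → Vx x ≡ true → Vx y ≡ true → Reach Adj x y

IsConnected : ∀ {n} → FacePred n → Set
IsConnected P = Connected (λ x → P ⁅ x ⁆) (λ x y → P (edge x y))

-- Combinatorial triangulated 2-sphere (vertices = those x with P ⁅ x ⁆):
-- a pure 2-dimensional complex in which every edge lies in exactly two
-- triangles and every vertex link is connected (i.e. a closed surface),
-- which is connected and has Euler characteristic 2.
record Is2Sphere {n : ℕ} (P : FacePred n) : Set where
  field
    down-closed : ∀ {σ τ} → τ ⊆ σ → P σ ≡ true → P τ ≡ true
    dim≤2       : ∀ σ → P σ ≡ true → ∣ σ ∣ ≤ 3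
    pure        : ∀ σ → P σ ≡ true → Σ (Subset n) λ τ → σ ⊆ τ × P τ ≡ true × ∣ τ ∣ ≡ 3
    edge-in-two : ∀ e → P e ≡ true → ∣ e ∣ ≡ 2 →
                  countᵇ (λ τ → P τ ∧ (∣ τ ∣ ≡ᵇ 3) ∧ (e ⊆ᵇ τ)) (allSubsets n) ≡ 2
    links-conn  : ∀ v → P ⁅ v ⁆ ≡ true → IsConnected (link P v)
    connected   : IsConnected P
    euler       : facesOfSize P 1 + facesOfSize P 3 ≡ facesOfSize P 2 + 2

IsClosed3Manifold : ∀ {n} → SimplicialComplex n → Set
IsClosed3Manifold K = ∀ v → Is2Sphere (link (face K) v)

cycAdj : ∀ {m} → Fin m → Fin m → Bool
cycAdj {m} i j = (suc (toℕ i) ≡ᵇ toℕ j) ∨ ((suc (toℕ i) ≡ᵇ m) ∧ (toℕ j ≡ᵇ 0))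

polygon : ∀ m → FacePred m
polygon m σ = (∣ σ ∣ ≤ᵇ 1) ∨
  any (λ i → any (λ j → cycAdj i j ∧ (σ ==ˢ edge i j)) (allFin m)) (allFin m)

join : ∀ {a b} → FacePred a → FacePred b → FacePred (a + b)
join {a} K L σ = K (take a σ) ∧ L (drop a σ)

image : ∀ {n m} → (Fin n ↔ Fin m) → Subset n → Subset m
image f σ = tabulate (λ j → lookup σ (Inverse.from f j))

IsJoinOfTwoPolygons : ∀ {n} → SimplicialComplex n → Set
IsJoinOfTwoPolygons {n} K =
  Σ ℕ λ a → Σ ℕ λ b → 3 ≤ a × 3 ≤ b ×
  Σ (Fin n ↔ Fin (a + b)) λ f →
    ∀ (σ : Subset n) → face K σ ≡ join (polygon a) (polygon b) (image f σ)

{-# OPTIONS --safe #-}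
module Submission where

-- In the 1-skeleton of a flag 3-manifold the link of an edge is an induced cycle of length at least 4, the link of
-- a vertex v of degree d has 3d - 6 edges, and there is no complete subgraph on five vertices.
--
-- Double counting over the edges gives an edge uv such that N(u) and N(v) have bounded intersection and leave only
-- boundedly many vertices uncovered. As the links have few edges, only O(n) pairs of N(u) × N(v) are non-adjacent,
-- and this produces a tetrahedron xx′yy′ such that the disjoint cycles ZA = lk(yy′) and ZB = lk(xx′) contain all
-- but boundedly many vertices. Choose it with as few remaining vertices as possible.
--
-- A remaining vertex has few neighbours on one of the cycles and is assigned to the side of that cycle, or it has
-- low degree. Since a vertex link has average degree below 6, for all but boundedly many edges bb′ of ZB the
-- vertices b and b′ have the same neighbours on the side of ZA (they are twins). If both sides have additional
-- vertices, then almost every vertex misses one of the other side, because the link of an edge cannot properly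
-- contain the induced cycle ZA or ZB, and by the twins this costs about n edges, which is too many. If only the side of ZA has additional vertices,
-- then minimality shows that b has at most |ZA| neighbours on that side, and again there are too few edges as soon
-- as there are two additional vertices. So at most one vertex w remains. If there is one, then N(w) meets the two
-- cycles in arcs or in everything, and the number of edges in the link of w yields f₁ ≤ (n² + 2n + 17) / 4.
-- If there is none, the link of every edge between ZA and ZB is a 4-cycle, which forces the join.

open import Defs
open import Data.Nat hiding (_≟_)
open import Data.Nat.Properties hiding (_≟_)
open import Data.Nat.Tactic.RingSolver using (solve-∀)
open import Data.Bool using (Bool; true; false; _∧_; _∨_; not)
open import Data.Bool.ListAction using (any)
open import Data.Bool.Properties using (∧-comm; ∧-assoc; ∧-zeroʳ; ∧-identityʳ; ∨-identityʳ; T-≡)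
open import Data.Empty using (⊥; ⊥-elim)
open import Data.Fin using (Fin; zero; suc; toℕ; fromℕ<; splitAt; _↑ˡ_; _↑ʳ_)
open import Data.Fin.Properties using (_≟_; toℕ<n; toℕ-injective; toℕ-fromℕ<; pigeonhole; splitAt-↑ˡ; splitAt-↑ʳ; splitAt⁻¹-↑ˡ; splitAt⁻¹-↑ʳ)
open import Data.Fin.Subset using (Subset; ⁅_⁆; _∪_; ∣_∣; _⊆_) renaming (⊥ to ∅)
open import Data.Fin.Subset.Properties using (x∈⁅x⁆; x∈⁅y⁆⇒x≡y; ∪-comm; ∪-idem; ∪-identityʳ; ∣⁅x⁆∣≡1)
open import Data.List using (List; []; _∷_; _++_; map; allFin)
open import Data.List.Membership.Propositional using (lose; find)
open import Data.List.Membership.Propositional.Properties using (∈-allFin)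
open import Data.List.Relation.Unary.Any.Properties using (any⁺; any⁻)
open import Data.Product using (Σ; ∃; _×_; _,_; proj₁; proj₂)
open import Data.Sum using (_⊎_; inj₁; inj₂; [_,_]′)
open import Data.Vec using ([]; _∷_; lookup; take; drop)
open import Data.Vec.Properties using (lookup-zipWith; []=⇒lookup; lookup⇒[]=; lookup∘tabulate; lookup-++ˡ; lookup-++ʳ; take++drop≡id)
open import Function using (_∘_; id; Equivalence)
open import Function.Bundles using (_↔_; mk↔ₛ′)
open import Relation.Binary.Definitions using (tri<; tri≈; tri>)
open import Relation.Binary.PropositionalEquality
open import Relation.Nullary using (yes; no; contradiction)
open import Relation.Nullary.Decidable using (⌊_⌋)
import Algebra.Properties.Semiring.Sum +-*-semiring as Sum

-- The case of one vertex outside the cycles dictates the shape of the proof. If k vertices lie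
-- outside cycles of lengths α and β, the complete join of the cycles accounts for 4αβ + 4(α + β),
-- at most (n - k)² + 4(n - k), in 4 `f₁`, and this has to be compared with n² + 2n + 18. The square
-- loses about 2kn, while the linear terms on the right are ahead by only 2n. Hence for k ≥ 2 a gap
-- linear in n remains, provided that the outer vertices contribute little, and it absorbs every
-- error that is bounded or a small multiple of n. For k = 1 the linear terms cancel and no error at
-- all is affordable. There an exact count is made: if w has s neighbours on one cycle and t on the
-- other, it ends with 4 `f₁` ≤ n² + 2n + 17 - 4(s - 3)(t - 3), and s and t are at least 3. This is
-- the origin of the constant 17. All estimates before that point may be crude; they only have to
-- leave a number of outer vertices that does not depend on n.

private variable
  n n′ : ℕ

-- Linear inequalities are proved by exhibiting the slack k, which leaves a semiring identity.
by-slack : ∀ {l r a b} → l ≤ r → ∀ k → a + r + k ≡ b + l → a ≤ b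
by-slack {l} {r} {a} {b} l≤r k eq = +-cancelʳ-≤ l a b (begin
  a + l      ≤⟨ +-monoʳ-≤ a l≤r ⟩
  a + r      ≤⟨ m≤m+n (a + r) k ⟩
  a + r + k  ≡⟨ eq ⟩
  b + l      ∎)
  where open ≤-Reasoning

absurd-slack : ∀ {l r} {A : Set} → l ≤ r → ∀ k → suc (r + k) ≡ l → A
absurd-slack {l} {r} l≤r k eq = ⊥-elim (<⇒≱ (subst (r <_) eq (s≤s (m≤m+n r k))) l≤r)

-- Truth values as numbers and Boolean tests

⟦_⟧ : Bool → ℕ
⟦ true ⟧  = 1
⟦ false ⟧ = 0

⟦⟧≤1 : ∀ b → ⟦ b ⟧ ≤ 1
⟦⟧≤1 true  = ≤-refl
⟦⟧≤1 false = z≤n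

⟦⟧-mono : ∀ {a b} → (a ≡ true → b ≡ true) → ⟦ a ⟧ ≤ ⟦ b ⟧
⟦⟧-mono {true}  h rewrite h refl = ≤-refl
⟦⟧-mono {false} h = z≤n

⟦∧⟧ : ∀ a b → ⟦ a ∧ b ⟧ ≡ ⟦ a ⟧ * ⟦ b ⟧
⟦∧⟧ true  b = sym (+-identityʳ ⟦ b ⟧)
⟦∧⟧ false b = refl

⟦not⟧ : ∀ b → ⟦ b ⟧ + ⟦ not b ⟧ ≡ 1
⟦not⟧ true  = refl
⟦not⟧ false = refl

∧-true : ∀ {a b} → a ∧ b ≡ true → a ≡ true × b ≡ true
∧-true {true} {true} _ = refl , refl

_∧ᵗ_ : ∀ {a b} → a ≡ true → b ≡ true → a ∧ b ≡ true
refl ∧ᵗ refl = refl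
infixr 6 _∧ᵗ_

∨-true : ∀ {a b} → a ∨ b ≡ true → a ≡ true ⊎ b ≡ true
∨-true {true}  _ = inj₁ refl
∨-true {false} p = inj₂ p

∨-trueˡ : ∀ {a b} → a ≡ true → a ∨ b ≡ true
∨-trueˡ refl = refl

∨-trueʳ : ∀ {a b} → b ≡ true → a ∨ b ≡ true
∨-trueʳ {true}  refl = refl
∨-trueʳ {false} refl = refl

not-true : ∀ {a} → not a ≡ true → a ≡ false
not-true {false} _ = refl

not-false : ∀ {a} → not a ≡ false → a ≡ true
not-false {true} _ = refl

true≢false : ∀ {a} {A : Set} → a ≡ true → a ≡ false → A
true≢false refl ()

decide : ∀ b → b ≡ true ⊎ b ≡ false
decide true  = inj₁ refl
decide false = inj₂ refl

≡ᵇ-true⇒≡ : ∀ {a b} → (a ≡ᵇ b) ≡ true → a ≡ b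
≡ᵇ-true⇒≡ {a} {b} p = ≡ᵇ⇒≡ a b (Equivalence.from T-≡ p)

≡⇒≡ᵇ-true : ∀ {a b} → a ≡ b → (a ≡ᵇ b) ≡ true
≡⇒≡ᵇ-true {a} {b} p = Equivalence.to T-≡ (≡⇒≡ᵇ a b p)

≤ᵇ-true⇒≤ : ∀ {a b} → (a ≤ᵇ b) ≡ true → a ≤ b
≤ᵇ-true⇒≤ {a} {b} p = ≤ᵇ⇒≤ a b (Equivalence.from T-≡ p)

≤ᵇ-false⇒> : ∀ {a b} → (a ≤ᵇ b) ≡ false → b < a
≤ᵇ-false⇒> p = ≰⇒> λ le → true≢false (Equivalence.to T-≡ (≤⇒≤ᵇ le)) p

_==_ : Fin n → Fin n → Bool
i == j = ⌊ i ≟ j ⌋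

==-refl : (i : Fin n) → i == i ≡ true
==-refl i with i ≟ i
... | yes _  = refl
... | no i≢i = contradiction refl i≢i

==⇒≡ : ∀ {i j : Fin n} → i == j ≡ true → i ≡ j
==⇒≡ {i = i} {j} p with i ≟ j
... | yes i≡j = i≡j

≢⇒== : ∀ {i j : Fin n} → i ≢ j → i == j ≡ false
≢⇒== {i = i} {j} i≢j with i ≟ j
... | yes i≡j = contradiction i≡j i≢j
... | no _    = refl

-- Finite sums

opaque
  sum : (Fin n → ℕ) → ℕ
  sum = Sum.sum

  sum-cong : {f g : Fin n → ℕ} → (∀ i → f i ≡ g i) → sum f ≡ sum g
  sum-cong = Sum.sum-cong-≗

  sum-+ : (f g : Fin n → ℕ) → sum (λ i → f i + g i) ≡ sum f + sum g
  sum-+ = Sum.∑-distrib-+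

  sum-comm : (f : Fin n → Fin n′ → ℕ) → sum (λ i → sum (f i)) ≡ sum (λ j → sum (λ i → f i j))
  sum-comm = Sum.∑-comm

  *-sum : ∀ k (f : Fin n → ℕ) → k * sum f ≡ sum (λ i → k * f i)
  *-sum = Sum.*-distribˡ-sum

  sum-suc : (f : Fin (suc n) → ℕ) → sum f ≡ f zero + sum (λ i → f (suc i))
  sum-suc f = refl

  sum-mono : {f g : Fin n → ℕ} → (∀ i → f i ≤ g i) → sum f ≤ sum g
  sum-mono {n = zero}  f≤g = z≤n
  sum-mono {n = suc n} f≤g = +-mono-≤ (f≤g zero) (sum-mono (f≤g ∘ suc))

  sum-const : ∀ n k → sum {n} (λ _ → k) ≡ n * k
  sum-const zero    k = refl
  sum-const (suc n) k = cong (k +_) (sum-const n k)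

  -- The averaging principle in its basic form. Every choice of an edge, a triangle or a vertex by
  -- counting goes through this lemma or its relative `sumOn-<⇒∃`.
  sum-<⇒∃ : (f g : Fin n → ℕ) → sum f < sum g → ∃ λ i → f i < g i
  sum-<⇒∃ {n = suc n} f g lt with f zero <? g zero
  ... | yes p = zero , p
  ... | no ¬p with sum-<⇒∃ (f ∘ suc) (g ∘ suc)
         (+-cancelˡ-< (g zero) _ _ (≤-<-trans (+-monoˡ-≤ _ (≮⇒≥ ¬p)) lt))
  ... | i , q = suc i , q

sum-zero : ∀ n → sum {n} (λ _ → 0) ≡ 0
sum-zero n = trans (sum-const n 0) (*-zeroʳ n)

suc==suc : (i j : Fin n) → suc i == suc j ≡ i == j
suc==suc i j with i ≟ j
... | yes _ = refl
... | no _  = refl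

sum-δ : (i : Fin n) → sum (λ j → ⟦ j == i ⟧) ≡ 1
sum-δ {suc n} zero    = trans (sum-suc _) (cong suc (sum-zero n))
sum-δ {suc n} (suc i) = trans (sum-suc _) (trans (sum-cong λ j → cong ⟦_⟧ (suc==suc j i)) (sum-δ i))

sum-* : ∀ k (f : Fin n → ℕ) → sum (λ i → f i * k) ≡ sum f * k
sum-* k f = trans (sum-cong λ i → *-comm (f i) k)
  (trans (sym (*-sum k f)) (*-comm k (sum f)))

opaque

  # : (Fin n → Bool) → ℕ
  # P = sum (λ i → ⟦ P i ⟧)

  sumOn : (Fin n → Bool) → (Fin n → ℕ) → ℕ
  sumOn P f = sum (λ i → ⟦ P i ⟧ * f i)

  sumOn-sum : (P : Fin n → Bool) (f : Fin n → ℕ) → sumOn P f ≡ sum (λ i → ⟦ P i ⟧ * f i)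
  sumOn-sum P f = refl

  #-sum : (P : Fin n → Bool) → # P ≡ sum (λ i → ⟦ P i ⟧)
  #-sum P = refl

  #-mono : {P Q : Fin n → Bool} → (∀ i → P i ≡ true → Q i ≡ true) → # P ≤ # Q
  #-mono P⊆Q = sum-mono λ i → ⟦⟧-mono (P⊆Q i)

  #-cong : {P Q : Fin n → Bool} → (∀ i → P i ≡ Q i) → # P ≡ # Q
  #-cong P≗Q = sum-cong λ i → cong ⟦_⟧ (P≗Q i)

  #≤n : (P : Fin n → Bool) → # P ≤ n
  #≤n {n} P = ≤-trans (sum-mono λ i → ⟦⟧≤1 (P i)) (≤-reflexive (trans (sum-const n 1) (*-identityʳ n)))

  #-split : (P Q : Fin n → Bool) → # P ≡ # (λ i → P i ∧ Q i) + # (λ i → P i ∧ not (Q i))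
  #-split P Q = trans (sum-cong λ i → lemma (P i) (Q i)) (sum-+ _ _)
    where
    lemma : ∀ a b → ⟦ a ⟧ ≡ ⟦ a ∧ b ⟧ + ⟦ a ∧ not b ⟧
    lemma true  true  = refl
    lemma true  false = refl
    lemma false _     = refl

  #-∨≤ : (P Q : Fin n → Bool) → # (λ i → P i ∨ Q i) ≤ # P + # Q
  #-∨≤ P Q = ≤-trans (sum-mono λ i → lemma (P i) (Q i)) (≤-reflexive (sum-+ _ _))
    where
    lemma : ∀ a b → ⟦ a ∨ b ⟧ ≤ ⟦ a ⟧ + ⟦ b ⟧
    lemma true  b = m≤m+n 1 ⟦ b ⟧
    lemma false b = ≤-refl

  #-not : (P : Fin n → Bool) → # P + # (λ i → not (P i)) ≡ n
  #-not {n} P = trans (sym (sum-+ _ _))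
    (trans (sum-cong λ i → ⟦not⟧ (P i)) (trans (sum-const n 1) (*-identityʳ n)))

  #>0⇒∃ : (P : Fin n → Bool) → 0 < # P → ∃ λ i → P i ≡ true
  #>0⇒∃ {n} P 0<#P with sum-<⇒∃ (λ _ → 0) (λ i → ⟦ P i ⟧) (subst (_< # P) (sym (sum-zero n)) 0<#P)
  ... | i , lt with P i in eq
  ... | true = i , eq

  ∃⇒#>0 : (P : Fin n → Bool) → ∀ {i} → P i ≡ true → 0 < # P
  ∃⇒#>0 P {i} Pi = subst (_≤ # P) (sum-δ i)
    (sum-mono λ j → ⟦⟧-mono λ j≡i → subst (λ k → P k ≡ true) (sym (==⇒≡ j≡i)) Pi)

  sumOn-mono : (P : Fin n → Bool) {f g : Fin n → ℕ} →
    (∀ i → P i ≡ true → f i ≤ g i) → sumOn P f ≤ sumOn P g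
  sumOn-mono P {f} {g} f≤g = sum-mono lemma
    where
    lemma : ∀ i → ⟦ P i ⟧ * f i ≤ ⟦ P i ⟧ * g i
    lemma i with P i in eq
    ... | true  = +-monoˡ-≤ 0 (f≤g i eq)
    ... | false = z≤n

  sumOn-cong : (P : Fin n → Bool) {f g : Fin n → ℕ} →
    (∀ i → P i ≡ true → f i ≡ g i) → sumOn P f ≡ sumOn P g
  sumOn-cong P f≡g = ≤-antisym (sumOn-mono P λ i p → ≤-reflexive (f≡g i p))
                               (sumOn-mono P λ i p → ≤-reflexive (sym (f≡g i p)))

  sumOn-⊆ : (P Q : Fin n → Bool) (f : Fin n → ℕ) →
    (∀ i → P i ≡ true → Q i ≡ true) → sumOn P f ≤ sumOn Q f
  sumOn-⊆ P Q f P⊆Q = sum-mono λ i → *-monoˡ-≤ (f i) (⟦⟧-mono (P⊆Q i))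

  sumOn-const : (P : Fin n → Bool) (k : ℕ) → sumOn P (λ _ → k) ≡ # P * k
  sumOn-const P k = sum-* k _

  sumOn-+ : (P : Fin n → Bool) (f g : Fin n → ℕ) →
    sumOn P (λ i → f i + g i) ≡ sumOn P f + sumOn P g
  sumOn-+ P f g = trans (sum-cong λ i → *-distribˡ-+ ⟦ P i ⟧ (f i) (g i)) (sum-+ _ _)

  sumOn-* : (P : Fin n → Bool) (k : ℕ) (f : Fin n → ℕ) → sumOn P (λ i → k * f i) ≡ k * sumOn P f
  sumOn-* P k f = trans (sum-cong λ i → lemma ⟦ P i ⟧ k (f i)) (sym (*-sum k _))
    where
    lemma : ∀ a b c → a * (b * c) ≡ b * (a * c)
    lemma = solve-∀

  sumOn-≤const : (P : Fin n → Bool) (f : Fin n → ℕ) (k : ℕ) →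
    (∀ i → P i ≡ true → f i ≤ k) → sumOn P f ≤ # P * k
  sumOn-≤const P f k f≤k = ≤-trans (sumOn-mono P f≤k) (≤-reflexive (sumOn-const P k))

  sumOn-≥const : (P : Fin n → Bool) (f : Fin n → ℕ) (k : ℕ) →
    (∀ i → P i ≡ true → k ≤ f i) → # P * k ≤ sumOn P f
  sumOn-≥const P f k k≤f = ≤-trans (≤-reflexive (sym (sumOn-const P k))) (sumOn-mono P k≤f)

  sumOn-<⇒∃ : (P : Fin n → Bool) (f g : Fin n → ℕ) →
    sumOn P f < sumOn P g → ∃ λ i → P i ≡ true × f i < g i
  sumOn-<⇒∃ P f g lt with sum-<⇒∃ _ _ lt
  ... | i , q with P i in eq
  ... | true = i , eq , subst₂ _<_ (+-identityʳ (f i)) (+-identityʳ (g i)) q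

  sumOn-comm : (P : Fin n → Bool) (Q : Fin n′ → Bool) (f : Fin n → Fin n′ → ℕ) →
    sumOn P (λ x → sumOn Q (λ y → f x y)) ≡ sumOn Q (λ y → sumOn P (λ x → f x y))
  sumOn-comm P Q f = begin
    sumOn P (λ x → sumOn Q (f x))
      ≡⟨ sum-cong (λ x → *-sum ⟦ P x ⟧ (λ y → ⟦ Q y ⟧ * f x y)) ⟩
    sum (λ x → sum (λ y → ⟦ P x ⟧ * (⟦ Q y ⟧ * f x y)))
      ≡⟨ sum-comm (λ x y → ⟦ P x ⟧ * (⟦ Q y ⟧ * f x y)) ⟩
    sum (λ y → sum (λ x → ⟦ P x ⟧ * (⟦ Q y ⟧ * f x y)))
      ≡⟨ sum-cong (λ y → trans (sum-cong λ x → lemma ⟦ P x ⟧ ⟦ Q y ⟧ (f x y))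
                                  (sym (*-sum ⟦ Q y ⟧ (λ x → ⟦ P x ⟧ * f x y)))) ⟩
    sumOn Q (λ y → sumOn P (λ x → f x y)) ∎
    where
    open ≡-Reasoning
    lemma : ∀ a b c → a * (b * c) ≡ b * (a * c)
    lemma = solve-∀

  sumOn-⟦⟧ : (P Q : Fin n → Bool) → sumOn P (λ i → ⟦ Q i ⟧) ≡ # (λ i → P i ∧ Q i)
  sumOn-⟦⟧ P Q = sum-cong λ i → sym (⟦∧⟧ (P i) (Q i))

  sumOn-true : (f : Fin n → ℕ) → sumOn (λ _ → true) f ≡ sum f
  sumOn-true f = sum-cong λ i → +-identityʳ (f i)

  sumOn-∨≤ : (P Q : Fin n → Bool) (f : Fin n → ℕ) →
    sumOn (λ i → P i ∨ Q i) f ≤ sumOn P f + sumOn Q f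
  sumOn-∨≤ P Q f = ≤-trans (sum-mono λ i → lemma (P i) (Q i) (f i)) (≤-reflexive (sum-+ _ _))
    where
    lemma : ∀ a b k → ⟦ a ∨ b ⟧ * k ≤ ⟦ a ⟧ * k + ⟦ b ⟧ * k
    lemma true  b k = m≤m+n (k + 0) (⟦ b ⟧ * k)
    lemma false b k = ≤-refl

  sumOn-split : (P Q : Fin n → Bool) (f : Fin n → ℕ) →
    sumOn P f ≡ sumOn (λ i → P i ∧ Q i) f + sumOn (λ i → P i ∧ not (Q i)) f
  sumOn-split P Q f = trans (sum-cong λ i → lemma (P i) (Q i) (f i)) (sum-+ _ _)
    where
    lemma : ∀ a b k → ⟦ a ⟧ * k ≡ ⟦ a ∧ b ⟧ * k + ⟦ a ∧ not b ⟧ * k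
    lemma true  true  k = sym (+-identityʳ (k + 0))
    lemma true  false k = refl
    lemma false _     k = refl

  term≤sumOn : (P : Fin n → Bool) (f : Fin n → ℕ) → ∀ {i} → P i ≡ true → f i ≤ sumOn P f
  term≤sumOn P f {i} Pi = begin
    f i                                  ≡⟨ sym (*-identityˡ (f i)) ⟩
    1 * f i                              ≡⟨ cong (_* f i) (sym (sum-δ i)) ⟩
    # (_== i) * f i                      ≡⟨ sym (sum-* (f i) _) ⟩
    sum (λ j → ⟦ j == i ⟧ * f i)         ≤⟨ sum-mono lemma ⟩
    sumOn P f                            ∎
    where
    open ≤-Reasoning
    lemma : ∀ j → ⟦ j == i ⟧ * f i ≤ ⟦ P j ⟧ * f j
    lemma j with j ≟ i
    ... | yes refl rewrite Pi = ≤-refl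
    ... | no _     = z≤n

  two-terms≤sumOn : (P : Fin n → Bool) (f : Fin n → ℕ) → ∀ {i j} → i ≢ j →
    P i ≡ true → P j ≡ true → f i + f j ≤ sumOn P f
  two-terms≤sumOn P f {i} {j} i≢j Pi Pj = begin
    f i + f j
      ≤⟨ +-mono-≤ (term≤sumOn (λ k → P k ∧ (k == i)) f (Pi ∧ᵗ ==-refl i))
                  (term≤sumOn (λ k → P k ∧ not (k == i)) f (Pj ∧ᵗ cong not (≢⇒== (i≢j ∘ sym)))) ⟩
    sumOn (λ k → P k ∧ (k == i)) f + sumOn (λ k → P k ∧ not (k == i)) f
      ≡⟨ sym (sumOn-split P (_== i) f) ⟩
    sumOn P f ∎
    where open ≤-Reasoning

opaque
  unfolding #

  three-elements : (P : Fin n → Bool) → ∀ {x y z} → x ≢ y → x ≢ z → y ≢ z →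
    P x ≡ true → P y ≡ true → P z ≡ true → 3 ≤ # P
  three-elements P {x} {y} {z} x≢y x≢z y≢z Px Py Pz = begin
    3 ≡⟨ sym (cong₂ _+_ (sum-δ x) (cong₂ _+_ (sum-δ y) (sum-δ z))) ⟩
    # (_== x) + (# (_== y) + # (_== z))
      ≡⟨ cong (# (_== x) +_) (sym (sum-+ _ _)) ⟩
    # (_== x) + sum (λ i → ⟦ i == y ⟧ + ⟦ i == z ⟧)
      ≡⟨ sym (sum-+ _ _) ⟩
    sum (λ i → ⟦ i == x ⟧ + (⟦ i == y ⟧ + ⟦ i == z ⟧))
      ≤⟨ sum-mono lemma ⟩
    # P ∎
    where
    open ≤-Reasoning
    lemma : ∀ i → ⟦ i == x ⟧ + (⟦ i == y ⟧ + ⟦ i == z ⟧) ≤ ⟦ P i ⟧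
    lemma i with i ≟ x | i ≟ y | i ≟ z
    ... | yes refl | yes p    | _        = contradiction p x≢y
    ... | yes refl | no _     | yes p    = contradiction p x≢z
    ... | yes refl | no _     | no _     = ≤-reflexive (sym (cong ⟦_⟧ Px))
    ... | no _     | yes refl | yes p    = contradiction p y≢z
    ... | no _     | yes refl | no _     = ≤-reflexive (sym (cong ⟦_⟧ Py))
    ... | no _     | no _     | yes refl = ≤-reflexive (sym (cong ⟦_⟧ Pz))
    ... | no _     | no _     | no _     = z≤n

  -- Meant for the two neighbours of a vertex on a cycle: knowing the one from which a walk has
  -- come, it produces the one to which it goes.
  other-element : (P : Fin n → Bool) → # P ≡ 2 → ∀ {x} → P x ≡ true →
    ∃ λ y → y ≢ x × P y ≡ true × (∀ z → P z ≡ true → z ≡ x ⊎ z ≡ y)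
  other-element P #P≡2 {x} Px
    with sum-<⇒∃ (λ i → ⟦ i == x ⟧) (λ i → ⟦ P i ⟧) (subst₂ _<_ (sym (sum-δ x)) (sym #P≡2) ≤-refl)
  ... | y , lt with y ≟ x | P y in Py
  ... | no y≢x | true = y , y≢x , Py , λ z Pz → only z Pz
    where
    only : ∀ z → P z ≡ true → z ≡ x ⊎ z ≡ y
    only z Pz with z ≟ x | z ≟ y
    ... | yes z≡x | _       = inj₁ z≡x
    ... | no _    | yes z≡y = inj₂ z≡y
    ... | no z≢x  | no z≢y  = contradiction
      (≤-trans (three-elements P (z≢x ∘ sym) (y≢x ∘ sym) z≢y Px Pz Py) (≤-reflexive #P≡2)) λ { (s≤s (s≤s ())) }
  ... | yes refl | true  = contradiction lt λ { (s≤s ()) }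
  ... | yes refl | false = contradiction lt λ ()

⊆∧#≥⇒⊇ : (P Q : Fin n → Bool) → (∀ i → P i ≡ true → Q i ≡ true) → # Q ≤ # P →
  ∀ i → Q i ≡ true → P i ≡ true
⊆∧#≥⇒⊇ P Q P⊆Q #Q≤#P i Qi with P i in eq
... | true  = refl
... | false = ⊥-elim (<-irrefl refl (begin-strict
  # P                                  ≡⟨ +-identityʳ (# P) ⟨
  # P + 0                              <⟨ +-monoʳ-< (# P) (∃⇒#>0 (λ i → Q i ∧ not (P i)) (Qi ∧ᵗ cong not eq)) ⟩
  # P + # (λ i → Q i ∧ not (P i))      ≤⟨ +-monoˡ-≤ _ (#-mono λ j Pj → P⊆Q j Pj ∧ᵗ Pj) ⟩
  # (λ i → Q i ∧ P i) + # (λ i → Q i ∧ not (P i)) ≡⟨ #-split Q P ⟨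
  # Q                                  ≤⟨ #Q≤#P ⟩
  # P ∎))
  where open ≤-Reasoning

-- Counting faces

lookup-∪ : (σ τ : Subset n) (i : Fin n) → lookup (σ ∪ τ) i ≡ lookup σ i ∨ lookup τ i
lookup-∪ σ τ i = lookup-zipWith _∨_ i σ τ

lookup-⁅⁆ : (i : Fin n) → lookup ⁅ i ⁆ i ≡ true
lookup-⁅⁆ i = []=⇒lookup (x∈⁅x⁆ i)

lookup-⁅⁆⇒≡ : (i j : Fin n) → lookup ⁅ i ⁆ j ≡ true → j ≡ i
lookup-⁅⁆⇒≡ i j p = x∈⁅y⁆⇒x≡y i (lookup⇒[]= j ⁅ i ⁆ p)

lookup-∅ : (i : Fin n) → lookup ∅ i ≡ false
lookup-∅ zero    = refl
lookup-∅ (suc i) = lookup-∅ i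

countᵇ-cong : {A : Set} {p q : A → Bool} → (∀ x → p x ≡ q x) → ∀ xs → countᵇ p xs ≡ countᵇ q xs
countᵇ-cong p≗q []       = refl
countᵇ-cong {q = q} p≗q (x ∷ xs) rewrite p≗q x with q x
... | true  = cong suc (countᵇ-cong p≗q xs)
... | false = countᵇ-cong p≗q xs

countᵇ-∷ : {A : Set} (p : A → Bool) (x : A) (xs : List A) → countᵇ p (x ∷ xs) ≡ ⟦ p x ⟧ + countᵇ p xs
countᵇ-∷ p x xs with p x
... | true  = refl
... | false = refl

countᵇ-++ : {A : Set} (p : A → Bool) (xs ys : List A) → countᵇ p (xs ++ ys) ≡ countᵇ p xs + countᵇ p ys
countᵇ-++ p []       ys = refl
countᵇ-++ p (x ∷ xs) ys with p x
... | true  = cong suc (countᵇ-++ p xs ys)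
... | false = countᵇ-++ p xs ys

countᵇ-map : {A B : Set} (p : B → Bool) (f : A → B) (xs : List A) → countᵇ p (map f xs) ≡ countᵇ (p ∘ f) xs
countᵇ-map p f []       = refl
countᵇ-map p f (x ∷ xs) with p (f x)
... | true  = cong suc (countᵇ-map p f xs)
... | false = countᵇ-map p f xs

countᵇ-false : {A : Set} (xs : List A) → countᵇ (λ _ → false) xs ≡ 0
countᵇ-false []       = refl
countᵇ-false (x ∷ xs) = countᵇ-false xs

countᵇ-subsets : (p : Subset (suc n) → Bool) → countᵇ p (allSubsets (suc n)) ≡
  countᵇ (p ∘ (true ∷_)) (allSubsets n) + countᵇ (p ∘ (false ∷_)) (allSubsets n)
countᵇ-subsets {n} p = trans (countᵇ-++ p (map (true ∷_) (allSubsets n)) _)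
  (cong₂ _+_ (countᵇ-map p (true ∷_) (allSubsets n)) (countᵇ-map p (false ∷_) (allSubsets n)))

∣∣≡sum : (σ : Subset n) → ∣ σ ∣ ≡ sum (λ i → ⟦ lookup σ i ⟧)
∣∣≡sum []          = sym (trans (sum-cong λ ()) (sum-zero 0))
∣∣≡sum (true ∷ σ)  = trans (cong suc (∣∣≡sum σ)) (sym (sum-suc _))
∣∣≡sum (false ∷ σ) = trans (∣∣≡sum σ) (sym (sum-suc _))

∣∣>0 : (σ : Subset n) (i : Fin n) → lookup σ i ≡ true → (∣ σ ∣ ≡ᵇ 0) ≡ false
∣∣>0 (true ∷ σ)  i       _ = refl
∣∣>0 (false ∷ σ) (suc i) p = ∣∣>0 σ i p

∣∪⁅⁆∣ : (σ : Subset n) (i : Fin n) → lookup σ i ≡ false → ∣ σ ∪ ⁅ i ⁆ ∣ ≡ suc ∣ σ ∣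
∣∪⁅⁆∣ (false ∷ σ) zero    _ = cong (suc ∘ ∣_∣) (∪-identityʳ σ)
∣∪⁅⁆∣ (true ∷ σ)  (suc i) p = cong suc (∣∪⁅⁆∣ σ i p)
∣∪⁅⁆∣ (false ∷ σ) (suc i) p = ∣∪⁅⁆∣ σ i p

-- Deleting `i` is a bijection, realised here by recursion on `i`. Behind a head that belongs to the
-- set the size drops by one, so `k = 0` is separate: then both counts vanish, the left one because
-- a set containing `i` is not empty.
count-containing : (P : FacePred n) (i : Fin n) (k : ℕ) →
  countᵇ (λ σ → lookup σ i ∧ P σ ∧ (∣ σ ∣ ≡ᵇ suc k)) (allSubsets n) ≡ facesOfSize (link P i) k
count-containing {suc n} P zero k = begin
  countᵇ (λ σ → lookup σ zero ∧ P σ ∧ (∣ σ ∣ ≡ᵇ suc k)) (allSubsets (suc n))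
    ≡⟨ countᵇ-subsets (λ σ → lookup σ zero ∧ P σ ∧ (∣ σ ∣ ≡ᵇ suc k)) ⟩
  countᵇ (λ σ → P (true ∷ σ) ∧ (∣ σ ∣ ≡ᵇ k)) (allSubsets n) + countᵇ (λ _ → false) (allSubsets n)
    ≡⟨ +-comm _ (countᵇ (λ _ → false) (allSubsets n)) ⟩
  countᵇ (λ _ → false) (allSubsets n) + countᵇ (λ σ → P (true ∷ σ) ∧ (∣ σ ∣ ≡ᵇ k)) (allSubsets n)
    ≡⟨ cong (countᵇ (λ _ → false) (allSubsets n) +_)
         (countᵇ-cong (λ σ → cong (λ τ → P (true ∷ τ) ∧ (∣ σ ∣ ≡ᵇ k)) (sym (∪-identityʳ σ))) (allSubsets n)) ⟩
  countᵇ (λ _ → false) (allSubsets n) + countᵇ (λ σ → P (true ∷ (σ ∪ ∅)) ∧ (∣ σ ∣ ≡ᵇ k)) (allSubsets n)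
    ≡⟨ sym (countᵇ-subsets (λ σ → link P zero σ ∧ (∣ σ ∣ ≡ᵇ k))) ⟩
  facesOfSize (link P zero) k ∎
  where open ≡-Reasoning
count-containing {suc n} P (suc i) k = trans (countᵇ-subsets (λ σ → lookup σ (suc i) ∧ P σ ∧ (∣ σ ∣ ≡ᵇ suc k)))
  (trans (cong₂ _+_ (containing-true k) (count-containing (P ∘ (false ∷_)) i k))
         (sym (countᵇ-subsets (λ σ → link P (suc i) σ ∧ (∣ σ ∣ ≡ᵇ k)))))
  where
  containing-true : ∀ k → countᵇ (λ σ → lookup σ i ∧ P (true ∷ σ) ∧ (∣ σ ∣ ≡ᵇ k)) (allSubsets n) ≡
    countᵇ (λ σ → link P (suc i) (true ∷ σ) ∧ (suc ∣ σ ∣ ≡ᵇ k)) (allSubsets n)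
  containing-true (suc k) = count-containing (P ∘ (true ∷_)) i k
  containing-true zero    = countᵇ-cong empty (allSubsets n)
    where
    empty : ∀ σ → lookup σ i ∧ P (true ∷ σ) ∧ (∣ σ ∣ ≡ᵇ 0) ≡ link P (suc i) (true ∷ σ) ∧ false
    empty σ with lookup σ i in eq
    ... | false = sym (∧-zeroʳ (P (true ∷ (σ ∪ ⁅ i ⁆))))
    ... | true  rewrite ∣∣>0 σ i eq = ∧-zeroʳ (P (true ∷ σ))

countᵇ-incidences : (R : Subset n → Bool) (k : ℕ) → (∀ σ → R σ ≡ true → ∣ σ ∣ ≡ k) → ∀ xs →
  sum (λ i → countᵇ (λ σ → lookup σ i ∧ R σ) xs) ≡ k * countᵇ R xs
countᵇ-incidences {n} R k size []       = trans (sum-zero n) (sym (*-zeroʳ k))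
countᵇ-incidences {n} R k size (σ ∷ xs) = begin
  sum (λ i → countᵇ (λ σ → lookup σ i ∧ R σ) (σ ∷ xs))
    ≡⟨ sum-cong (λ i → countᵇ-∷ _ σ xs) ⟩
  sum (λ i → ⟦ lookup σ i ∧ R σ ⟧ + countᵇ (λ σ → lookup σ i ∧ R σ) xs)
    ≡⟨ sum-+ _ _ ⟩
  sum (λ i → ⟦ lookup σ i ∧ R σ ⟧) + sum (λ i → countᵇ (λ σ → lookup σ i ∧ R σ) xs)
    ≡⟨ cong₂ _+_ head (countᵇ-incidences R k size xs) ⟩
  k * ⟦ R σ ⟧ + k * countᵇ R xs
    ≡⟨ sym (*-distribˡ-+ k _ _) ⟩
  k * (⟦ R σ ⟧ + countᵇ R xs)
    ≡⟨ cong (k *_) (sym (countᵇ-∷ R σ xs)) ⟩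
  k * countᵇ R (σ ∷ xs) ∎
  where
  open ≡-Reasoning
  head : sum (λ i → ⟦ lookup σ i ∧ R σ ⟧) ≡ k * ⟦ R σ ⟧
  head with R σ in eq
  ... | false = trans (sum-cong λ i → cong ⟦_⟧ (∧-zeroʳ (lookup σ i))) (trans (sum-zero n) (sym (*-zeroʳ k)))
  ... | true  = trans (sum-cong λ i → cong ⟦_⟧ (∧-comm (lookup σ i) true))
                (trans (sym (∣∣≡sum σ)) (trans (size σ eq) (sym (*-identityʳ k))))

facesOfSize-link : (P : FacePred n) (k : ℕ) →
  sum (λ i → facesOfSize (link P i) k) ≡ suc k * facesOfSize P (suc k)
facesOfSize-link {n} P k = trans (sum-cong λ i → sym (count-containing P i k))
  (countᵇ-incidences (λ σ → P σ ∧ (∣ σ ∣ ≡ᵇ suc k)) (suc k)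
    (λ σ p → ≡ᵇ-true⇒≡ (proj₂ (∧-true {P σ} p))) (allSubsets n))

facesOfSize-0 : (P : FacePred n) → facesOfSize P 0 ≡ ⟦ P ∅ ⟧
facesOfSize-0 {zero} P with P []
... | true  = refl
... | false = refl
facesOfSize-0 {suc n} P = trans (countᵇ-subsets (λ σ → P σ ∧ (∣ σ ∣ ≡ᵇ 0)))
  (trans (cong₂ _+_ (trans (countᵇ-cong (λ σ → ∧-zeroʳ (P (true ∷ σ))) (allSubsets n)) (countᵇ-false (allSubsets n)))
                    (facesOfSize-0 (P ∘ (false ∷_))))
         refl)

∅⊆ᵇ : (σ : Subset n) → ∅ ⊆ᵇ σ ≡ true
∅⊆ᵇ []      = refl
∅⊆ᵇ (x ∷ σ) = ∅⊆ᵇ σ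

⁅⁆⊆ᵇ : (i : Fin n) (σ : Subset n) → ⁅ i ⁆ ⊆ᵇ σ ≡ lookup σ i
⁅⁆⊆ᵇ zero    (x ∷ σ) rewrite ∅⊆ᵇ σ = trans (∧-comm x true) refl
⁅⁆⊆ᵇ (suc i) (x ∷ σ) = ⁅⁆⊆ᵇ i σ

∪⊆ᵇ : (ρ σ τ : Subset n) → (ρ ∪ σ) ⊆ᵇ τ ≡ (ρ ⊆ᵇ τ) ∧ (σ ⊆ᵇ τ)
∪⊆ᵇ []      []      []      = refl
∪⊆ᵇ (x ∷ ρ) (y ∷ σ) (z ∷ τ) rewrite ∪⊆ᵇ ρ σ τ = lemma x y z (ρ ⊆ᵇ τ) (σ ⊆ᵇ τ)
  where
  lemma : ∀ x y z a b → (not (x ∨ y) ∨ z) ∧ a ∧ b ≡ ((not x ∨ z) ∧ a) ∧ (not y ∨ z) ∧ b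
  lemma false false z     true  b = refl
  lemma false false z     false b = refl
  lemma false true  true  true  b = refl
  lemma false true  true  false b = refl
  lemma false true  false a     b = sym (∧-zeroʳ _)
  lemma true  y     false a     b = refl
  lemma true  true  true  true  b = refl
  lemma true  true  true  false b = refl
  lemma true  false true  true  b = refl
  lemma true  false true  false b = refl

edge⊆ᵇ : (i j : Fin n) (σ : Subset n) → edge i j ⊆ᵇ σ ≡ lookup σ i ∧ lookup σ j
edge⊆ᵇ i j σ = trans (∪⊆ᵇ ⁅ i ⁆ ⁅ j ⁆ σ) (cong₂ _∧_ (⁅⁆⊆ᵇ i σ) (⁅⁆⊆ᵇ j σ))

-- Clique complexes

-- The vertex set `A` is kept apart from the ground set and from `adj`, so that the notion passes to
-- links: the link of `v` has the same `adj` and the vertex set of all neighbours of `v` in `A`.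
record IsCliqueComplex (adj : Fin n → Fin n → Bool) (P : FacePred n) (A : Fin n → Bool) : Set where
  field
    irreflexive : ∀ i → adj i i ≡ false
    support     : ∀ σ i → P σ ≡ true → lookup σ i ≡ true → A i ≡ true
    pairwise    : ∀ σ i j → P σ ≡ true → lookup σ i ≡ true → lookup σ j ≡ true → i ≢ j → adj i j ≡ true
    clique      : ∀ σ → (∀ i → lookup σ i ≡ true → A i ≡ true) →
      (∀ i j → lookup σ i ≡ true → lookup σ j ≡ true → i ≢ j → adj i j ≡ true) → P σ ≡ true

link⇒ : (P : FacePred n) (v : Fin n) (σ : Subset n) → link P v σ ≡ true → lookup σ v ≡ false × P (σ ∪ ⁅ v ⁆) ≡ true
link⇒ P v σ p = let q , r = ∧-true p in not-true q , r

module _ {n : ℕ} {adj : Fin n → Fin n → Bool} {P : FacePred n} {A : Fin n → Bool} (C : IsCliqueComplex adj P A) where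
  open IsCliqueComplex C

  adjacent⇒≢ : ∀ {i j : Fin n} → adj i j ≡ true → i ≢ j
  adjacent⇒≢ {i} p refl = true≢false p (irreflexive i)

  private
    inˡ : (σ : Subset n) (v i : Fin n) → lookup σ i ≡ true → lookup (σ ∪ ⁅ v ⁆) i ≡ true
    inˡ σ v i p = trans (lookup-∪ σ ⁅ v ⁆ i) (∨-trueˡ p)

    inʳ : (σ : Subset n) (v : Fin n) → lookup (σ ∪ ⁅ v ⁆) v ≡ true
    inʳ σ v = trans (lookup-∪ σ ⁅ v ⁆ v) (∨-trueʳ (lookup-⁅⁆ v))

    in⇒ : (σ : Subset n) (v i : Fin n) → lookup (σ ∪ ⁅ v ⁆) i ≡ true → lookup σ i ≡ true ⊎ i ≡ v
    in⇒ σ v i p with ∨-true (trans (sym (lookup-∪ σ ⁅ v ⁆ i)) p)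
    ... | inj₁ q = inj₁ q
    ... | inj₂ q = inj₂ (lookup-⁅⁆⇒≡ v i q)

  link-isCliqueComplex : (∀ i j → adj i j ≡ adj j i) → ∀ {v} → A v ≡ true →
    IsCliqueComplex adj (link P v) (λ i → A i ∧ adj v i)
  link-isCliqueComplex adj-sym {v} Av = record
    { irreflexive = irreflexive
    ; support     = λ σ i p q → let σ∌v , r = link⇒ P v σ p in
        support (σ ∪ ⁅ v ⁆) i r (inˡ σ v i q) ∧ᵗ
        pairwise (σ ∪ ⁅ v ⁆) v i r (inʳ σ v) (inˡ σ v i q) (λ { refl → true≢false q σ∌v })
    ; pairwise    = λ σ i j p q r i≢j → let _ , s = link⇒ P v σ p in
        pairwise (σ ∪ ⁅ v ⁆) i j s (inˡ σ v i q) (inˡ σ v j r) i≢j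
    ; clique      = λ σ supp pw → cong not (σ∌v σ supp) ∧ᵗ clique (σ ∪ ⁅ v ⁆)
        (λ i p → [ (λ q → proj₁ (∧-true (supp i q))) , (λ { refl → Av }) ]′ (in⇒ σ v i p))
        (λ i j p q i≢j → pair σ supp pw i j (in⇒ σ v i p) (in⇒ σ v j q) i≢j)
    }
    where
    σ∌v : (σ : Subset n) → (∀ i → lookup σ i ≡ true → A i ∧ adj v i ≡ true) → lookup σ v ≡ false
    σ∌v σ supp with lookup σ v in eq
    ... | false = refl
    ... | true  = true≢false (proj₂ (∧-true {A v} (supp v eq))) (irreflexive v)
    pair : (σ : Subset n) → (∀ i → lookup σ i ≡ true → A i ∧ adj v i ≡ true) →
      (∀ i j → lookup σ i ≡ true → lookup σ j ≡ true → i ≢ j → adj i j ≡ true) →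
      ∀ i j → lookup σ i ≡ true ⊎ i ≡ v → lookup σ j ≡ true ⊎ j ≡ v → i ≢ j → adj i j ≡ true
    pair σ supp pw i j (inj₁ p)    (inj₁ q)    i≢j = pw i j p q i≢j
    pair σ supp pw i j (inj₁ p)    (inj₂ refl) i≢j = trans (adj-sym i j) (proj₂ (∧-true {A i} (supp i p)))
    pair σ supp pw i j (inj₂ refl) (inj₁ q)    i≢j = proj₂ (∧-true {A j} (supp j q))
    pair σ supp pw i j (inj₂ refl) (inj₂ refl) i≢j = contradiction refl i≢j

  ∅-face : P ∅ ≡ true
  ∅-face = clique ∅ (λ i p → true≢false p (lookup-∅ i)) (λ i _ p → true≢false p (lookup-∅ i))

  vertex-face : ∀ {i} → A i ≡ true → P ⁅ i ⁆ ≡ true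
  vertex-face {i} Ai = clique ⁅ i ⁆ (λ j p → subst (λ k → A k ≡ true) (sym (lookup-⁅⁆⇒≡ i j p)) Ai)
    (λ j k p q j≢k → contradiction (trans (lookup-⁅⁆⇒≡ i j p) (sym (lookup-⁅⁆⇒≡ i k q))) j≢k)

  facesOfSize-suc : (k : ℕ) → suc k * facesOfSize P (suc k) ≡ sumOn A (λ i → facesOfSize (link P i) k)
  facesOfSize-suc k = trans (sym (facesOfSize-link P k)) (trans (sum-cong lemma) (sym (sumOn-sum A _)))
    where
    no-link : ∀ {i} → A i ≡ false → ∀ σ → link P i σ ≡ false
    no-link {i} ¬Ai σ with link P i σ in eq
    ... | false = refl
    ... | true  = true≢false (support (σ ∪ ⁅ i ⁆) i (proj₂ (link⇒ P i σ eq)) (inʳ σ i)) ¬Ai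
    lemma : ∀ i → facesOfSize (link P i) k ≡ ⟦ A i ⟧ * facesOfSize (link P i) k
    lemma i with A i in eq
    ... | true  = sym (+-identityʳ _)
    ... | false = trans (countᵇ-cong (λ σ → cong (_∧ (∣ σ ∣ ≡ᵇ k)) (no-link eq σ)) (allSubsets n))
                        (countᵇ-false (allSubsets n))

∣edge∣ : {i j : Fin n} → i ≢ j → ∣ edge i j ∣ ≡ 2
∣edge∣ {i = i} {j} i≢j = trans (∣∪⁅⁆∣ ⁅ i ⁆ j j∉i) (cong suc (∣⁅x⁆∣≡1 i))
  where
  j∉i : lookup ⁅ i ⁆ j ≡ false
  j∉i with lookup ⁅ i ⁆ j in eq
  ... | true  = contradiction (sym (lookup-⁅⁆⇒≡ i j eq)) i≢j
  ... | false = refl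

lookup-edge : (i j k : Fin n) → lookup (edge i j) k ≡ true → k ≡ i ⊎ k ≡ j
lookup-edge i j k p with ∨-true (trans (sym (lookup-∪ ⁅ i ⁆ ⁅ j ⁆ k)) p)
... | inj₁ q = inj₁ (lookup-⁅⁆⇒≡ i k q)
... | inj₂ q = inj₂ (lookup-⁅⁆⇒≡ j k q)

edge-face : {adj : Fin n → Fin n → Bool} {P : FacePred n} {A : Fin n → Bool} →
  IsCliqueComplex adj P A → (∀ i j → adj i j ≡ adj j i) →
  ∀ {i j} → A i ≡ true → A j ≡ true → adj i j ≡ true → P (edge i j) ≡ true
edge-face {n} {adj} {A = A} C adj-sym {i} {j} Ai Aj ij = IsCliqueComplex.clique C (edge i j)
  (λ k p → [ (λ { refl → Ai }) , (λ { refl → Aj }) ]′ (lookup-edge i j k p))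
  (λ k l p q k≢l → pair (lookup-edge i j k p) (lookup-edge i j l q) k≢l)
  where
  pair : ∀ {k l} → k ≡ i ⊎ k ≡ j → l ≡ i ⊎ l ≡ j → k ≢ l → adj k l ≡ true
  pair (inj₁ refl) (inj₁ refl) k≢l = contradiction refl k≢l
  pair (inj₁ refl) (inj₂ refl) k≢l = ij
  pair (inj₂ refl) (inj₁ refl) k≢l = trans (adj-sym j i) ij
  pair (inj₂ refl) (inj₂ refl) k≢l = contradiction refl k≢l

-- From v - e + f = 2 and 3f = 2e one gets e = 3v - 6, here for the degree sum `s` = 2e. The factor
-- 6 appears because triangles are counted with an order of their vertices.
euler-arithmetic : ∀ a b c x s → a + c ≡ b + 2 → a ≡ x → 2 * b ≡ s → 6 * c ≡ 2 * s → s + 12 ≡ 6 * x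
euler-arithmetic a b c .a .(2 * b) e refl refl h = +-cancelˡ-≡ (6 * c) _ _ (begin
  6 * c + (2 * b + 12)       ≡⟨ cong (_+ (2 * b + 12)) h ⟩
  2 * (2 * b) + (2 * b + 12) ≡⟨ lemma₁ b ⟩
  6 * (b + 2)                ≡⟨ cong (6 *_) (sym e) ⟩
  6 * (a + c)                ≡⟨ lemma₂ a c ⟩
  6 * c + 6 * a              ∎)
  where
  open ≡-Reasoning
  lemma₁ : ∀ b → 2 * (2 * b) + (2 * b + 12) ≡ 6 * (b + 2)
  lemma₁ = solve-∀
  lemma₂ : ∀ a c → 6 * (a + c) ≡ 6 * c + 6 * a
  lemma₂ = solve-∀

faces₀ : {adj : Fin n → Fin n → Bool} {P : FacePred n} {A : Fin n → Bool} →
  IsCliqueComplex adj P A → facesOfSize P 0 ≡ 1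
faces₀ {P = P} C = trans (facesOfSize-0 P) (cong ⟦_⟧ (∅-face C))

module _ {n : ℕ} {adj : Fin n → Fin n → Bool} (adj-sym : ∀ i j → adj i j ≡ adj j i) where

  private
    linkC : {P : FacePred n} {A : Fin n → Bool} → IsCliqueComplex adj P A → ∀ {v} → A v ≡ true →
      IsCliqueComplex adj (link P v) (λ i → A i ∧ adj v i)
    linkC C = link-isCliqueComplex C adj-sym

  faces₁ : {P : FacePred n} {A : Fin n → Bool} → IsCliqueComplex adj P A → facesOfSize P 1 ≡ # A
  faces₁ {P} {A} C = begin
    facesOfSize P 1                              ≡⟨ +-identityʳ _ ⟨
    1 * facesOfSize P 1                          ≡⟨ facesOfSize-suc C 0 ⟩
    sumOn A (λ i → facesOfSize (link P i) 0)     ≡⟨ sumOn-cong A (λ i Ai → faces₀ (linkC C Ai)) ⟩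
    sumOn A (λ _ → 1)                            ≡⟨ sumOn-const A 1 ⟩
    # A * 1                                      ≡⟨ *-identityʳ _ ⟩
    # A                                          ∎
    where open ≡-Reasoning

  faces₂ : {P : FacePred n} {A : Fin n → Bool} → IsCliqueComplex adj P A →
    2 * facesOfSize P 2 ≡ sumOn A (λ i → # (λ j → A j ∧ adj i j))
  faces₂ {P} {A} C = trans (facesOfSize-suc C 1) (sumOn-cong A (λ i Ai → faces₁ (linkC C Ai)))

  faces₃ : {P : FacePred n} {A : Fin n → Bool} → IsCliqueComplex adj P A →
    6 * facesOfSize P 3 ≡ sumOn A (λ i → sumOn (λ j → A j ∧ adj i j) (λ j → # (λ k → (A k ∧ adj i k) ∧ adj j k)))
  faces₃ {P} {A} C = begin
    6 * facesOfSize P 3                                ≡⟨ *-assoc 2 3 (facesOfSize P 3) ⟩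
    2 * (3 * facesOfSize P 3)                          ≡⟨ cong (2 *_) (facesOfSize-suc C 2) ⟩
    2 * sumOn A (λ i → facesOfSize (link P i) 2)       ≡⟨ sumOn-* A 2 _ ⟨
    sumOn A (λ i → 2 * facesOfSize (link P i) 2)       ≡⟨ sumOn-cong A (λ i Ai → faces₂ (linkC C Ai)) ⟩
    sumOn A (λ i → sumOn (λ j → A j ∧ adj i j) (λ j → # (λ k → (A k ∧ adj i k) ∧ adj j k))) ∎
    where open ≡-Reasoning

  -- Peeling off `i` and then `j` turns the triangles into the vertices of the iterated link, that
  -- is, into common neighbours.
  triangles-containing-edge : {P : FacePred n} {A : Fin n → Bool} → IsCliqueComplex adj P A →
    ∀ {i j} → A i ≡ true → A j ≡ true → adj i j ≡ true →
    countᵇ (λ τ → P τ ∧ (∣ τ ∣ ≡ᵇ 3) ∧ (edge i j ⊆ᵇ τ)) (allSubsets n) ≡ # (λ k → (A k ∧ adj i k) ∧ adj j k)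
  triangles-containing-edge {P} {A} C {i} {j} Ai Aj ij = begin
    countᵇ (λ τ → P τ ∧ (∣ τ ∣ ≡ᵇ 3) ∧ (edge i j ⊆ᵇ τ)) (allSubsets n)
      ≡⟨ countᵇ-cong (λ τ → trans (cong (λ b → P τ ∧ (∣ τ ∣ ≡ᵇ 3) ∧ b) (edge⊆ᵇ i j τ))
           (rearrange (P τ) (∣ τ ∣ ≡ᵇ 3) (lookup τ i) (lookup τ j))) (allSubsets n) ⟩
    countᵇ (λ τ → lookup τ i ∧ (lookup τ j ∧ P τ) ∧ (∣ τ ∣ ≡ᵇ 3)) (allSubsets n)
      ≡⟨ count-containing (λ τ → lookup τ j ∧ P τ) i 2 ⟩
    countᵇ (λ σ → link (λ τ → lookup τ j ∧ P τ) i σ ∧ (∣ σ ∣ ≡ᵇ 2)) (allSubsets n)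
      ≡⟨ countᵇ-cong (λ σ → trans (cong (λ b → (not (lookup σ i) ∧ b ∧ P (σ ∪ ⁅ i ⁆)) ∧ (∣ σ ∣ ≡ᵇ 2)) (j∈ σ))
           (rearrange′ (not (lookup σ i)) (lookup σ j) (P (σ ∪ ⁅ i ⁆)) (∣ σ ∣ ≡ᵇ 2))) (allSubsets n) ⟩
    countᵇ (λ σ → lookup σ j ∧ link P i σ ∧ (∣ σ ∣ ≡ᵇ 2)) (allSubsets n)
      ≡⟨ count-containing (link P i) j 1 ⟩
    facesOfSize (link (link P i) j) 1
      ≡⟨ faces₁ (linkC (linkC C Ai) (Aj ∧ᵗ ij)) ⟩
    # (λ k → (A k ∧ adj i k) ∧ adj j k) ∎
    where
    open ≡-Reasoning
    rearrange : ∀ a b c d → a ∧ b ∧ c ∧ d ≡ c ∧ (d ∧ a) ∧ b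
    rearrange true  true  c     d = cong (c ∧_) (sym (trans (∧-identityʳ _) (∧-identityʳ d)))
    rearrange true  false c     d = sym (trans (cong (c ∧_) (∧-zeroʳ _)) (∧-zeroʳ c))
    rearrange false b     c     d = sym (trans (cong (λ x → c ∧ x ∧ b) (∧-zeroʳ d)) (∧-zeroʳ c))
    rearrange′ : ∀ a b c d → (a ∧ b ∧ c) ∧ d ≡ b ∧ (a ∧ c) ∧ d
    rearrange′ a true  c d = refl
    rearrange′ a false c d = cong (_∧ d) (∧-zeroʳ a)
    j∈ : ∀ σ → lookup (σ ∪ ⁅ i ⁆) j ≡ lookup σ j
    j∈ σ with lookup ⁅ i ⁆ j in eq
    ... | true  = contradiction (sym (lookup-⁅⁆⇒≡ i j eq)) (adjacent⇒≢ C ij)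
    ... | false = trans (lookup-∪ σ ⁅ i ⁆ j) (trans (cong (lookup σ j ∨_) eq) (∨-identityʳ _))

  sphere-degree-sum : {P : FacePred n} {A : Fin n → Bool} → IsCliqueComplex adj P A → Is2Sphere P →
    sumOn A (λ i → # (λ j → A j ∧ adj i j)) + 12 ≡ 6 * # A
  sphere-degree-sum {P} {A} C S = euler-arithmetic (facesOfSize P 1) (facesOfSize P 2) (facesOfSize P 3) _ _
    (Is2Sphere.euler S) (faces₁ C) (faces₂ C) (trans (faces₃ C) (trans (sumOn-cong A two-triangles) (sumOn-* A 2 _)))
    where
    two-triangles : ∀ i → A i ≡ true →
      sumOn (λ j → A j ∧ adj i j) (λ j → # (λ k → (A k ∧ adj i k) ∧ adj j k)) ≡ 2 * # (λ j → A j ∧ adj i j)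
    two-triangles i Ai = trans (sumOn-cong (λ j → A j ∧ adj i j) λ j p → link-cycle i j Ai (∧-true p))
                               (trans (sumOn-const _ 2) (*-comm (# (λ j → A j ∧ adj i j)) 2))
      where
      link-cycle : ∀ i j → A i ≡ true → A j ≡ true × adj i j ≡ true → # (λ k → (A k ∧ adj i k) ∧ adj j k) ≡ 2
      link-cycle i j Ai (Aj , ij) = trans (sym (triangles-containing-edge C Ai Aj ij))
        (Is2Sphere.edge-in-two S (edge i j) (edge-face C adj-sym Ai Aj ij) (∣edge∣ (adjacent⇒≢ C ij)))

-- The 1-skeleton of a flag 3-manifold

-- All that the combinatorial argument uses of the manifold. `lk u v` is the vertex set of the link
-- of the edge `uv`; connectedness is an induction principle for Boolean predicates, which is the
-- form in which properties are spread along a cycle.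
record SphericalGraph (n : ℕ) : Set where
  field
    adj     : Fin n → Fin n → Bool
    adj-sym : ∀ i j → adj i j ≡ adj j i
    adj-irr : ∀ i → adj i i ≡ false

  lk : Fin n → Fin n → Fin n → Bool
  lk u v x = adj u x ∧ adj v x

  field
    link-degree-sum : ∀ v → sumOn (adj v) (λ u → # (lk v u)) + 12 ≡ 6 * # (adj v)
    lk-2-regular : ∀ {u v x} → adj u v ≡ true → lk u v x ≡ true → # (λ y → lk u v y ∧ adj x y) ≡ 2
    lk-connected : ∀ {u v x} → adj u v ≡ true → (P : Fin n → Bool) →
      (∀ x y → P x ≡ true → lk u v y ≡ true → adj x y ≡ true → P y ≡ true) →
      lk u v x ≡ true → P x ≡ true → ∀ y → lk u v y ≡ true → P y ≡ true
    lk-nonempty  : ∀ {u v} → adj u v ≡ true → ∃ λ x → lk u v x ≡ true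
    lk-no-triangle : ∀ {u v x y z} → adj u v ≡ true → lk u v x ≡ true → lk u v y ≡ true → lk u v z ≡ true →
      adj x y ≡ true → adj x z ≡ true → adj y z ≡ true → ⊥

module _ {n : ℕ} (M : SimplicialComplex n) (flag : IsFlag M) where

  skeleton : Fin n → Fin n → Bool
  skeleton i j = face M (edge i j) ∧ not (i == j)

  skeleton-sym : ∀ i j → skeleton i j ≡ skeleton j i
  skeleton-sym i j = cong₂ (λ σ b → face M σ ∧ not b) (∪-comm ⁅ i ⁆ ⁅ j ⁆) ==-sym
    where
    ==-sym : i == j ≡ j == i
    ==-sym with i ≟ j
    ... | yes refl = sym (==-refl i)
    ... | no i≢j   = sym (≢⇒== (i≢j ∘ sym))

  skeleton-irr : ∀ i → skeleton i i ≡ false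
  skeleton-irr i rewrite ==-refl i = ∧-zeroʳ (face M (edge i i))

  private
    edge-⊆ : ∀ (σ : Subset n) i j → lookup σ i ≡ true → lookup σ j ≡ true → edge i j ⊆ σ
    edge-⊆ σ i j p q {x} x∈e with lookup-edge i j x ([]=⇒lookup x∈e)
    ... | inj₁ refl = lookup⇒[]= i σ p
    ... | inj₂ refl = lookup⇒[]= j σ q

  face-isCliqueComplex : IsCliqueComplex skeleton (face M) (λ _ → true)
  face-isCliqueComplex = record
    { irreflexive = skeleton-irr
    ; support     = λ _ _ _ _ → refl
    ; pairwise    = λ σ i j p q r i≢j → down-closed M (edge-⊆ σ i j q r) p ∧ᵗ cong not (≢⇒== i≢j)
    ; clique      = λ σ _ pw → flag σ λ i j p q → pair σ pw i j p q
    }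
    where
    pair : ∀ (σ : Subset n) → (∀ i j → lookup σ i ≡ true → lookup σ j ≡ true → i ≢ j → skeleton i j ≡ true) →
      ∀ i j → lookup σ i ≡ true → lookup σ j ≡ true → face M (edge i j) ≡ true
    pair σ pw i j p q with i ≟ j
    ... | yes refl = subst (λ τ → face M τ ≡ true) (sym (∪-idem ⁅ i ⁆)) (vertices M i)
    ... | no i≢j   = proj₁ (∧-true (pw i j p q i≢j))

  twice-f₁ : 2 * f₁ M ≡ sum (λ i → # (skeleton i))
  twice-f₁ = trans (faces₂ skeleton-sym face-isCliqueComplex) (sumOn-true _)

  module _ (manifold : IsClosed3Manifold M) where
    private
      linkC : ∀ v → IsCliqueComplex skeleton (link (face M) v) (skeleton v)
      linkC v = link-isCliqueComplex face-isCliqueComplex skeleton-sym refl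

      linkC₂ : ∀ {u v} → skeleton u v ≡ true →
        IsCliqueComplex skeleton (link (link (face M) u) v) (λ i → skeleton u i ∧ skeleton v i)
      linkC₂ {u} uv = link-isCliqueComplex (linkC u) skeleton-sym uv

    skeleton-link-nonempty : ∀ {u v} → skeleton u v ≡ true → ∃ λ x → skeleton u x ∧ skeleton v x ≡ true
    skeleton-link-nonempty {u} {v} uv with Is2Sphere.pure (manifold u) ⁅ v ⁆ (vertex-face (linkC u) uv)
    ... | τ , v⊆τ , Pτ , ∣τ∣≡3
      with sum-<⇒∃ (λ i → ⟦ i == v ⟧) (λ i → ⟦ lookup τ i ⟧)
             (subst₂ _<_ (sym (sum-δ v)) (trans (sym ∣τ∣≡3) (∣∣≡sum τ)) (s≤s (s≤s z≤n)))
    ... | x , lt with x ≟ v | lookup τ x in eq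
    ... | no x≢v   | true  = x , support τ x Pτ eq ∧ᵗ pairwise τ v x Pτ ([]=⇒lookup (v⊆τ (x∈⁅x⁆ v))) eq (x≢v ∘ sym)
      where open IsCliqueComplex (linkC u)
    ... | no _     | false = contradiction lt λ ()
    ... | yes _    | true  = contradiction lt λ { (s≤s ()) }
    ... | yes _    | false = contradiction lt λ ()

    skeleton-link-connected : ∀ {u v x} → skeleton u v ≡ true → (P : Fin n → Bool) →
      (∀ x y → P x ≡ true → skeleton u y ∧ skeleton v y ≡ true → skeleton x y ≡ true → P y ≡ true) →
      skeleton u x ∧ skeleton v x ≡ true → P x ≡ true → ∀ y → skeleton u y ∧ skeleton v y ≡ true → P y ≡ true
    skeleton-link-connected {u} {v} {x} uv P closed x∈ Px y y∈ =
      propagate (Is2Sphere.links-conn (manifold u) v (vertex-face (linkC u) uv) x y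
        (vertex-face (linkC₂ uv) x∈) (vertex-face (linkC₂ uv) y∈)) Px
      where
      open IsCliqueComplex (linkC₂ uv)
      propagate : ∀ {x y} → Reach (λ x y → link (link (face M) u) v (edge x y)) x y → P x ≡ true → P y ≡ true
      propagate here Px = Px
      propagate {x} (step {y = y} xy r) Px = propagate r next
        where
        x∈e : lookup (edge x y) x ≡ true
        x∈e = trans (lookup-∪ ⁅ x ⁆ ⁅ y ⁆ x) (∨-trueˡ (lookup-⁅⁆ x))
        y∈e : lookup (edge x y) y ≡ true
        y∈e = trans (lookup-∪ ⁅ x ⁆ ⁅ y ⁆ y) (∨-trueʳ (lookup-⁅⁆ y))
        next : P y ≡ true
        next with x ≟ y
        ... | yes refl = Px
        ... | no x≢y   = closed x y Px (support (edge x y) y xy y∈e) (pairwise (edge x y) x y xy x∈e y∈e x≢y)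

    -- By flagness the five vertices would span a face, and the 2-dimensional link of `u` would have
    -- a face with four vertices.
    skeleton-no-K₅ : ∀ {u v x y z} → skeleton u v ≡ true → skeleton u x ∧ skeleton v x ≡ true →
      skeleton u y ∧ skeleton v y ≡ true → skeleton u z ∧ skeleton v z ≡ true →
      skeleton x y ≡ true → skeleton x z ≡ true → skeleton y z ≡ true → ⊥
    skeleton-no-K₅ {u} {v} {x} {y} {z} uv x∈ y∈ z∈ xy xz yz = contradiction (begin
      4                                         ≡⟨ cong (3 +_) (∣⁅x⁆∣≡1 z) ⟨
      suc (suc (suc ∣ ⁅ z ⁆ ∣))                 ≡⟨ cong (2 +_) (∣∪⁅⁆∣ ⁅ z ⁆ y (proj₁ l₁)) ⟨
      suc (suc ∣ ⁅ z ⁆ ∪ ⁅ y ⁆ ∣)               ≡⟨ cong suc (∣∪⁅⁆∣ (⁅ z ⁆ ∪ ⁅ y ⁆) x (proj₁ l₂)) ⟨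
      suc ∣ (⁅ z ⁆ ∪ ⁅ y ⁆) ∪ ⁅ x ⁆ ∣           ≡⟨ ∣∪⁅⁆∣ ((⁅ z ⁆ ∪ ⁅ y ⁆) ∪ ⁅ x ⁆) v (proj₁ l₃) ⟨
      ∣ ((⁅ z ⁆ ∪ ⁅ y ⁆) ∪ ⁅ x ⁆) ∪ ⁅ v ⁆ ∣     ≤⟨ Is2Sphere.dim≤2 (manifold u) _ (proj₂ l₃) ⟩
      3 ∎) λ { (s≤s (s≤s (s≤s ()))) }
      where
      open ≤-Reasoning
      C₃ = link-isCliqueComplex (linkC₂ uv) skeleton-sym x∈
      C₄ = link-isCliqueComplex C₃ skeleton-sym (y∈ ∧ᵗ xy)
      l₁ = link⇒ (link (link (link (face M) u) v) x) y ⁅ z ⁆ (vertex-face C₄ ((z∈ ∧ᵗ xz) ∧ᵗ yz))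
      l₂ = link⇒ (link (link (face M) u) v) x (⁅ z ⁆ ∪ ⁅ y ⁆) (proj₂ l₁)
      l₃ = link⇒ (link (face M) u) v ((⁅ z ⁆ ∪ ⁅ y ⁆) ∪ ⁅ x ⁆) (proj₂ l₂)

    sphericalGraph : SphericalGraph n
    sphericalGraph = record
      { adj     = skeleton
      ; adj-sym = skeleton-sym
      ; adj-irr = skeleton-irr
      ; link-degree-sum = λ v → sphere-degree-sum skeleton-sym (linkC v) (manifold v)
      ; lk-2-regular = λ {u} {v} {x} uv x∈ → let ux , vx = ∧-true x∈ in
          trans (sym (triangles-containing-edge skeleton-sym (linkC u) uv ux vx))
            (Is2Sphere.edge-in-two (manifold u) (edge v x) (edge-face (linkC u) skeleton-sym uv ux vx)
              (∣edge∣ (adjacent⇒≢ (linkC u) vx)))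
      ; lk-connected = skeleton-link-connected
      ; lk-nonempty  = skeleton-link-nonempty
      ; lk-no-triangle = skeleton-no-K₅
      }

-- Degrees, missing degrees and link cycles

module Graph {n : ℕ} (G : SphericalGraph n) where
  open SphericalGraph G public

  d : Fin n → ℕ
  d v = # (adj v)

  c : Fin n → Fin n → ℕ
  c u v = # (lk u v)

  deg : (Fin n → Bool) → Fin n → ℕ
  deg Q x = # (λ y → Q y ∧ adj x y)

  codeg : (Fin n → Bool) → Fin n → ℕ
  codeg Q x = # (λ y → Q y ∧ not (adj x y))

  e : (Fin n → Bool) → (Fin n → Bool) → ℕ
  e P Q = sumOn P (deg Q)

  D : ℕ
  D = sum d

  flip : ∀ {u v} → adj u v ≡ true → adj v u ≡ true
  flip {u} {v} = trans (adj-sym v u)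

  adj⇒≢ : ∀ {u v} → adj u v ≡ true → u ≢ v
  adj⇒≢ {u} uv refl = true≢false uv (adj-irr u)

  deg≤# : ∀ Q x → deg Q x ≤ # Q
  deg≤# Q x = #-mono λ y p → proj₁ (∧-true p)

  deg≤d : ∀ Q x → deg Q x ≤ d x
  deg≤d Q x = #-mono λ y p → proj₂ (∧-true {Q y} p)

  deg-mono : ∀ P Q x → (∀ y → P y ≡ true → Q y ≡ true) → deg P x ≤ deg Q x
  deg-mono P Q x P⊆Q = #-mono λ y p → let Py , xy = ∧-true p in P⊆Q y Py ∧ᵗ xy

  deg-∨ : ∀ P Q x → deg (λ y → P y ∨ Q y) x ≤ deg P x + deg Q x
  deg-∨ P Q x = ≤-trans (#-mono λ y p → distrib (P y) (Q y) (adj x y) p) (#-∨≤ _ _)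
    where
    distrib : ∀ a b c → (a ∨ b) ∧ c ≡ true → (a ∧ c) ∨ (b ∧ c) ≡ true
    distrib true  b true _ = refl
    distrib false b c    p = p

  deg+codeg : ∀ Q x → deg Q x + codeg Q x ≡ # Q
  deg+codeg Q x = sym (#-split Q (adj x))

  d≤n : ∀ x → d x ≤ n
  d≤n x = #≤n (adj x)

  e-sym : ∀ P Q → e P Q ≡ e Q P
  e-sym P Q = begin
    sumOn P (λ x → # (λ y → Q y ∧ adj x y))        ≡⟨ sumOn-cong P (λ x _ → sym (sumOn-⟦⟧ Q (adj x))) ⟩
    sumOn P (λ x → sumOn Q (λ y → ⟦ adj x y ⟧))    ≡⟨ sumOn-comm P Q _ ⟩
    sumOn Q (λ y → sumOn P (λ x → ⟦ adj x y ⟧))    ≡⟨ sumOn-cong Q (λ y _ → trans (sumOn-⟦⟧ P (λ x → adj x y))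
                                                        (#-cong λ x → cong (P x ∧_) (adj-sym x y))) ⟩
    e Q P ∎
    where open ≡-Reasoning

  e+codeg : ∀ P Q → e P Q + sumOn P (codeg Q) ≡ # P * # Q
  e+codeg P Q = trans (sym (sumOn-+ P (deg Q) (codeg Q)))
    (trans (sumOn-cong P λ x _ → deg+codeg Q x) (sumOn-const P (# Q)))

  codeg-sym : ∀ P Q → sumOn P (codeg Q) ≡ sumOn Q (codeg P)
  codeg-sym P Q = +-cancelˡ-≡ (e P Q) _ _ (trans (e+codeg P Q) (trans (*-comm (# P) (# Q))
    (trans (sym (e+codeg Q P)) (cong (_+ sumOn Q (codeg P)) (e-sym Q P)))))

  Σc≤6d : ∀ v → sumOn (adj v) (c v) ≤ 6 * d v
  Σc≤6d v = ≤-trans (m≤m+n _ 12) (≤-reflexive (link-degree-sum v))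

  sum≤cover : ∀ A B W (f : Fin n → ℕ) → (∀ i → A i ≡ false → B i ≡ false → W i ≡ true) →
    sum f ≤ sumOn A f + (sumOn B f + sumOn W f)
  sum≤cover A B W f cover = begin
    sum f                                      ≡⟨ sumOn-true f ⟨
    sumOn (λ _ → true) f                       ≤⟨ sumOn-⊆ _ (λ i → A i ∨ (B i ∨ W i)) f (λ i _ → covered i) ⟩
    sumOn (λ i → A i ∨ (B i ∨ W i)) f          ≤⟨ sumOn-∨≤ A (λ i → B i ∨ W i) f ⟩
    sumOn A f + sumOn (λ i → B i ∨ W i) f      ≤⟨ +-monoʳ-≤ (sumOn A f) (sumOn-∨≤ B W f) ⟩
    sumOn A f + (sumOn B f + sumOn W f)        ∎
    where
    open ≤-Reasoning
    covered : ∀ i → A i ∨ (B i ∨ W i) ≡ true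
    covered i with A i in a | B i in b
    ... | true  | _     = refl
    ... | false | true  = refl
    ... | false | false = cover i a b

  d≤cover : ∀ A B W → (∀ i → A i ≡ false → B i ≡ false → W i ≡ true) →
    ∀ x → d x ≤ deg A x + (deg B x + deg W x)
  d≤cover A B W cover x = begin
    d x ≤⟨ #-mono (λ y xy → covered y xy) ⟩
    deg (λ y → A y ∨ (B y ∨ W y)) x            ≤⟨ deg-∨ A (λ y → B y ∨ W y) x ⟩
    deg A x + deg (λ y → B y ∨ W y) x          ≤⟨ +-monoʳ-≤ (deg A x) (deg-∨ B W x) ⟩
    deg A x + (deg B x + deg W x)              ∎
    where
    open ≤-Reasoning
    covered : ∀ y → adj x y ≡ true → (A y ∨ (B y ∨ W y)) ∧ adj x y ≡ true
    covered y xy with A y in a | B y in b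
    ... | true  | _     = xy
    ... | false | true  = xy
    ... | false | false = cover y a b ∧ᵗ xy

  -- Two adjacent vertices of the link cycle have disjoint neighbourhoods in it.
  4≤c : ∀ {u v} → adj u v ≡ true → 4 ≤ c u v
  4≤c {u} {v} uv with lk-nonempty uv
  ... | x , x∈ with #>0⇒∃ (λ y → lk u v y ∧ adj x y) (subst (0 <_) (sym (lk-2-regular uv x∈)) (s≤s z≤n))
  ... | y , p = begin
    4                                                 ≡⟨ cong₂ _+_ (lk-2-regular uv x∈) (lk-2-regular uv y∈) ⟨
    deg (lk u v) x + deg (lk u v) y                   ≤⟨ +-monoʳ-≤ _ (#-mono disjoint) ⟩
    # (λ z → lk u v z ∧ adj x z) + # (λ z → lk u v z ∧ not (adj x z)) ≡⟨ #-split (lk u v) (adj x) ⟨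
    c u v                                             ∎
    where
    open ≤-Reasoning
    y∈ = proj₁ (∧-true p)
    xy = proj₂ (∧-true {lk u v y} p)
    disjoint : ∀ z → lk u v z ∧ adj y z ≡ true → lk u v z ∧ not (adj x z) ≡ true
    disjoint z q with adj x z in xz
    ... | false = proj₁ (∧-true q) ∧ᵗ refl
    ... | true  = ⊥-elim (lk-no-triangle uv x∈ y∈ (proj₁ (∧-true q)) xy xz (proj₂ (∧-true {lk u v z} q)))

  -- A vertex of `Z` has both of its cycle neighbours in `Z`, so `Z` is closed under adjacency and
  -- connectedness makes it everything. Thus the link of an edge cannot properly contain an induced
  -- cycle.
  lk-minimal : ∀ {u v} → adj u v ≡ true → (Z : Fin n → Bool) → (∀ z → Z z ≡ true → lk u v z ≡ true) →
    (∀ z → Z z ≡ true → 2 ≤ deg Z z) → ∀ {z} → Z z ≡ true → ∀ y → lk u v y ≡ true → Z y ≡ true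
  lk-minimal {u} {v} uv Z Z⊆lk reg {z} Zz = lk-connected uv Z closed (Z⊆lk z Zz) Zz
    where
    closed : ∀ x y → Z x ≡ true → lk u v y ≡ true → adj x y ≡ true → Z y ≡ true
    closed x y Zx y∈ xy = proj₁ (∧-true {Z y} (⊆∧#≥⇒⊇ (λ t → Z t ∧ adj x t) (λ t → lk u v t ∧ adj x t)
      (λ t p → let Zt , xt = ∧-true p in Z⊆lk t Zt ∧ᵗ xt)
      (≤-trans (≤-reflexive (lk-2-regular uv (Z⊆lk x Zx))) (reg x Zx)) y (y∈ ∧ᵗ xy)))

-- Two quadratic inequalities

cauchy : ∀ {n} (f : Fin n → ℕ) → sum f * sum f ≤ n * sum (λ i → f i * f i)
cauchy {n} f = *-cancelˡ-≤ 2 (begin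
  2 * (sum f * sum f)                                 ≡⟨ cong (2 *_) (*-sum (sum f) f) ⟩
  2 * sum (λ i → sum f * f i)                         ≡⟨ *-sum 2 _ ⟩
  sum (λ i → 2 * (sum f * f i))
    ≡⟨ sum-cong (λ i → trans (lemma (sum f) (f i)) (*-sum (2 * f i) f)) ⟩
  sum (λ i → sum (λ j → 2 * f i * f j))               ≤⟨ sum-mono (λ i → sum-mono λ j → amgm (f i) (f j)) ⟩
  sum (λ i → sum (λ j → f i * f i + f j * f j))
    ≡⟨ sum-cong (λ i → trans (sum-+ _ _) (cong (_+ Q) (sum-const n (f i * f i)))) ⟩
  sum (λ i → n * (f i * f i) + Q)                     ≡⟨ sum-+ _ _ ⟩
  sum (λ i → n * (f i * f i)) + sum {n} (λ _ → Q)     ≡⟨ cong₂ _+_ (sym (*-sum n _)) (sum-const n Q) ⟩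
  n * Q + n * Q                                       ≡⟨ lemma′ (n * Q) ⟩
  2 * (n * Q)                                         ∎)
  where
  open ≤-Reasoning
  Q = sum (λ i → f i * f i)
  lemma : ∀ s x → 2 * (s * x) ≡ 2 * x * s
  lemma = solve-∀
  lemma′ : ∀ x → x + x ≡ 2 * x
  lemma′ = solve-∀
  square : ∀ x k → 2 * x * (x + k) + k * k ≡ x * x + (x + k) * (x + k)
  square = solve-∀
  square′ : ∀ x k → 2 * (x + k) * x + k * k ≡ (x + k) * (x + k) + x * x
  square′ = solve-∀
  amgm : ∀ x y → 2 * x * y ≤ x * x + y * y
  amgm x y with ≤-total x y
  ... | inj₁ x≤y rewrite sym (m+[n∸m]≡n x≤y) = ≤-trans (m≤m+n _ ((y ∸ x) * (y ∸ x))) (≤-reflexive (square x (y ∸ x)))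
  ... | inj₂ y≤x rewrite sym (m+[n∸m]≡n y≤x) = ≤-trans (m≤m+n _ ((x ∸ y) * (x ∸ y))) (≤-reflexive (square′ y (x ∸ y)))

4xy≤[x+y]² : ∀ x y → 4 * (x * y) ≤ (x + y) * (x + y)
4xy≤[x+y]² x y with ≤-total x y
... | inj₁ x≤y rewrite sym (m+[n∸m]≡n x≤y) = ≤-trans (m≤m+n _ ((y ∸ x) * (y ∸ x))) (≤-reflexive (square x (y ∸ x)))
  where
  square : ∀ x k → 4 * (x * (x + k)) + k * k ≡ (x + (x + k)) * (x + (x + k))
  square = solve-∀
... | inj₂ y≤x rewrite sym (m+[n∸m]≡n y≤x) = ≤-trans (m≤m+n _ ((x ∸ y) * (x ∸ y))) (≤-reflexive (square y (x ∸ y)))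
  where
  square : ∀ x k → 4 * ((x + k) * x) + k * k ≡ (x + k + x) * (x + k + x)
  square = solve-∀

-- A nearly complete bipartition

-- From Q ≥ D²/n and 2D ≥ n² + 2n + 18 follows 2Q ≥ (n + 2)D + 18D/n. A further 10D is exactly what
-- is missing for the term (n + 12)D of `F`; this explains the constant 10 in `heavy-edge`.
edge-arithmetic : ∀ m D Q F G → let n = suc m in
  n * n + 2 * n + 18 ≤ 2 * D → D * D ≤ n * Q →
  F + n * 24 ≡ n * D + 12 * D → G ≡ 2 * Q + 10 * D → F < G
edge-arithmetic m D Q F G h₁ h₂ h₃ refl = *-cancelˡ-< (suc m) F (2 * Q + 10 * D)
  (by-slack (+-mono-≤ (+-mono-≤ (*-monoʳ-≤ D h₁) (*-monoʳ-≤ 2 h₂)) (*-monoʳ-≤ (suc m) (≤-reflexive h₃)))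
    (18 * D + 24 * m * m + 48 * m + 23) (identity m D Q F))
  where
  identity : ∀ m D Q F → suc (suc m * F) + (D * (2 * D) + 2 * (suc m * Q) + suc m * (suc m * D + 12 * D)) +
    (18 * D + 24 * m * m + 48 * m + 23)
    ≡ suc m * (2 * Q + 10 * D) + (D * (suc m * suc m + 2 * suc m + 18) + 2 * (D * D) + suc m * (F + suc m * 24))
  identity = solve-∀

-- The n² of 4ab ≤ (n + 9)² cancels against 2D. For 4M the bound 64n + 333 remains, which is at most
-- 68n from n = 84 on.
missing-arithmetic : ∀ n D a b ab M c w → n * n + 2 * n + 18 ≤ 2 * D →
  w + (a + b) ≡ n + c → c ≤ 9 → 4 * ab ≤ (a + b) * (a + b) →
  D + 2 * M ≤ 2 * ab + 15 * (a + b) + 9 * n → 84 ≤ n → M ≤ 17 * n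
missing-arithmetic n D a b ab M c w h₁ h₂ h₃ h₄ h₅ h₆ = *-cancelˡ-≤ 4
  (by-slack (+-mono-≤ (+-mono-≤ (+-mono-≤ (+-mono-≤ (+-mono-≤ h₁ h₄) (*-monoʳ-≤ 2 h₅)) (*-monoʳ-≤ 30 s≤))
    (*-mono-≤ s≤ s≤)) (*-monoʳ-≤ 4 h₆))
    3 (identity n D s ab M))
  where
  s = a + b
  s≤ : s ≤ n + 9
  s≤ = ≤-trans (m≤n+m s w) (≤-trans (≤-reflexive h₂) (+-monoʳ-≤ n h₃))
  identity : ∀ n D s ab M →
    4 * M + (2 * D + s * s + 2 * (2 * ab + 15 * s + 9 * n) + 30 * (n + 9) + (n + 9) * (n + 9) + 4 * n) + 3
    ≡ 4 * (17 * n) + ((n * n + 2 * n + 18) + 4 * ab + 2 * (D + 2 * M) + 30 * s + s * s + 4 * 84)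
  identity = solve-∀

-- If 5a < n, then 2ab is at most 2n²/5, too little for `D`, which is about n²/2 or more.
side-arithmetic : ∀ n D a b s → n * n + 2 * n + 18 ≤ 2 * D → D ≤ 2 * (a * b) + 15 * s + 9 * n →
  s ≤ n + 9 → b ≤ n → 300 ≤ n → n ≤ 5 * a
side-arithmetic n D a b s h₁ h₂ h₃ h₄ h₅ with n ≤? 5 * a
... | yes p = p
... | no ¬p = absurd-slack (+-mono-≤ (+-mono-≤ (+-mono-≤ (+-mono-≤ (+-mono-≤ (*-monoʳ-≤ 5 h₁) (*-monoʳ-≤ 10 h₂))
     (*-monoʳ-≤ 4 (*-mono-≤ (<⇒≤ (≰⇒> ¬p)) h₄))) (*-monoʳ-≤ 150 h₃)) (*-monoʳ-≤ n h₅)) (*-monoʳ-≤ 5 h₅))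
   (65 * n + 239) (identity n D a b s)
  where
  identity : ∀ n D a b s →
    suc (5 * (2 * D) + 10 * (2 * (a * b) + 15 * s + 9 * n) + 4 * (n * n) + 150 * (n + 9) + n * n + 5 * n +
    (65 * n + 239))
    ≡ 5 * (n * n + 2 * n + 18) + 10 * D + 4 * (5 * a * b) + 150 * s + n * 300 + 5 * 300
  identity = solve-∀

module Rough {n : ℕ} (G : SphericalGraph n) where
  open Graph G

  -- Average |V ∖ (N(u) ∪ N(v))| + |N(u) ∩ N(v)| = n + 2 c(u,v) - d(u) - d(v) over the edges uv.
  heavy-edge : .{{NonZero n}} → n * n + 2 * n + 18 ≤ 2 * D →
    ∃ λ u → ∃ λ v → adj u v ≡ true × n + 2 * c u v < d u + d v + 10
  heavy-edge h = let u , lt = sum-<⇒∃ _ _ F<K ; v , uv , lt′ = sumOn-<⇒∃ (adj u) _ _ lt in u , v , uv , lt′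
    where
    open ≡-Reasoning
    F K Q : ℕ
    F = sum (λ u → sumOn (adj u) (λ v → n + 2 * c u v))
    K = sum (λ u → sumOn (adj u) (λ v → d u + d v + 10))
    Q = sum (λ u → d u * d u)
    lemma₁ : ∀ n x s → x * n + 2 * s + 24 ≡ x * n + 2 * (s + 12)
    lemma₁ = solve-∀
    lemma₂ : ∀ n x → x * n + 2 * (6 * x) ≡ (n + 12) * x
    lemma₂ = solve-∀
    inner : ∀ u → sumOn (adj u) (λ v → n + 2 * c u v) + 24 ≡ (n + 12) * d u
    inner u = begin
      sumOn (adj u) (λ v → n + 2 * c u v) + 24
        ≡⟨ cong (_+ 24) (trans (sumOn-+ (adj u) _ _) (cong₂ _+_ (sumOn-const (adj u) n) (sumOn-* (adj u) 2 (c u)))) ⟩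
      d u * n + 2 * sumOn (adj u) (c u) + 24    ≡⟨ lemma₁ n (d u) (sumOn (adj u) (c u)) ⟩
      d u * n + 2 * (sumOn (adj u) (c u) + 12)  ≡⟨ cong (λ x → d u * n + 2 * x) (link-degree-sum u) ⟩
      d u * n + 2 * (6 * d u)                   ≡⟨ lemma₂ n (d u) ⟩
      (n + 12) * d u                            ∎
    F≡ : F + n * 24 ≡ n * D + 12 * D
    F≡ = begin
      F + n * 24                                ≡⟨ cong (F +_) (sum-const n 24) ⟨
      F + sum {n} (λ _ → 24)                    ≡⟨ sum-+ _ _ ⟨
      sum (λ u → sumOn (adj u) (λ v → n + 2 * c u v) + 24) ≡⟨ sum-cong inner ⟩
      sum (λ u → (n + 12) * d u)                ≡⟨ *-sum (n + 12) d ⟨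
      (n + 12) * D                              ≡⟨ *-distribʳ-+ D n 12 ⟩
      n * D + 12 * D                            ∎
    inner′ : ∀ u → sumOn (adj u) (λ v → d u + d v + 10) ≡ d u * (d u + 10) + sumOn (adj u) d
    inner′ u = begin
      sumOn (adj u) (λ v → d u + d v + 10)      ≡⟨ sumOn-cong (adj u) (λ v _ → lemma (d u) (d v)) ⟩
      sumOn (adj u) (λ v → (d u + 10) + d v)    ≡⟨ sumOn-+ (adj u) _ d ⟩
      sumOn (adj u) (λ _ → d u + 10) + sumOn (adj u) d ≡⟨ cong (_+ sumOn (adj u) d) (sumOn-const (adj u) _) ⟩
      d u * (d u + 10) + sumOn (adj u) d        ∎
      where
      lemma : ∀ x y → x + y + 10 ≡ (x + 10) + y
      lemma = solve-∀
    Σd : sum (λ u → sumOn (adj u) d) ≡ Q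
    Σd = begin
      sum (λ u → sumOn (adj u) d)                        ≡⟨ sum-cong (λ u → sumOn-sum (adj u) d) ⟩
      sum (λ u → sum (λ v → ⟦ adj u v ⟧ * d v))          ≡⟨ sum-comm _ ⟩
      sum (λ v → sum (λ u → ⟦ adj u v ⟧ * d v))
        ≡⟨ sum-cong (λ v → sum-cong λ u → cong (λ b → ⟦ b ⟧ * d v) (adj-sym u v)) ⟩
      sum (λ v → sum (λ u → ⟦ adj v u ⟧ * d v))
        ≡⟨ sum-cong (λ v → trans (sum-* (d v) _) (cong (_* d v) (sym (#-sum (adj v))))) ⟩
      Q                                                  ∎
    K≡ : K ≡ 2 * Q + 10 * D
    K≡ = begin
      K                                                              ≡⟨ sum-cong inner′ ⟩
      sum (λ u → d u * (d u + 10) + sumOn (adj u) d)                 ≡⟨ sum-+ _ _ ⟩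
      sum (λ u → d u * (d u + 10)) + sum (λ u → sumOn (adj u) d)     ≡⟨ cong₂ _+_ (sum-cong λ u → lemma (d u)) Σd ⟩
      sum (λ u → d u * d u + 10 * d u) + Q
        ≡⟨ cong (_+ Q) (trans (sum-+ _ _) (cong (Q +_) (sym (*-sum 10 d)))) ⟩
      Q + 10 * D + Q                                                 ≡⟨ lemma′ Q D ⟩
      2 * Q + 10 * D                                                 ∎
      where
      lemma : ∀ x → x * (x + 10) ≡ x * x + 10 * x
      lemma = solve-∀
      lemma′ : ∀ q x → q + 10 * x + q ≡ 2 * q + 10 * x
      lemma′ = solve-∀
    F<K : F < K
    F<K = subst (λ k → edge-bound k) (suc-pred n) (edge-arithmetic (pred n) D Q F K)
            h (cauchy d) F≡ K≡
      where
      edge-bound : ℕ → Set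
      edge-bound n = n * n + 2 * n + 18 ≤ 2 * D → D * D ≤ n * Q → F + n * 24 ≡ n * D + 12 * D → K ≡ 2 * Q + 10 * D →
        F < K

  record RoughBipartition (K L : ℕ) (A B Aₜ Bₜ : Fin n → Bool) : Set where
    field
      Aₜ⊆A   : ∀ x → Aₜ x ≡ true → A x ≡ true
      Bₜ⊆B   : ∀ x → Bₜ x ≡ true → B x ≡ true
      codegA : ∀ x → Aₜ x ≡ true → codeg B x ≤ L
      codegB : ∀ x → Bₜ x ≡ true → codeg A x ≤ L
      A∖Aₜ   : K * # (λ x → A x ∧ not (Aₜ x)) ≤ n
      B∖Bₜ   : K * # (λ x → B x ∧ not (Bₜ x)) ≤ n
      n≤5A   : n ≤ 5 * # A
      n≤5B   : n ≤ 5 * # B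
      n≤A+B  : n ≤ # A + # B + 9
      uncovered≤9 : # (λ i → not (A i) ∧ not (B i)) ≤ 9

  swap : ∀ {K L A B Aₜ Bₜ} → RoughBipartition K L A B Aₜ Bₜ → RoughBipartition K L B A Bₜ Aₜ
  swap {A = A} {B} R = record
    { Aₜ⊆A = Bₜ⊆B ; Bₜ⊆B = Aₜ⊆A ; codegA = codegB ; codegB = codegA ; A∖Aₜ = B∖Bₜ ; B∖Bₜ = A∖Aₜ
    ; n≤5A = n≤5B ; n≤5B = n≤5A ; n≤A+B = ≤-trans n≤A+B (≤-reflexive (cong (_+ 9) (+-comm (# A) (# B))))
    ; uncovered≤9 = subst (_≤ 9) (#-cong λ i → ∧-comm (not (A i)) (not (B i))) uncovered≤9 }
    where open RoughBipartition R

  typical : ℕ → (P Q : Fin n → Bool) → Fin n → Bool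
  typical L P Q x = P x ∧ (codeg Q x ≤ᵇ L)

  -- At most 17 n pairs of N(v) × N(u) are non-adjacent, so by Markov's inequality at most n / K vertices
  -- of either side miss more than L = 17 K - 1 vertices of the other one.
  rough-bipartition : ∀ K L → suc L ≡ 17 * K → 300 ≤ n → n * n + 2 * n + 18 ≤ 2 * D →
    ∀ u v → n + 2 * c u v < d u + d v + 10 →
    RoughBipartition K L (adj v) (adj u) (typical L (adj v) (adj u)) (typical L (adj u) (adj v))
  rough-bipartition K L sL≡17K 300≤n h u v uv-heavy = record
    { Aₜ⊆A   = λ x p → proj₁ (∧-true p)
    ; Bₜ⊆B   = λ x p → proj₁ (∧-true p)
    ; codegA = λ x p → ≤ᵇ-true⇒≤ (proj₂ (∧-true {A x} p))
    ; codegB = λ x p → ≤ᵇ-true⇒≤ (proj₂ (∧-true {B x} p))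
    ; A∖Aₜ   = markov A B M≤17n
    ; B∖Bₜ   = markov B A (subst (_≤ 17 * n) (codeg-sym A B) M≤17n)
    ; n≤5A   = side-arithmetic n D (# A) (# B) (# A + # B) h
                 (≤-trans (m≤m+n D _) D+2M≤) A+B≤n+9 (#≤n B) 300≤n
    ; n≤5B   = side-arithmetic n D (# B) (# A) (# A + # B) h
                 (≤-trans (m≤m+n D _) (≤-trans D+2M≤
                   (≤-reflexive (cong (λ x → 2 * x + 15 * (# A + # B) + 9 * n) (*-comm (# A) (# B))))))
                 A+B≤n+9 (#≤n A) 300≤n
    ; n≤A+B  = ≤-trans (m≤m+n n (c u v))
      (≤-trans (≤-reflexive (sym W+A+B≡n+c)) (≤-trans (+-monoˡ-≤ _ W≤9) (≤-reflexive (+-comm 9 _))))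
    ; uncovered≤9 = subst (_≤ 9) (#-cong λ i → ∧-comm (not (B i)) (not (A i))) W≤9
    }
    where
    A B W : Fin n → Bool
    A = adj v
    B = adj u
    W i = not (adj u i) ∧ not (adj v i)
    W+A+B≡n+c : # W + (# A + # B) ≡ n + c u v
    W+A+B≡n+c = begin
      # W + (# A + # B)           ≡⟨ cong (λ x → # W + (x + # B)) (#-split A B) ⟩
      # W + (# (λ i → A i ∧ B i) + # (λ i → A i ∧ not (B i)) + # B)
        ≡⟨ cong (λ x → # W + (x + # (λ i → A i ∧ not (B i)) + # B)) (#-cong λ i → ∧-comm (A i) (B i)) ⟩
      # W + (c u v + # (λ i → A i ∧ not (B i)) + # B)
        ≡⟨ cong (λ x → # W + (c u v + x + # B)) (#-cong λ i → ∧-comm (A i) (not (B i))) ⟩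
      # W + (c u v + # (λ i → not (B i) ∧ A i) + # B)  ≡⟨ lemma (# W) (c u v) (# (λ i → not (B i) ∧ A i)) (# B) ⟩
      (# (λ i → not (B i) ∧ A i) + # W) + # B + c u v  ≡⟨ cong (λ x → x + # B + c u v) (#-split (λ i → not (B i)) A) ⟨
      # (λ i → not (B i)) + # B + c u v                ≡⟨ cong (_+ c u v) (trans (+-comm _ (# B)) (#-not B)) ⟩
      n + c u v                                        ∎
      where
      open ≡-Reasoning
      lemma : ∀ w c x b → w + (c + x + b) ≡ (x + w) + b + c
      lemma = solve-∀
    -- The choice of `uv` bounds the sum `# W + c u v` by 9, which gives this bound and the next
    -- one.
    c≤9 : c u v ≤ 9
    c≤9 = by-slack (+-mono-≤ uv-heavy (≤-reflexive W+A+B≡n+c)) (# W) (identity (c u v) n (# A) (# B) (# W))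
      where
      identity : ∀ c n a b w → c + (b + a + 10 + (n + c)) + w ≡ 9 + (suc (n + 2 * c) + (w + (a + b)))
      identity = solve-∀
    W≤9 : # W ≤ 9
    W≤9 = by-slack (+-mono-≤ uv-heavy (≤-reflexive W+A+B≡n+c)) (c u v) (identity (c u v) n (# A) (# B) (# W))
      where
      identity : ∀ c n a b w → w + (b + a + 10 + (n + c)) + c ≡ 9 + (suc (n + 2 * c) + (w + (a + b)))
      identity = solve-∀
    A+B≤n+9 : # A + # B ≤ n + 9
    A+B≤n+9 = ≤-trans (m≤n+m _ (# W)) (≤-trans (≤-reflexive W+A+B≡n+c) (+-monoʳ-≤ n c≤9))
    cover : ∀ i → A i ≡ false → B i ≡ false → W i ≡ true
    cover i p q rewrite p | q = refl
    -- As `P` is the neighbourhood of `w`, the degrees inside `P` add up to the degree sum of the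
    -- link of `w`, at most 6 per vertex; the uncovered vertices add at most 9 per vertex. Together
    -- these give the 15 in `D+2M≤`.
    half : ∀ w P Q → (∀ x → d x ≤ deg P x + (deg Q x + deg W x)) → P ≡ adj w →
      sumOn P d ≤ 6 * # P + (e P Q + # P * 9)
    half w P Q d≤ refl = begin
      sumOn P d                                                    ≤⟨ sumOn-mono P (λ x _ → d≤ x) ⟩
      sumOn P (λ x → deg P x + (deg Q x + deg W x))
        ≡⟨ trans (sumOn-+ P _ _) (cong (sumOn P (deg P) +_) (sumOn-+ P _ _)) ⟩
      sumOn P (deg P) + (e P Q + sumOn P (deg W))                  ≤⟨ +-mono-≤ (Σc≤6d w) (+-monoʳ-≤ (e P Q)
        (≤-trans (sumOn-≤const P (deg W) 9 λ x _ → ≤-trans (deg≤# W x) W≤9) ≤-refl)) ⟩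
      6 * # P + (e P Q + # P * 9)                                  ∎
      where open ≤-Reasoning
    M = sumOn A (codeg B)
    D+2M≤ : D + 2 * M ≤ 2 * (# A * # B) + 15 * (# A + # B) + 9 * n
    D+2M≤ = by-slack (+-mono-≤ (+-mono-≤ (≤-trans (sum≤cover A B W d cover)
        (+-mono-≤ (half v A B (d≤cover A B W cover) refl)
          (+-mono-≤ (half u B A (d≤cover B A W (λ i p q → cover i q p)) refl)
            (≤-trans (sumOn-≤const W d n (λ x _ → d≤n x)) (*-monoˡ-≤ n W≤9)))))
        (≤-reflexive (e+codeg A B)))
        (≤-reflexive (trans (cong₂ _+_ (e-sym B A) refl) (e+codeg A B))))
      0 (identity D M (# A) (# B) (e A B) (e B A) (# A * # B) n)
      where
      identity : ∀ D M a b x y ab n → D + 2 * M + ((6 * a + (x + a * 9)) + ((6 * b + (y + b * 9)) + 9 * n) + ab + ab) +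
        0
        ≡ 2 * ab + 15 * (a + b) + 9 * n + (D + (x + M) + (y + M))
      identity = solve-∀
    M≤17n : M ≤ 17 * n
    M≤17n = missing-arithmetic n D (# A) (# B) (# A * # B) M (c u v) (# W) h W+A+B≡n+c c≤9 (4xy≤[x+y]² (# A) (# B))
      D+2M≤
      (≤-trans (m≤m+n 84 216) 300≤n)
    markov : ∀ P Q → sumOn P (codeg Q) ≤ 17 * n → K * # (λ x → P x ∧ not (typical L P Q x)) ≤ n
    markov P Q bound = *-cancelˡ-≤ 17 (begin
      17 * (K * # X)         ≡⟨ *-assoc 17 K (# X) ⟨
      17 * K * # X           ≡⟨ cong (_* # X) sL≡17K ⟨
      suc L * # X            ≡⟨ *-comm (suc L) (# X) ⟩
      # X * suc L            ≤⟨ sumOn-≥const X (codeg Q) (suc L) atypical ⟩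
      sumOn X (codeg Q)      ≤⟨ sumOn-⊆ X P (codeg Q) (λ x p → proj₁ (∧-true p)) ⟩
      sumOn P (codeg Q)      ≤⟨ bound ⟩
      17 * n                 ∎)
      where
      open ≤-Reasoning
      X : Fin n → Bool
      X x = P x ∧ not (typical L P Q x)
      atypical : ∀ x → X x ≡ true → suc L ≤ codeg Q x
      atypical x p with P x | codeg Q x ≤ᵇ L in eq
      ... | true | false = ≤ᵇ-false⇒> eq

-- A tetrahedron of typical vertices

density-arithmetic : ∀ n K L B Bₜ x → K * B ≤ K * Bₜ + n → n ≤ 5 * B → Bₜ ≤ x + L → 20 ≤ K → 20 * L ≤ n → n ≤ 10 * x
density-arithmetic n K@(suc _) L B Bₜ x h₁ h₂ h₃ h₄ h₅ = *-cancelˡ-≤ (2 * K)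
  (by-slack (+-mono-≤ (+-mono-≤ (+-mono-≤ (+-mono-≤ (*-monoʳ-≤ 20 h₁) (*-monoʳ-≤ (4 * K) h₂)) (*-monoʳ-≤ (20 * K) h₃))
    (*-monoˡ-≤ n h₄)) (*-monoʳ-≤ K h₅))
    0 (identity n K L B Bₜ x))
  where
  identity : ∀ n K L B Bₜ x → 2 * K * n + (20 * (K * Bₜ + n) + 4 * K * (5 * B) + 20 * K * (x + L) + K * n + K * n) + 0
    ≡ 2 * K * (10 * x) + (20 * (K * B) + 4 * K * n + 20 * K * Bₜ + 20 * n + K * (20 * L))
  identity = solve-∀

atypical-arithmetic : ∀ n K U X → K * U ≤ 9 * K + 2 * n → 150 * (9 * K + 2 * n) < K * n → n * n ≤ 100 * X →
  .{{NonZero n}} → .{{NonZero K}} → U * (6 * n) < 4 * X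
atypical-arithmetic n K U X h₁ h₂ h₃ = *-cancelˡ-< (25 * K) _ _ (begin-strict
  25 * K * (U * (6 * n))       ≡⟨ identity₁ n K U ⟩
  150 * (K * U) * n            ≤⟨ *-monoˡ-≤ n (*-monoʳ-≤ 150 h₁) ⟩
  150 * (9 * K + 2 * n) * n    <⟨ *-monoˡ-< n h₂ ⟩
  K * n * n                    ≡⟨ *-assoc K n n ⟩
  K * (n * n)                  ≤⟨ *-monoʳ-≤ K h₃ ⟩
  K * (100 * X)                ≡⟨ identity₂ K X ⟩
  25 * K * (4 * X)             ∎)
  where
  open ≤-Reasoning
  identity₁ : ∀ n K U → 25 * K * (U * (6 * n)) ≡ 150 * (K * U) * n
  identity₁ = solve-∀
  identity₂ : ∀ K X → K * (100 * X) ≡ 25 * K * (4 * X)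
  identity₂ = solve-∀

-- The typical part `p` of the link cycle has about n/5 - n/K vertices, the rest `q` only about
-- 2n/K. In the last condition 15n = 5(2n + n) stands for the atypical vertices, 10L for the
-- vertices missed by the two ends, and 346 = 5(9 + 60) + 1 for the bounded losses.
cycle-arithmetic : ∀ n K L U s p q B Bₜ → K * U ≤ 9 * K + 2 * n → K * B ≤ K * Bₜ + n → n ≤ 5 * B →
  s ≤ 60 → q ≤ U + s → Bₜ ≤ p + 2 * L → 15 * n + K * (10 * L + 346) ≤ K * n → .{{NonZero K}} → q < p
cycle-arithmetic n K L U s p q B Bₜ h₁ h₂ h₃ h₄ h₅ h₆ h₇ = *-cancelˡ-< (5 * K) _ _
  (by-slack (+-mono-≤ (+-mono-≤
    (+-mono-≤ (+-mono-≤ (+-mono-≤ (+-mono-≤ (*-monoʳ-≤ 5 h₁) (*-monoʳ-≤ 5 h₂)) (*-monoʳ-≤ K h₃))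
      (*-monoʳ-≤ (5 * K) h₄)) (*-monoʳ-≤ (5 * K) h₅)) (*-monoʳ-≤ (5 * K) h₆)) h₇)
    (pred K) (trans (+-suc-pred _ (5 * K * q) K) (identity n K L U s p q B Bₜ)))
  where
  +-suc-pred : ∀ r x K → .{{NonZero K}} → suc x + r + pred K ≡ x + r + K
  +-suc-pred r x K = trans (sym (+-suc (x + r) (pred K))) (cong (x + r +_) (suc-pred K))
  identity : ∀ n K L U s p q B Bₜ →
    5 * K * q + (5 * (9 * K + 2 * n) + 5 * (K * Bₜ + n) + K * (5 * B) + 5 * K * 60 + 5 * K * (U + s) + 5 * K *
    (p + 2 * L) + K * n) + K
    ≡ 5 * K * p + (5 * (K * U) + 5 * (K * B) + K * n + 5 * K * s + 5 * K * q + 5 * K * Bₜ +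
      (15 * n + K * (10 * L + 346)))
  identity = solve-∀

module _ {n : ℕ} (G : SphericalGraph n) where
  open Graph G
  open Rough G

  -- The weight is the total length of the links of two opposite edges; it is the quantity that the
  -- later descent increases.
  record Tetrahedron : Set where
    field
      {x x′ y y′} : Fin n
      xx′ : adj x x′ ≡ true
      yy′ : adj y y′ ≡ true
      y∈  : lk x x′ y ≡ true
      y′∈ : lk x x′ y′ ≡ true
    weight : ℕ
    weight = c x x′ + c y y′

  module _ (K L : ℕ) {A B Aₜ Bₜ : Fin n → Bool} (R : RoughBipartition K L A B Aₜ Bₜ)
           (20≤K : 20 ≤ K) (20L≤n : 20 * L ≤ n) (h₁ : 150 * (9 * K + 2 * n) < K * n)
           (h₂ : 15 * n + K * (10 * L + 346) ≤ K * n) (0<n : 0 < n) where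
    open RoughBipartition R

    private instance
      n≢0 : NonZero n
      n≢0 = >-nonZero 0<n
      K≢0 : NonZero K
      K≢0 = >-nonZero (≤-trans (s≤s z≤n) 20≤K)

    private
      U : Fin n → Bool
      U i = not (Aₜ i) ∧ not (Bₜ i)

      ¬U : (i : Fin n) → U i ≡ false → Aₜ i ≡ true ⊎ Bₜ i ≡ true
      ¬U i p with Aₜ i | Bₜ i
      ... | true  | _    = inj₁ refl
      ... | false | true = inj₂ refl

      #≤#typical : (P Pₜ : Fin n → Bool) → (∀ x → Pₜ x ≡ true → P x ≡ true) → K * # (λ x → P x ∧ not (Pₜ x)) ≤ n →
        K * # P ≤ K * # Pₜ + n
      #≤#typical P Pₜ Pₜ⊆P h = begin
        K * # P                                                       ≡⟨ cong (K *_) (#-split P Pₜ) ⟩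
        K * (# (λ x → P x ∧ Pₜ x) + # (λ x → P x ∧ not (Pₜ x)))       ≡⟨ *-distribˡ-+ K _ _ ⟩
        K * # (λ x → P x ∧ Pₜ x) + K * # (λ x → P x ∧ not (Pₜ x))
          ≤⟨ +-mono-≤ (*-monoʳ-≤ K (#-mono λ x p → proj₂ (∧-true {P x} p))) h ⟩
        K * # Pₜ + n                                                  ∎
        where open ≤-Reasoning

      #U≤ : K * # U ≤ 9 * K + 2 * n
      #U≤ = begin
        K * # U ≤⟨ *-monoʳ-≤ K (≤-trans (#-mono split) (≤-trans (#-∨≤ _ _) (+-monoʳ-≤ _ (#-∨≤ _ _)))) ⟩
        K * (# (λ i → not (A i) ∧ not (B i)) + (# A′ + # B′))  ≤⟨ *-monoʳ-≤ K (+-monoˡ-≤ _ uncovered≤9) ⟩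
        K * (9 + (# A′ + # B′))                                ≡⟨ identity K (# A′) (# B′) ⟩
        9 * K + (K * # A′ + K * # B′)                          ≤⟨ +-monoʳ-≤ (9 * K) (+-mono-≤ A∖Aₜ B∖Bₜ) ⟩
        9 * K + (n + n)                                        ≡⟨ cong (λ x → 9 * K + (n + x)) (sym (+-identityʳ n)) ⟩
        9 * K + 2 * n                                          ∎
        where
        open ≤-Reasoning
        A′ B′ : Fin n → Bool
        A′ x = A x ∧ not (Aₜ x)
        B′ x = B x ∧ not (Bₜ x)
        identity : ∀ k a b → k * (9 + (a + b)) ≡ 9 * k + (k * a + k * b)
        identity = solve-∀
        split : ∀ i → U i ≡ true → (not (A i) ∧ not (B i)) ∨ (A′ i ∨ B′ i) ≡ true
        split i p with A i | B i | Aₜ i | Bₜ i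
        ... | true  | _     | false | false = refl
        ... | false | true  | false | false = refl
        ... | false | false | false | false = refl

      n≤10Aₜ : n ≤ 10 * # Aₜ
      n≤10Aₜ = density-arithmetic n K 0 (# A) (# Aₜ) (# Aₜ) (#≤#typical A Aₜ Aₜ⊆A A∖Aₜ) n≤5A (m≤m+n _ 0) 20≤K z≤n

      codegₜ : (x : Fin n) → Aₜ x ≡ true → codeg Bₜ x ≤ L
      codegₜ x p = ≤-trans (#-mono λ y q → let a , b = ∧-true q in Bₜ⊆B y a ∧ᵗ b) (codegA x p)

      n≤10deg : (x : Fin n) → Aₜ x ≡ true → n ≤ 10 * deg Bₜ x
      n≤10deg x p = density-arithmetic n K L (# B) (# Bₜ) (deg Bₜ x) (#≤#typical B Bₜ Bₜ⊆B B∖Bₜ) n≤5B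
        (≤-trans (≤-reflexive (sym (deg+codeg Bₜ x))) (+-monoʳ-≤ _ (codegₜ x p))) 20≤K 20L≤n

      X : ℕ
      X = e Aₜ Bₜ

      n²≤100X : n * n ≤ 100 * X
      n²≤100X = begin
        n * n               ≤⟨ *-monoˡ-≤ n n≤10Aₜ ⟩
        10 * # Aₜ * n       ≡⟨ *-assoc 10 (# Aₜ) n ⟩
        10 * (# Aₜ * n)     ≤⟨ *-monoʳ-≤ 10 (sumOn-≥const Aₜ (λ x → 10 * deg Bₜ x) n n≤10deg) ⟩
        10 * sumOn Aₜ (λ x → 10 * deg Bₜ x) ≡⟨ cong (10 *_) (sumOn-* Aₜ 10 (deg Bₜ)) ⟩
        10 * (10 * X)       ≡⟨ *-assoc 10 10 X ⟨
        100 * X             ∎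
        where open ≤-Reasoning

      Bₜ∩N : Fin n → Fin n → Bool
      Bₜ∩N x b = Bₜ b ∧ adj x b

      -- Summing over the atypical vertex `y` first leaves the degree sum in the link of `y`, which
      -- is at most 6n.
      U-triangles : sumOn Aₜ (λ x → sumOn (Bₜ∩N x) (λ b → # (λ y → U y ∧ lk x b y))) ≤ # U * (6 * n)
      U-triangles = begin
        sumOn Aₜ (λ x → sumOn (Bₜ∩N x) (λ b → # (λ y → U y ∧ lk x b y)))
          ≤⟨ sumOn-mono Aₜ (λ x _ → sumOn-⊆ (Bₜ∩N x) (adj x) _ λ b p → proj₂ (∧-true {Bₜ b} p)) ⟩
        sumOn Aₜ (λ x → sumOn (adj x) (λ b → # (λ y → U y ∧ lk x b y)))
          ≤⟨ sumOn-⊆ Aₜ (λ _ → true) _ (λ _ _ → refl) ⟩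
        sumOn (λ _ → true) (λ x → sumOn (adj x) (λ b → # (λ y → U y ∧ lk x b y)))
          ≡⟨ sumOn-cong (λ _ → true)
            (λ x _ → trans (sumOn-cong (adj x) λ b _ → sym (sumOn-⟦⟧ U (lk x b))) (sumOn-comm (adj x) U _)) ⟩
        sumOn (λ _ → true) (λ x → sumOn U (λ y → sumOn (adj x) (λ b → ⟦ lk x b y ⟧)))
          ≡⟨ sumOn-comm (λ _ → true) U _ ⟩
        sumOn U (λ y → sumOn (λ _ → true) (λ x → sumOn (adj x) (λ b → ⟦ lk x b y ⟧)))
          ≡⟨ sumOn-cong U (λ y _ →
            trans (sumOn-true _) (trans (sum-cong (λ x → inner x y)) (sym (sumOn-sum (adj y) (c y))))) ⟩
        sumOn U (λ y → sumOn (adj y) (c y))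
          ≤⟨ sumOn-≤const U _ (6 * n) (λ y _ → ≤-trans (Σc≤6d y) (*-monoʳ-≤ 6 (d≤n y))) ⟩
        # U * (6 * n) ∎
        where
        open ≤-Reasoning
        swap-adj : ∀ x b y → adj x b ∧ adj b y ≡ adj y b ∧ adj x b
        swap-adj x b y = trans (cong (adj x b ∧_) (adj-sym b y)) (∧-comm (adj x b) (adj y b))
        inner : ∀ x y → sumOn (adj x) (λ b → ⟦ lk x b y ⟧) ≡ ⟦ adj y x ⟧ * c y x
        inner x y with adj x y in eq
        ... | true  rewrite trans (adj-sym y x) eq = trans (sumOn-⟦⟧ (adj x) (λ b → adj b y))
            (trans (#-cong λ b → swap-adj x b y) (sym (+-identityʳ (c y x))))
        ... | false rewrite trans (adj-sym y x) eq = trans (sumOn-const (adj x) 0) (*-zeroʳ (d x))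

      4X≤ : 4 * X ≤ sumOn Aₜ (λ x → sumOn (Bₜ∩N x) (c x))
      4X≤ = ≤-trans (≤-reflexive (sym (sumOn-* Aₜ 4 (deg Bₜ)))) (sumOn-mono Aₜ λ x _ →
        ≤-trans (≤-reflexive (*-comm 4 (deg Bₜ x)))
          (sumOn-≥const (Bₜ∩N x) (c x) 4 λ b p → 4≤c (proj₂ (∧-true {Bₜ b} p))))

      #<#⇒∃ : ∀ (P Q : Fin n → Bool) → # (λ y → P y ∧ Q y) < # Q → ∃ λ y → P y ≡ false × Q y ≡ true
      #<#⇒∃ P Q lt with sum-<⇒∃ _ _ (subst₂ _<_ (#-sum (λ y → P y ∧ Q y)) (#-sum Q) lt)
      ... | y , q with P y in eq₁ | Q y in eq₂
      ... | false | true  = y , eq₁ , eq₂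
      ... | true  | true  = contradiction q λ { (s≤s ()) }
      ... | true  | false = contradiction q λ ()
      ... | false | false = contradiction q λ ()

    private
      few-U-triangles : sumOn Aₜ (λ x → sumOn (Bₜ∩N x) (λ b → # (λ y → U y ∧ lk x b y))) < sumOn Aₜ
        (λ x → sumOn (Bₜ∩N x) (c x))
      few-U-triangles = ≤-<-trans U-triangles (<-≤-trans (atypical-arithmetic n K (# U) X #U≤ h₁ n²≤100X) 4X≤)

    -- Each of the at least n²/100 edges between `Aₜ` and `Bₜ` lies in four triangles or more,
    -- whereas the few atypical vertices lie in O(n) triangles each. So one of these triangles has
    -- only typical vertices, and two of them are on the same side.
    typical-edge : ∃ λ x → ∃ λ y → adj x y ≡ true × ((Aₜ x ≡ true × Aₜ y ≡ true) ⊎ (Bₜ x ≡ true × Bₜ y ≡ true))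
    typical-edge = choose-x (sumOn-<⇒∃ Aₜ _ _ few-U-triangles)
      where
      Goal : Set
      Goal = ∃ λ x → ∃ λ y → adj x y ≡ true × ((Aₜ x ≡ true × Aₜ y ≡ true) ⊎ (Bₜ x ≡ true × Bₜ y ≡ true))
      choose-y : ∀ {x b} → Aₜ x ≡ true → Bₜ b ≡ true → (∃ λ y → U y ≡ false × lk x b y ≡ true) → Goal
      choose-y {x} {b} x∈ b∈ (y , y∉U , y∈lk) with ¬U y y∉U
      ... | inj₁ y∈ = x , y , proj₁ (∧-true y∈lk) , inj₁ (x∈ , y∈)
      ... | inj₂ y∈ = b , y , proj₂ (∧-true {adj x y} y∈lk) , inj₂ (b∈ , y∈)
      choose-b : ∀ {x} → Aₜ x ≡ true → (∃ λ b → Bₜ∩N x b ≡ true × # (λ y → U y ∧ lk x b y) < c x b) → Goal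
      choose-b {x} x∈ (b , p , lt) = choose-y x∈ (proj₁ (∧-true p)) (#<#⇒∃ U (lk x b) lt)
      choose-x : (∃ λ x → Aₜ x ≡ true × sumOn (Bₜ∩N x) (λ b → # (λ y → U y ∧ lk x b y)) < sumOn (Bₜ∩N x) (c x)) → Goal
      choose-x (x , x∈ , lt) = choose-b x∈ (sumOn-<⇒∃ (Bₜ∩N x) _ _ lt)

    private
      #B≤c : (P : Fin n → Bool) (x y : Fin n) → (codeg P x ≤ L) → (codeg P y ≤ L) → # P ≤ # (λ z → lk x y z ∧ P z) + 2 *
        L
      #B≤c P x y hx hy = begin
        # P                                             ≤⟨ #-mono split ⟩
        # (λ z → (lk x y z ∧ P z) ∨ ((P z ∧ not (adj x z)) ∨ (P z ∧ not (adj y z))))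
          ≤⟨ ≤-trans (#-∨≤ _ _) (+-monoʳ-≤ _ (#-∨≤ _ _)) ⟩
        # (λ z → lk x y z ∧ P z) + (codeg P x + codeg P y)
          ≤⟨ +-monoʳ-≤ (# (λ z → lk x y z ∧ P z)) (+-mono-≤ hx (≤-trans hy (≤-reflexive (sym (+-identityʳ L))))) ⟩
        # (λ z → lk x y z ∧ P z) + 2 * L                ∎
        where
        open ≤-Reasoning
        split : ∀ z → P z ≡ true → (lk x y z ∧ P z) ∨ ((P z ∧ not (adj x z)) ∨ (P z ∧ not (adj y z))) ≡ true
        split z p rewrite p with adj x z | adj y z
        ... | true  | true  = refl
        ... | true  | false = refl
        ... | false | _     = refl

      #P≤c : (P : Fin n → Bool) (x y : Fin n) → (codeg P x ≤ L) → (codeg P y ≤ L) → # P ≤ c x y + 2 * L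
      #P≤c P x y hx hy = ≤-trans (#B≤c P x y hx hy) (+-monoˡ-≤ _ (#-mono λ z p → proj₁ (∧-true p)))

    private
     module _ {x x′ : Fin n} (xx′ : adj x x′ ≡ true) (x∈ : Aₜ x ≡ true) (x′∈ : Aₜ x′ ≡ true) where
      open ≤-Reasoning
      Y P Q S : Fin n → Bool
      Y = lk x x′
      P b = Y b ∧ Bₜ b
      Q b = not (Bₜ b) ∧ Y b
      S z = Aₜ z ∧ adj x z
      -- Two adjacent typical vertices on the same side have at least `# B` - 2L ≥ n/10 common
      -- neighbours, but the numbers `c x z` add up to at most 6n.
      S≤60 : # S ≤ 60
      S≤60 = *-cancelʳ-≤ (# S) 60 n (begin
        # S * n                        ≤⟨ *-monoʳ-≤ (# S) (n≤10deg′) ⟩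
        # S * (10 * (# B ∸ 2 * L))     ≡⟨ identity′ (# S) (# B ∸ 2 * L) ⟩
        10 * (# S * (# B ∸ 2 * L))     ≤⟨ *-monoʳ-≤ 10 (sumOn-≥const S (c x) (# B ∸ 2 * L) λ z p →
                                            m≤n+o⇒m∸n≤o (# B) (2 * L)
                                              (≤-trans (#P≤c B x z (codegA x x∈) (codegA z (proj₁ (∧-true {Aₜ z} p))))
                                              (≤-reflexive (+-comm (c x z) (2 * L))))) ⟩
        10 * sumOn S (c x)             ≤⟨ *-monoʳ-≤ 10 (sumOn-⊆ S (adj x) (c x) λ z p → proj₂ (∧-true {Aₜ z} p)) ⟩
        10 * sumOn (adj x) (c x)       ≤⟨ *-monoʳ-≤ 10 (≤-trans (Σc≤6d x) (*-monoʳ-≤ 6 (d≤n x))) ⟩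
        10 * (6 * n)                   ≡⟨ *-assoc 10 6 n ⟨
        60 * n                         ∎)
        where
        identity′ : ∀ s b → s * (10 * b) ≡ 10 * (s * b)
        identity′ = solve-∀
        n≤10deg′ : n ≤ 10 * (# B ∸ 2 * L)
        n≤10deg′ = begin
          n
            ≤⟨ m+n≤o⇒m≤o∸n n (≤-trans (+-monoʳ-≤ n 20L≤n)
            (≤-trans (≤-reflexive (cong (n +_) (sym (+-identityʳ n)))) (*-monoʳ-≤ 2 n≤5B))) ⟩
          2 * (5 * # B) ∸ 20 * L        ≡⟨ cong₂ _∸_ (sym (*-assoc 2 5 (# B))) (*-assoc 10 2 L) ⟩
          10 * # B ∸ 10 * (2 * L)       ≡⟨ *-distribˡ-∸ 10 (# B) (2 * L) ⟨
          10 * (# B ∸ 2 * L)            ∎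
      Q≤ : # Q ≤ # U + # S
      Q≤ = ≤-trans (#-mono split) (#-∨≤ U S)
        where
        split : ∀ z → Q z ≡ true → U z ∨ S z ≡ true
        split z p with Aₜ z | Bₜ z | adj x z
        ... | true  | false | true = refl
        ... | false | false | _    = refl
      Q<P : # Q < # P
      Q<P = cycle-arithmetic n K L (# U) (# S) (# P) (# Q) (# B) (# Bₜ) #U≤ (#≤#typical B Bₜ Bₜ⊆B B∖Bₜ) n≤5B S≤60 Q≤
        (#B≤c Bₜ x x′ (codegₜ x x∈) (codegₜ x′ x′∈)) h₂
      -- If no edge of the link cycle joined two typical vertices, all 2 · `# P` edge ends at `P`
      -- would be matched by edge ends at `Q`, and there are at most 2 · `# Q` of those.
      degs : sumOn P (deg Q) < sumOn P (deg Y)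
      degs = begin-strict
        e P Q               ≡⟨ e-sym P Q ⟩
        e Q P               ≤⟨ sumOn-≤const Q (deg P) 2 (λ z p → ≤-trans (deg-mono P Y z λ y q → proj₁ (∧-true q))
                                 (≤-reflexive (lk-2-regular xx′ (proj₂ (∧-true {not (Bₜ z)} p))))) ⟩
        # Q * 2             <⟨ *-monoˡ-< 2 Q<P ⟩
        # P * 2             ≤⟨ sumOn-≥const P (deg Y) 2
          (λ z p → ≤-reflexive (sym (lk-2-regular xx′ (proj₁ (∧-true p))))) ⟩
        sumOn P (deg Y)     ∎

      neighbour : ∀ b → P b ≡ true → deg Q b < deg Y b → ∃ λ b′ → Bₜ b′ ≡ true × Y b′ ≡ true × adj b b′ ≡ true
      neighbour b p lt with #<#⇒∃ (λ z → not (Bₜ z)) (λ z → Y z ∧ adj b z)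
            (subst (_< deg Y b) (#-cong λ z → ∧-assoc (not (Bₜ z)) (Y z) (adj b z)) lt)
      ... | b′ , b′∉ , q = b′ , not-false b′∉ , proj₁ (∧-true q) , proj₂ (∧-true {Y b′} q)

      consecutive : ∃ λ b → ∃ λ b′ → (Bₜ b ≡ true × Y b ≡ true) × (Bₜ b′ ≡ true × Y b′ ≡ true) × adj b b′ ≡ true
      consecutive = choose (sumOn-<⇒∃ P (deg Q) (deg Y) degs)
        where
        choose : (∃ λ b → P b ≡ true × deg Q b < deg Y b) →
          ∃ λ b → ∃ λ b′ → (Bₜ b ≡ true × Y b ≡ true) × (Bₜ b′ ≡ true × Y b′ ≡ true) × adj b b′ ≡ true
        choose (b , p , lt) with neighbour b p lt
        ... | b′ , b′∈Bₜ , b′∈Y , bb′ = b , b′ , (proj₂ (∧-true {Y b} p) , proj₁ (∧-true p)) , (b′∈Bₜ , b′∈Y) , bb′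

    -- All four vertices are typical. Each misses at most `L` vertices of the other side, so the two
    -- links together lose at most 4L, and 9 vertices may be uncovered from the start.
    rough-tetrahedron : ∀ {x x′} → adj x x′ ≡ true → Aₜ x ≡ true → Aₜ x′ ≡ true →
      Σ Tetrahedron λ t → n ≤ Tetrahedron.weight t + (4 * L + 9)
    rough-tetrahedron {x} {x′} xx′ x∈ x′∈ = build (consecutive xx′ x∈ x′∈)
      where
      open ≤-Reasoning
      identity : ∀ p q l → p + 2 * l + (q + 2 * l) + 9 ≡ q + p + (4 * l + 9)
      identity = solve-∀
      build : (∃ λ b → ∃ λ b′ → (Bₜ b ≡ true × lk x x′ b ≡ true) × (Bₜ b′ ≡ true × lk x x′ b′ ≡ true) × adj b b′ ≡
        true) →
        Σ Tetrahedron λ t → n ≤ Tetrahedron.weight t + (4 * L + 9)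
      build (b , b′ , (b∈Bₜ , b∈Y) , (b′∈Bₜ , b′∈Y) , bb′) =
        record { xx′ = xx′ ; yy′ = bb′ ; y∈ = b∈Y ; y′∈ = b′∈Y } , (begin
        n                                             ≤⟨ n≤A+B ⟩
        # A + # B + 9                                 ≤⟨ +-monoˡ-≤ 9 (+-mono-≤
          (#P≤c A b b′ (codegB b b∈Bₜ) (codegB b′ b′∈Bₜ)) (#P≤c B x x′ (codegA x x∈) (codegA x′ x′∈))) ⟩
        c b b′ + 2 * L + (c x x′ + 2 * L) + 9         ≡⟨ identity (c b b′) (c x x′) L ⟩
        c x x′ + c b b′ + (4 * L + 9)                 ∎)

-- Cycles in the links of opposite edges

-- Again the squares cancel. A vertex has only two neighbours on its own cycle, so apart from a
-- linear term only the `r` outer vertices contribute, at most 2n each to the degree sum.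
cycle-pair-arithmetic : ∀ n D α β X m r → n * n + 2 * n + 18 ≤ 2 * D → D ≤ 2 * (α + β) + 2 * X + 2 * (r * n) →
  X + m ≡ α * β → α + β ≤ n → m ≤ (r + 1) * n
cycle-pair-arithmetic n D α β X m r h₁ h₂ h₃ h₄ = *-cancelˡ-≤ 4
  (by-slack (+-mono-≤ (+-mono-≤ (+-mono-≤ (+-mono-≤ (+-mono-≤ h₁ (*-monoʳ-≤ 2 h₂)) (*-monoʳ-≤ 4 (≤-reflexive h₃)))
    (4xy≤[x+y]² α β)) (*-mono-≤ h₄ h₄)) (*-monoʳ-≤ 4 h₄))
    (2 * n + 18) (identity n D α β X m r))
  where
  identity : ∀ n D α β X m r →
    4 * m + (2 * D + 2 * (2 * (α + β) + 2 * X + 2 * (r * n)) + 4 * (α * β) + (α + β) * (α + β) + n * n + 4 * n) +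
    (2 * n + 18)
    ≡ 4 * ((r + 1) * n) + ((n * n + 2 * n + 18) + 2 * D + 4 * (X + m) + 4 * (α * β) + (α + β) * (α + β) + 4 * (α + β))
  identity = solve-∀

cycle-length-arithmetic : ∀ n D α β X m r → n * n + 2 * n + 18 ≤ 2 * D → D ≤ 2 * (α + β) + 2 * X + 2 * (r * n) →
  X + m ≡ α * β → α + β ≤ n → 20 * r + 11 ≤ n → n ≤ 5 * β
cycle-length-arithmetic n D α β X m r h₁ h₂ h₃ h₄ h₅ with n ≤? 5 * β
... | yes p = p
... | no ¬p = absurd-slack
  (+-mono-≤ (+-mono-≤ (+-mono-≤ (+-mono-≤ (+-mono-≤ (*-monoʳ-≤ 5 h₁) (*-monoʳ-≤ 10 h₂)) (*-monoʳ-≤ 20 (≤-reflexive h₃)))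
    (*-monoʳ-≤ 4 (*-mono-≤ (≤-trans (m≤m+n α β) h₄) (<⇒≤ (≰⇒> ¬p))))) (*-monoʳ-≤ 20 h₄)) (*-monoʳ-≤ n h₅))
  (20 * m + n + 89) (identity n D α β X m r)
  where
  identity : ∀ n D α β X m r →
    suc (5 * (2 * D) + 10 * (2 * (α + β) + 2 * X + 2 * (r * n)) + 20 * (α * β) + 4 * (n * n) + 20 * n + n * n +
    (20 * m + n + 89))
    ≡ 5 * (n * n + 2 * n + 18) + 10 * D + 20 * (X + m) + 4 * (α * (5 * β)) + 20 * (α + β) + n * (20 * r + 11)
  identity = solve-∀

module Cycles {n : ℕ} (G : SphericalGraph n) where
  open Graph G

  -- Exchanges the two cycles, so that each statement is proved for one of them only.
  opposite : Tetrahedron G → Tetrahedron G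
  opposite t = record
    { xx′ = yy′ ; yy′ = xx′
    ; y∈ = flip (proj₁ (∧-true y∈)) ∧ᵗ flip (proj₁ (∧-true y′∈))
    ; y′∈ = flip (proj₂ (∧-true {adj x y} y∈)) ∧ᵗ flip (proj₂ (∧-true {adj x y′} y′∈)) }
    where open Tetrahedron t

  -- The links of the opposite edges yy′ and xx′ of a tetrahedron are disjoint induced cycles, the candidates
  -- for the two factors of the join; each edge of a tetrahedron lies in the link of the opposite one.
  ZA ZB R : Tetrahedron G → Fin n → Bool
  ZA t = lk (Tetrahedron.y t) (Tetrahedron.y′ t)
  ZB t = lk (Tetrahedron.x t) (Tetrahedron.x′ t)
  R t i = not (ZA t i) ∧ not (ZB t i)

  module _ (t : Tetrahedron G) where
    open Tetrahedron t

    ZA-regular : ∀ {z} → ZA t z ≡ true → deg (ZA t) z ≡ 2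
    ZA-regular = lk-2-regular yy′

    ZB-regular : ∀ {z} → ZB t z ≡ true → deg (ZB t) z ≡ 2
    ZB-regular = lk-2-regular xx′

    -- A common vertex would form a complete graph on five vertices with the tetrahedron.
    ZA-∌ZB : ∀ {z} → ZA t z ≡ true → ZB t z ≡ true → ⊥
    ZA-∌ZB {z} p q = lk-no-triangle xx′ y∈ y′∈ q yy′ (proj₁ (∧-true p)) (proj₂ (∧-true {adj y z} p))

    x∈ZA : ZA t x ≡ true
    x∈ZA = flip (proj₁ (∧-true y∈)) ∧ᵗ flip (proj₁ (∧-true y′∈))

    ZA-minimal : ∀ {u v} → adj u v ≡ true → (∀ z → ZA t z ≡ true → lk u v z ≡ true) → ∀ z → lk u v z ≡ true →
      ZA t z ≡ true
    ZA-minimal uv ZA⊆lk = lk-minimal uv (ZA t) ZA⊆lk (λ z z∈ → ≤-reflexive (sym (ZA-regular z∈))) x∈ZA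

    #R+#Z≡n : # (R t) + (# (ZA t) + # (ZB t)) ≡ n
    #R+#Z≡n = begin
      # (R t) + (# (ZA t) + # (ZB t))                             ≡⟨ cong (λ k → # (R t) + (# (ZA t) + k)) ZB≡ ⟩
      # (R t) + (# (ZA t) + # (λ i → not (ZA t i) ∧ ZB t i))      ≡⟨ lemma (# (R t)) (# (ZA t)) _ ⟩
      # (ZA t) + (# (λ i → not (ZA t i) ∧ ZB t i) + # (R t))
        ≡⟨ cong (# (ZA t) +_) (#-split (λ i → not (ZA t i)) (ZB t)) ⟨
      # (ZA t) + # (λ i → not (ZA t i))                           ≡⟨ #-not (ZA t) ⟩
      n                                                           ∎
      where
      open ≡-Reasoning
      lemma : ∀ r a b → r + (a + b) ≡ a + (b + r)
      lemma = solve-∀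
      ZB≡ : # (ZB t) ≡ # (λ i → not (ZA t i) ∧ ZB t i)
      ZB≡ = #-cong same
        where
        same : ∀ i → ZB t i ≡ not (ZA t i) ∧ ZB t i
        same i with ZA t i in p | ZB t i in q
        ... | true  | true  = ⊥-elim (ZA-∌ZB p q)
        ... | true  | false = refl
        ... | false | _     = refl

    #Z≤n : # (ZA t) + # (ZB t) ≤ n
    #Z≤n = ≤-trans (m≤n+m _ (# (R t))) (≤-reflexive #R+#Z≡n)

    #R≤ : ∀ C → n ≤ weight + C → # (R t) ≤ C
    #R≤ C h = +-cancelʳ-≤ (# (ZA t) + # (ZB t)) (# (R t)) C (≤-trans (≤-reflexive #R+#Z≡n)
      (≤-trans h (≤-reflexive (trans (cong (_+ C) (+-comm (c x x′) (c y y′))) (+-comm (c y y′ + c x x′) C)))))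

    R-cover : ∀ i → ZA t i ≡ false → ZB t i ≡ false → R t i ≡ true
    R-cover i p q rewrite p | q = refl

    missing : ℕ
    missing = sumOn (ZA t) (codeg (ZB t))

    ZA-degree-sum : sumOn (ZA t) d ≤ # (ZA t) * 2 + (e (ZA t) (ZB t) + e (R t) (ZA t))
    ZA-degree-sum = begin
      sumOn (ZA t) d ≤⟨ sumOn-mono (ZA t) (λ z _ → d≤cover (ZA t) (ZB t) (R t) R-cover z) ⟩
      sumOn (ZA t) (λ z → deg (ZA t) z + (deg (ZB t) z + deg (R t) z))
        ≡⟨ trans (sumOn-+ (ZA t) _ _) (cong₂ _+_ (trans (sumOn-cong (ZA t) λ z p → ZA-regular p) (sumOn-const (ZA t) 2))
          (sumOn-+ (ZA t) _ _)) ⟩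
      # (ZA t) * 2 + (e (ZA t) (ZB t) + e (ZA t) (R t))
        ≡⟨ cong (λ k → # (ZA t) * 2 + (e (ZA t) (ZB t) + k)) (e-sym (ZA t) (R t)) ⟩
      # (ZA t) * 2 + (e (ZA t) (ZB t) + e (R t) (ZA t)) ∎
      where open ≤-Reasoning

    ZB-degree-sum : sumOn (ZB t) d ≤ # (ZB t) * 2 + (e (ZA t) (ZB t) + e (R t) (ZB t))
    ZB-degree-sum = begin
      sumOn (ZB t) d ≤⟨ sumOn-mono (ZB t) (λ z _ → d≤cover (ZB t) (ZA t) (R t) (λ i p q → R-cover i q p) z) ⟩
      sumOn (ZB t) (λ z → deg (ZB t) z + (deg (ZA t) z + deg (R t) z))
        ≡⟨ trans (sumOn-+ (ZB t) _ _) (cong₂ _+_ (trans (sumOn-cong (ZB t) λ z p → ZB-regular p) (sumOn-const (ZB t) 2))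
          (sumOn-+ (ZB t) _ _)) ⟩
      # (ZB t) * 2 + (e (ZB t) (ZA t) + e (ZB t) (R t))
        ≡⟨ cong₂ (λ k l → # (ZB t) * 2 + (k + l)) (e-sym (ZB t) (ZA t)) (e-sym (ZB t) (R t)) ⟩
      # (ZB t) * 2 + (e (ZA t) (ZB t) + e (R t) (ZB t)) ∎
      where open ≤-Reasoning

    D≤ : D ≤ 2 * (# (ZA t) + # (ZB t)) + 2 * e (ZA t) (ZB t) + 2 * (# (R t) * n)
    D≤ = begin
      D ≤⟨ sum≤cover (ZA t) (ZB t) (R t) d R-cover ⟩
      sumOn (ZA t) d + (sumOn (ZB t) d + sumOn (R t) d)
        ≤⟨ +-mono-≤ ZA-degree-sum (+-mono-≤ ZB-degree-sum (sumOn-≤const (R t) d n λ w _ → d≤n w)) ⟩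
      (a * 2 + (e (ZA t) (ZB t) + e (R t) (ZA t))) + ((b * 2 + (e (ZA t) (ZB t) + e (R t) (ZB t))) + r * n)
        ≡⟨ lemma a b (e (ZA t) (ZB t)) (e (R t) (ZA t)) (e (R t) (ZB t)) (r * n) ⟩
      2 * (a + b) + 2 * e (ZA t) (ZB t) + (e (R t) (ZA t) + e (R t) (ZB t)) + r * n
        ≤⟨ +-monoˡ-≤ (r * n) (+-monoʳ-≤ (2 * (a + b) + 2 * e (ZA t) (ZB t)) rest) ⟩
      2 * (a + b) + 2 * e (ZA t) (ZB t) + r * n + r * n
        ≡⟨ lemma′ (2 * (a + b) + 2 * e (ZA t) (ZB t)) (r * n) ⟩
      2 * (a + b) + 2 * e (ZA t) (ZB t) + 2 * (r * n) ∎
      where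
      open ≤-Reasoning
      a b r : ℕ
      a = # (ZA t)
      b = # (ZB t)
      r = # (R t)
      lemma : ∀ a b e x y k → (a * 2 + (e + x)) + ((b * 2 + (e + y)) + k) ≡ 2 * (a + b) + 2 * e + (x + y) + k
      lemma = solve-∀
      lemma′ : ∀ x k → x + k + k ≡ x + 2 * k
      lemma′ = solve-∀
      rest : e (R t) (ZA t) + e (R t) (ZB t) ≤ r * n
      rest = begin
        e (R t) (ZA t) + e (R t) (ZB t)                     ≡⟨ sumOn-+ (R t) (deg (ZA t)) (deg (ZB t)) ⟨
        sumOn (R t) (λ w → deg (ZA t) w + deg (ZB t) w)
          ≤⟨ sumOn-≤const (R t) _ n (λ w _ → ≤-trans (+-mono-≤ (deg≤# (ZA t) w) (deg≤# (ZB t) w)) #Z≤n) ⟩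
        r * n                                               ∎

    missing≤ : n * n + 2 * n + 18 ≤ 2 * D → missing ≤ (# (R t) + 1) * n
    missing≤ h = cycle-pair-arithmetic n D (# (ZA t)) (# (ZB t)) (e (ZA t) (ZB t)) missing (# (R t)) h D≤
      (e+codeg (ZA t) (ZB t)) #Z≤n

    n≤5ZB : n * n + 2 * n + 18 ≤ 2 * D → 20 * # (R t) + 11 ≤ n → n ≤ 5 * # (ZB t)
    n≤5ZB h h′ = cycle-length-arithmetic n D (# (ZA t)) (# (ZB t)) (e (ZA t) (ZB t)) missing (# (R t)) h D≤
      (e+codeg (ZA t) (ZB t)) #Z≤n h′

    missing-near : ∀ w → sumOn (λ a → ZA t a ∧ adj w a) (codeg (λ b → ZB t b ∧ adj w b)) ≤ missing
    missing-near w = ≤-trans (sumOn-⊆ _ (ZA t) _ λ a p → proj₁ (∧-true p))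
      (sumOn-mono (ZA t) λ a _ → #-mono λ b p → let q , r = ∧-true {ZB t b ∧ adj w b} p in proj₁ (∧-true q) ∧ᵗ r)

    sumOn-parts : ∀ w (f : Fin n → ℕ) → sumOn (λ a → ZA t a ∧ adj w a) f + sumOn (λ b → ZB t b ∧ adj w b) f ≤ sumOn
      (adj w) f
    sumOn-parts w f = begin
      sumOn (λ a → ZA t a ∧ adj w a) f + sumOn (λ b → ZB t b ∧ adj w b) f ≤⟨ +-mono-≤
        (sumOn-⊆ (λ a → ZA t a ∧ adj w a) (λ i → adj w i ∧ ZA t i) f λ i p → let q , r = ∧-true {ZA t i} p in r ∧ᵗ q)
        (sumOn-⊆ (λ b → ZB t b ∧ adj w b) (λ i → adj w i ∧ not (ZA t i)) f λ i p → let q , r = ∧-true {ZB t i} p in r ∧ᵗ notZA i q) ⟩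
      sumOn (λ i → adj w i ∧ ZA t i) f + sumOn (λ i → adj w i ∧ not (ZA t i)) f ≡⟨ sumOn-split (adj w) (ZA t) f ⟨
      sumOn (adj w) f ∎
      where
      open ≤-Reasoning
      notZA : ∀ i → ZB t i ≡ true → not (ZA t i) ≡ true
      notZA i q with ZA t i in p
      ... | false = refl
      ... | true  = ⊥-elim (ZA-∌ZB p q)

    -- A pair of neighbours of `w` on different cycles is either one of the missing pairs or an edge
    -- of the link of `w`, which has at most 3n edges.
    deg-product : ∀ w → deg (ZA t) w * deg (ZB t) w ≤ missing + 3 * n
    deg-product w = begin
      # S * # T                        ≡⟨ e+codeg S T ⟨
      e S T + sumOn S (codeg T)        ≡⟨ +-comm (e S T) _ ⟩
      sumOn S (codeg T) + e S T        ≤⟨ +-mono-≤ (missing-near w) (*-cancelˡ-≤ 2 twice) ⟩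
      missing + 3 * n                  ∎
      where
      open ≤-Reasoning
      S T : Fin n → Bool
      S a = ZA t a ∧ adj w a
      T b = ZB t b ∧ adj w b
      lemma : ∀ x → 2 * x ≡ x + x
      lemma = solve-∀
      common : ∀ P → (∀ z → P z ≡ true → adj w z ≡ true) → ∀ z → deg P z ≤ c w z
      common P P⊆ z = #-mono λ y p → let Py , zy = ∧-true {P y} p in P⊆ y Py ∧ᵗ zy
      twice : 2 * e S T ≤ 2 * (3 * n)
      twice = begin
        2 * e S T                                    ≡⟨ lemma (e S T) ⟩
        e S T + e S T                                ≡⟨ cong (e S T +_) (e-sym S T) ⟩
        e S T + e T S                                ≤⟨ +-mono-≤
          (sumOn-mono S λ z _ → common T (λ i p → proj₂ (∧-true {ZB t i} p)) z)
          (sumOn-mono T λ z _ → common S (λ i p → proj₂ (∧-true {ZA t i} p)) z) ⟩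
        sumOn S (c w) + sumOn T (c w)                ≤⟨ sumOn-parts w (c w) ⟩
        sumOn (adj w) (c w)                          ≤⟨ Σc≤6d w ⟩
        6 * d w                                      ≤⟨ *-monoʳ-≤ 6 (d≤n w) ⟩
        6 * n                                        ≡⟨ *-assoc 2 3 n ⟩
        2 * (3 * n)                                  ∎

-- Twins on a cycle

sumOn-∧ : ∀ {n} (P Q : Fin n → Bool) (f : Fin n → ℕ) → sumOn (λ i → P i ∧ Q i) f ≡ sumOn P (λ i → ⟦ Q i ⟧ * f i)
sumOn-∧ P Q f = trans (sumOn-sum _ f)
  (trans (sum-cong λ i → trans (cong (_* f i) (⟦∧⟧ (P i) (Q i))) (*-assoc ⟦ P i ⟧ _ _)) (sym (sumOn-sum P _)))

∨-case : ∀ {a b} {A : Set} → a ∨ b ≡ true → (a ≡ true → A) → (b ≡ true → A) → A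
∨-case {true}  _ f g = f refl
∨-case {false} p f g = g p

opaque
  -- A bound for the total of `exit-weight` over ZB: at most rK edges between `RB` and ZB, and for
  -- each of at most r + rK vertices of `A⁺` six times the number of its neighbours outside ZB,
  -- which is at most K + 2 + r.
  twin-constant : ℕ → ℕ → ℕ
  twin-constant r K = r * K + (r + r * K) * (6 * (K + 2 + r))

  twin-constant-≡ : ∀ r K → r * K + (r + r * K) * (6 * (K + 2 + r)) ≡ twin-constant r K
  twin-constant-≡ r K = refl

module Twins {n : ℕ} (G : SphericalGraph n) where
  open Graph G
  open Cycles G

  -- A vertex of ZA has just two neighbours on ZA, so an outer vertex with at most `K` of them
  -- imitates a vertex of that cycle and joins its side. `R₀` holds the vertices that are put on
  -- neither side.
  record Sides (t : Tetrahedron G) (K : ℕ) (RA RB R₀ : Fin n → Bool) : Set where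
    field
      RA⊆R  : ∀ w → RA w ≡ true → R t w ≡ true
      RB⊆R  : ∀ w → RB w ≡ true → R t w ≡ true
      R₀⊆R  : ∀ w → R₀ w ≡ true → R t w ≡ true
      degA  : ∀ w → RA w ≡ true → deg (ZA t) w ≤ K
      degB  : ∀ w → RB w ≡ true → deg (ZB t) w ≤ K
      RA∌RB : ∀ w → RA w ≡ true → RB w ≡ true → ⊥
      RA∌R₀ : ∀ w → RA w ≡ true → R₀ w ≡ true → ⊥
      RB∌R₀ : ∀ w → RB w ≡ true → R₀ w ≡ true → ⊥
      cover : ∀ w → R t w ≡ true → RA w ≡ false → RB w ≡ false → R₀ w ≡ true

  R-swap : ∀ t w → R (opposite t) w ≡ R t w
  R-swap t w = ∧-comm (not (ZB t w)) (not (ZA t w))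

  oppositeSides : ∀ {t K RA RB R₀} → Sides t K RA RB R₀ → Sides (opposite t) K RB RA R₀
  oppositeSides {t} S = record
    { RA⊆R = λ w p → trans (R-swap t w) (RB⊆R w p) ; RB⊆R = λ w p → trans (R-swap t w) (RA⊆R w p)
    ; R₀⊆R = λ w p → trans (R-swap t w) (R₀⊆R w p)
    ; degA = degB ; degB = degA ; RA∌RB = λ w p q → RA∌RB w q p ; RA∌R₀ = RB∌R₀ ; RB∌R₀ = RA∌R₀
    ; cover = λ w p q r → cover w (trans (sym (R-swap t w)) p) r q }
    where open Sides S

  side : (Fin n → Bool) → (Fin n → Bool) → Fin n → Bool
  side Z R i = Z i ∨ R i

  R⇒¬ZA : ∀ t w → R t w ≡ true → ZA t w ≡ false
  R⇒¬ZA t w p = not-true (proj₁ (∧-true p))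

  exits : Tetrahedron G → Fin n → Fin n → ℕ
  exits t a b = # (λ b′ → (ZB t b′ ∧ adj b b′) ∧ not (adj a b′))

  -- Every b ∈ ZB ∩ N(a) has at least 6 + exits incidences in the link of a, whose average degree is below 6.
  exits-bound : ∀ t a → sumOn (λ b → ZB t b ∧ adj a b) (exits t a) ≤ 6 * # (λ u → adj a u ∧ not (ZB t u))
  exits-bound t a = +-cancelˡ-≤ (# T * 6) _ _ (begin
    # T * 6 + sumOn T (exits t a)                   ≡⟨ cong (_+ sumOn T (exits t a)) (sumOn-const T 6) ⟨
    sumOn T (λ _ → 6) + sumOn T (exits t a)         ≡⟨ sumOn-+ T (λ _ → 6) (exits t a) ⟨
    sumOn T (λ b → 6 + exits t a b)                 ≤⟨ sumOn-mono T (λ b p → incidences b p) ⟩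
    sumOn T (λ b → c a b + deg S b)                 ≡⟨ sumOn-+ T (c a) (deg S) ⟩
    sumOn T (c a) + e T S                           ≡⟨ cong (sumOn T (c a) +_) (e-sym T S) ⟩
    sumOn T (c a) + e S T                           ≤⟨ +-monoʳ-≤ (sumOn T (c a)) (sumOn-mono S λ u _ → #-mono λ y p →
                                                        proj₂ (∧-true {ZB t y} (proj₁ (∧-true {T y} p))) ∧ᵗ proj₂
                                                          (∧-true {T y} p)) ⟩
    sumOn T (c a) + sumOn S (c a)
      ≡⟨ cong (_+ sumOn S (c a)) (sumOn-≡ (λ b → ∧-comm (ZB t b) (adj a b)) (c a)) ⟩
    sumOn (λ b → adj a b ∧ ZB t b) (c a) + sumOn S (c a) ≡⟨ sumOn-split (adj a) (ZB t) (c a) ⟨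
    sumOn (adj a) (c a)                             ≤⟨ Σc≤6d a ⟩
    6 * d a                                         ≡⟨ cong (6 *_) (#-split (adj a) (ZB t)) ⟩
    6 * (# (λ b → adj a b ∧ ZB t b) + # S)
      ≡⟨ cong (λ k → 6 * (k + # S)) (#-cong λ b → ∧-comm (adj a b) (ZB t b)) ⟩
    6 * (# T + # S)                                 ≡⟨ lemma (# T) (# S) ⟩
    # T * 6 + 6 * # S                               ∎)
    where
    open ≤-Reasoning
    T S : Fin n → Bool
    T b = ZB t b ∧ adj a b
    S u = adj a u ∧ not (ZB t u)
    lemma : ∀ x y → 6 * (x + y) ≡ x * 6 + 6 * y
    lemma = solve-∀
    sumOn-≡ : {P Q : Fin n → Bool} → (∀ i → P i ≡ Q i) → (f : Fin n → ℕ) → sumOn P f ≡ sumOn Q f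
    sumOn-≡ {P} {Q} P≗Q f = trans (sumOn-sum P f)
      (trans (sum-cong λ i → cong (λ b → ⟦ b ⟧ * f i) (P≗Q i)) (sym (sumOn-sum Q f)))
    incidences : ∀ b → T b ≡ true → 6 + exits t a b ≤ c a b + deg S b
    incidences b p = by-slack (+-mono-≤ (+-mono-≤ (+-mono-≤ (4≤c ab) (4≤c ab)) c≤) (≤-reflexive degT))
      0 (identity (c a b) (deg T b) (deg S b) (exits t a b))
      where
      ab = proj₂ (∧-true {ZB t b} p)
      identity : ∀ c x s k → 6 + k + (c + c + (x + s) + 2) + 0 ≡ c + s + (4 + 4 + c + (x + k))
      identity = solve-∀
      rotate : ∀ u v w → (u ∧ v) ∧ w ≡ (u ∧ w) ∧ v
      rotate true  v w = ∧-comm v w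
      rotate false v w = refl
      degT : deg T b + exits t a b ≡ 2
      degT = trans (cong (_+ exits t a b) (#-cong λ y → rotate (ZB t y) (adj a y) (adj b y)))
        (trans (sym (#-split (λ y → ZB t y ∧ adj b y) (adj a))) (ZB-regular t (proj₁ (∧-true p))))
      c≤ : c a b ≤ deg T b + deg S b
      c≤ = ≤-trans (≤-reflexive (#-split (lk a b) (ZB t))) (+-mono-≤
        (#-mono λ y q → let r , s = ∧-true {lk a b y} q in (s ∧ᵗ proj₁ (∧-true r)) ∧ᵗ proj₂ (∧-true {adj a y} r))
        (#-mono λ y q → let r , s = ∧-true {lk a b y} q in (proj₁ (∧-true r) ∧ᵗ s) ∧ᵗ proj₂ (∧-true {adj a y} r)))

  module _ {t : Tetrahedron G} {K : ℕ} {RA RB : Fin n → Bool} (S : Sides t K RA RB (λ _ → false)) where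
    open Sides S

    private
      A : Fin n → Bool
      A = side (ZA t) RA
      r : ℕ
      r = # (R t)

      RA-or-RB : ∀ w → R t w ≡ true → RA w ≡ false → RB w ≡ true
      RA-or-RB w p q with RB w in eq
      ... | true  = refl
      ... | false = true≢false (cover w p q eq) refl

      covered : ∀ u → ZB t u ≡ false → RB u ≡ false → A u ≡ true
      covered u p q with ZA t u in a | RA u in s
      ... | true  | _     = refl
      ... | false | true  = refl
      ... | false | false = true≢false (RA-or-RB u (R-cover t u a p) s) q

    A⁺ : Fin n → Bool
    A⁺ a = A a ∧ (3 ≤ᵇ deg A a)

    -- Measures the obstacles at `b`: neighbours in `RB`, and exits of its neighbours with three or
    -- more neighbours in `A`. The restriction to `A⁺` keeps the total independent of n, since a
    -- vertex of ZA normally has only its two cycle neighbours in `A`.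
    exit-weight : Fin n → ℕ
    exit-weight b = deg RB b + sumOn (λ a → A⁺ a ∧ adj a b) (λ a → exits t a b)

    -- If a had at most two neighbours in A, then the link of ab would have at most three vertices.
    no-exit : ∀ {a b b′} → ZB t b ≡ true → exit-weight b ≡ 0 → A a ≡ true → adj a b ≡ true →
      ZB t b′ ≡ true → adj b b′ ≡ true → adj a b′ ≡ true
    no-exit {a} {b} {b′} b∈ w≡0 a∈ ab b′∈ bb′ with adj a b′ in ab′
    ... | true  = refl
    ... | false = ⊥-elim (<⇒≱ 1≤exits (small (3 ≤ᵇ deg A a) refl))
      where
      open ≤-Reasoning
      1≤exits : 0 < exits t a b
      1≤exits = ∃⇒#>0 (λ b′ → (ZB t b′ ∧ adj b b′) ∧ not (adj a b′)) ((b′∈ ∧ᵗ bb′) ∧ᵗ cong not ab′)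
      RB≡0 : deg RB b ≡ 0
      RB≡0 = m+n≡0⇒m≡0 (deg RB b) w≡0
      small : ∀ x → (3 ≤ᵇ deg A a) ≡ x → exits t a b ≤ 0
      small true  eq = ≤-trans (term≤sumOn (λ a → A⁺ a ∧ adj a b) (λ a → exits t a b) ((a∈ ∧ᵗ eq) ∧ᵗ ab))
        (≤-reflexive (m+n≡0⇒n≡0 (deg RB b) w≡0))
      small false eq = by-slack (+-mono-≤ (+-mono-≤ (+-mono-≤ (4≤c ab) degA≤2) c≤) (≤-reflexive cB+exits)) 0
        (identity (exits t a b) (c a b) (deg A a) cB)
        where
        cB : ℕ
        cB = # (λ y → (ZB t y ∧ adj b y) ∧ adj a y)
        identity : ∀ x c d b → x + (c + 2 + (d + b) + 2) + 0 ≡ 4 + d + c + (b + x)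
        identity = solve-∀
        degA≤2 : deg A a ≤ 2
        degA≤2 = ≤-pred (≤ᵇ-false⇒> {3} eq)
        cB+exits : cB + exits t a b ≡ 2
        cB+exits = trans (sym (#-split (λ y → ZB t y ∧ adj b y) (adj a))) (ZB-regular t b∈)
        c≤ : c a b ≤ deg A a + cB
        c≤ = ≤-trans (#-mono {Q = λ y → (A y ∧ adj a y) ∨ ((ZB t y ∧ adj b y) ∧ adj a y)} split) (#-∨≤ _ _)
          where
          split : ∀ y → lk a b y ≡ true → (A y ∧ adj a y) ∨ ((ZB t y ∧ adj b y) ∧ adj a y) ≡ true
          split y p with ∧-true {adj a y} p
          ... | ay , by with ZB t y in zb
          ... | true  = ∨-trueʳ (by ∧ᵗ ay)
          ... | false with RB y in rb
          ... | true  = ⊥-elim (<⇒≱ (∃⇒#>0 (λ y → RB y ∧ adj b y) (rb ∧ᵗ by)) (≤-reflexive RB≡0))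
          ... | false = ∨-trueˡ (covered y zb rb ∧ᵗ ay)

    private
      e-R≤ : ∀ P Z → (∀ w → P w ≡ true → R t w ≡ true) → (∀ w → P w ≡ true → deg Z w ≤ K) → e P Z ≤ r * K
      e-R≤ P Z P⊆R h = ≤-trans (sumOn-≤const P (deg Z) K h) (*-monoˡ-≤ K (#-mono P⊆R))

      -- A vertex of ZA with a third neighbour in `A` has a neighbour in `RA`, and `RA` sends at
      -- most rK edges to ZA.
      #A⁺≤ : # A⁺ ≤ r + r * K
      #A⁺≤ = begin
        # A⁺                                    ≡⟨ #-sum A⁺ ⟩
        sum (λ a → ⟦ A⁺ a ⟧)                    ≤⟨ sum-mono pointwise ⟩
        sum (λ a → ⟦ RA a ⟧ + ⟦ ZA t a ⟧ * deg RA a)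
          ≡⟨ trans (sum-+ _ _) (cong₂ _+_ (sym (#-sum RA)) (sym (sumOn-sum (ZA t) (deg RA)))) ⟩
        # RA + e (ZA t) RA                      ≡⟨ cong (# RA +_) (e-sym (ZA t) RA) ⟩
        # RA + e RA (ZA t)                      ≤⟨ +-mono-≤ (#-mono RA⊆R) (e-R≤ RA (ZA t) RA⊆R degA) ⟩
        r + r * K                               ∎
        where
        open ≤-Reasoning
        pointwise : ∀ a → ⟦ A⁺ a ⟧ ≤ ⟦ RA a ⟧ + ⟦ ZA t a ⟧ * deg RA a
        pointwise a with RA a in ra | ZA t a in za | 3 ≤ᵇ deg A a in ge
        ... | true  | true  | _     = ≤-trans (⟦⟧≤1 _) (m≤m+n 1 _)
        ... | true  | false | _     = ≤-trans (⟦⟧≤1 _) (m≤m+n 1 _)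
        ... | false | false | _     = z≤n
        ... | false | true  | false = z≤n
        ... | false | true  | true  = +-cancelˡ-≤ 2 _ _ (begin
          3                          ≤⟨ ≤ᵇ-true⇒≤ {3} ge ⟩
          deg A a                    ≤⟨ deg-∨ (ZA t) RA a ⟩
          deg (ZA t) a + deg RA a    ≡⟨ cong₂ _+_ (ZA-regular t za) (sym (+-identityʳ (deg RA a))) ⟩
          2 + (deg RA a + 0)         ∎)

      outside≤ : ∀ a → A⁺ a ≡ true → # (λ u → adj a u ∧ not (ZB t u)) ≤ K + 2 + r
      outside≤ a p = begin
        # (λ u → adj a u ∧ not (ZB t u))             ≤⟨ #-mono {Q = λ u → (ZA t u ∧ adj a u) ∨ R t u} split ⟩
        # (λ u → (ZA t u ∧ adj a u) ∨ R t u)         ≤⟨ #-∨≤ (λ u → ZA t u ∧ adj a u) (R t) ⟩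
        deg (ZA t) a + r                             ≤⟨ +-monoˡ-≤ r (∨-case {ZA t a} (proj₁ (∧-true p))
            (λ za → ≤-trans (≤-reflexive (ZA-regular t za)) (m≤n+m 2 K)) (λ ra → ≤-trans (degA a ra) (m≤m+n K 2))) ⟩
        K + 2 + r                                    ∎
        where
        open ≤-Reasoning
        split : ∀ u → adj a u ∧ not (ZB t u) ≡ true → (ZA t u ∧ adj a u) ∨ R t u ≡ true
        split u q with ZA t u
        ... | true  = ∨-trueˡ (proj₁ (∧-true {adj a u} q))
        ... | false = proj₂ (∧-true {adj a u} q)

    exit-weight-sum : sumOn (ZB t) exit-weight ≤ twin-constant r K
    exit-weight-sum = begin
      sumOn (ZB t) exit-weight
        ≡⟨ sumOn-+ (ZB t) (deg RB) _ ⟩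
      e (ZB t) RB + sumOn (ZB t) (λ b → sumOn (λ a → A⁺ a ∧ adj a b) (λ a → exits t a b))
        ≡⟨ cong₂ _+_ (e-sym (ZB t) RB) (trans (sumOn-cong (ZB t) λ b _ → sumOn-∧ A⁺ (λ a → adj a b) (λ a → exits t a b))
             (trans (sumOn-comm (ZB t) A⁺ _) (sumOn-cong A⁺ λ a _ → sym (sumOn-∧ (ZB t) (adj a) (exits t a))))) ⟩
      e RB (ZB t) + sumOn A⁺ (λ a → sumOn (λ b → ZB t b ∧ adj a b) (exits t a))
        ≤⟨ +-mono-≤ (e-R≤ RB (ZB t) RB⊆R degB) (sumOn-≤const A⁺ _ (6 * (K + 2 + r)) λ a p →
             ≤-trans (exits-bound t a) (*-monoʳ-≤ 6 (outside≤ a p))) ⟩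
      r * K + # A⁺ * (6 * (K + 2 + r))
        ≤⟨ +-monoʳ-≤ (r * K) (*-monoˡ-≤ (6 * (K + 2 + r)) #A⁺≤) ⟩
      r * K + (r + r * K) * (6 * (K + 2 + r))
        ≡⟨ twin-constant-≡ r K ⟩
      twin-constant r K ∎
      where open ≤-Reasoning

    -- Adjacency to `a` has to pass from `b` to `b′` and back, so the weights of the cycle
    -- neighbours have to vanish as well.
    nearby-weight : Fin n → ℕ
    nearby-weight b = exit-weight b + sumOn (λ b′ → ZB t b′ ∧ adj b b′) exit-weight

    good : Fin n → Bool
    good b = ZB t b ∧ (nearby-weight b ≡ᵇ 0)

    good⇒twins : ∀ {b b′} → good b ≡ true → ZB t b′ ≡ true → adj b b′ ≡ true →
      ∀ a → A a ≡ true → adj a b ≡ adj a b′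
    good⇒twins {b} {b′} g b′∈ bb′ a a∈ = iff (no-exit b∈ w≡0 a∈) (no-exit b′∈ w′≡0 a∈)
      where
      b∈ = proj₁ (∧-true {ZB t b} g)
      total≡0 : nearby-weight b ≡ 0
      total≡0 = ≡ᵇ-true⇒≡ (proj₂ (∧-true {ZB t b} g))
      w≡0 : exit-weight b ≡ 0
      w≡0 = m+n≡0⇒m≡0 (exit-weight b) total≡0
      w′≡0 : exit-weight b′ ≡ 0
      w′≡0 = n≤0⇒n≡0 (≤-trans (term≤sumOn (λ b′ → ZB t b′ ∧ adj b b′) exit-weight (b′∈ ∧ᵗ bb′))
        (≤-reflexive (m+n≡0⇒n≡0 (exit-weight b) total≡0)))
      iff : (adj a b ≡ true → ZB t b′ ≡ true → adj b b′ ≡ true → adj a b′ ≡ true) →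
            (adj a b′ ≡ true → ZB t b ≡ true → adj b′ b ≡ true → adj a b ≡ true) → adj a b ≡ adj a b′
      iff f g with adj a b in p | adj a b′ in q
      ... | true  | true  = refl
      ... | false | false = refl
      ... | true  | false = sym (f refl b′∈ bb′)
      ... | false | true  = g refl b∈ (flip bb′)

    -- Exit weight at one vertex spoils only this vertex and its two neighbours on the cycle.
    #bad≤ : # (λ b → ZB t b ∧ not (good b)) ≤ 3 * twin-constant r K
    #bad≤ = begin
      # (λ b → ZB t b ∧ not (good b))           ≡⟨ #-sum _ ⟩
      sum (λ b → ⟦ ZB t b ∧ not (good b) ⟧)     ≤⟨ sum-mono pointwise ⟩
      sum (λ b → ⟦ ZB t b ⟧ * nearby-weight b)  ≡⟨ sumOn-sum (ZB t) nearby-weight ⟨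
      sumOn (ZB t) nearby-weight                ≡⟨ sumOn-+ (ZB t) exit-weight _ ⟩
      Σw + sumOn (ZB t) (λ b → sumOn (λ b′ → ZB t b′ ∧ adj b b′) exit-weight)
        ≡⟨ cong (Σw +_) (trans (sumOn-cong (ZB t) λ b _ → sumOn-∧ (ZB t) (adj b) exit-weight)
          (sumOn-comm (ZB t) (ZB t) _)) ⟩
      Σw + sumOn (ZB t) (λ b′ → sumOn (ZB t) (λ b → ⟦ adj b b′ ⟧ * exit-weight b′))
        ≡⟨ cong (Σw +_) (sumOn-cong (ZB t) λ b′ p → trans (sym (sumOn-∧ (ZB t) (λ b → adj b b′) _))
          (trans (sumOn-const _ (exit-weight b′))
             (cong (_* exit-weight b′) (trans (#-cong λ b → cong (ZB t b ∧_) (adj-sym b b′)) (ZB-regular t p))))) ⟩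
      Σw + sumOn (ZB t) (λ b′ → 2 * exit-weight b′) ≡⟨ cong (Σw +_) (sumOn-* (ZB t) 2 exit-weight) ⟩
      Σw + 2 * Σw                               ≡⟨⟩
      3 * Σw                                    ≤⟨ *-monoʳ-≤ 3 exit-weight-sum ⟩
      3 * twin-constant r K                     ∎
      where
      open ≤-Reasoning
      Σw : ℕ
      Σw = sumOn (ZB t) exit-weight
      pointwise : ∀ b → ⟦ ZB t b ∧ not (good b) ⟧ ≤ ⟦ ZB t b ⟧ * nearby-weight b
      pointwise b with ZB t b | nearby-weight b
      ... | false | _     = z≤n
      ... | true  | zero  = z≤n
      ... | true  | suc k = s≤s z≤n

-- Edges and missing pairs between the two sides

opaque
  -- Degree sum inside the two sides beyond the cycle edges: for each side twice the at most rK
  -- edges between the cycle and its additional vertices, and r² among the latter.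
  edge-bound-constant : ℕ → ℕ → ℕ
  edge-bound-constant r K = 4 * (r * K) + 2 * (r * r)

  edge-bound-constant-≡ : ∀ r K → 4 * (r * K) + 2 * (r * r) ≡ edge-bound-constant r K
  edge-bound-constant-≡ r K = refl

#≡0⇒false : ∀ {n} (P : Fin n → Bool) → # P ≡ 0 → ∀ i → P i ≡ false
#≡0⇒false P #P≡0 i with P i in eq
... | false = refl
... | true  = ⊥-elim (<⇒≱ (∃⇒#>0 P eq) (≤-reflexive #P≡0))

module Counting {n : ℕ} (G : SphericalGraph n) where
  open Graph G
  open Cycles G
  open Twins G

  module _ {t : Tetrahedron G} {K : ℕ} {RA RB R₀ : Fin n → Bool} (S : Sides t K RA RB R₀) where
    open Sides S

    private
      A B : Fin n → Bool
      A = side (ZA t) RA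
      B = side (ZB t) RB
      r α β : ℕ
      r = # (R t)
      α = # (ZA t)
      β = # (ZB t)

    #RA+#RB+#R₀≤r : # RA + (# RB + # R₀) ≤ r
    #RA+#RB+#R₀≤r = begin
      # RA + (# RB + # R₀) ≡⟨ cong₂ _+_ (#-sum RA) (cong₂ _+_ (#-sum RB) (#-sum R₀)) ⟩
      sum (λ w → ⟦ RA w ⟧) + (sum (λ w → ⟦ RB w ⟧) + sum (λ w → ⟦ R₀ w ⟧))
        ≡⟨ cong (sum (λ w → ⟦ RA w ⟧) +_) (sum-+ _ _) ⟨
      sum (λ w → ⟦ RA w ⟧) + sum (λ w → ⟦ RB w ⟧ + ⟦ R₀ w ⟧)
        ≡⟨ sum-+ _ _ ⟨
      sum (λ w → ⟦ RA w ⟧ + (⟦ RB w ⟧ + ⟦ R₀ w ⟧)) ≤⟨ sum-mono pointwise ⟩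
      sum (λ w → ⟦ R t w ⟧) ≡⟨ #-sum (R t) ⟨
      r ∎
      where
      open ≤-Reasoning
      pointwise : ∀ w → ⟦ RA w ⟧ + (⟦ RB w ⟧ + ⟦ R₀ w ⟧) ≤ ⟦ R t w ⟧
      pointwise w with RA w in p | RB w in q | R₀ w in s
      ... | true  | true  | _     = ⊥-elim (RA∌RB w p q)
      ... | true  | false | true  = ⊥-elim (RA∌R₀ w p s)
      ... | true  | false | false = ≤-reflexive (sym (cong ⟦_⟧ (RA⊆R w p)))
      ... | false | true  | true  = ⊥-elim (RB∌R₀ w q s)
      ... | false | true  | false = ≤-reflexive (sym (cong ⟦_⟧ (RB⊆R w q)))
      ... | false | false | true  = ≤-reflexive (sym (cong ⟦_⟧ (R₀⊆R w s)))
      ... | false | false | false = z≤n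

    #A≤ : # A ≤ α + # RA
    #A≤ = #-∨≤ (ZA t) RA

    #B≤ : # B ≤ β + # RB
    #B≤ = #-∨≤ (ZB t) RB

    #A+#B+#R₀≤n : # A + # B + # R₀ ≤ n
    #A+#B+#R₀≤n = by-slack (+-mono-≤ (+-mono-≤ (+-mono-≤ #A≤ #B≤) #RA+#RB+#R₀≤r) (≤-reflexive (#R+#Z≡n t)))
      0 (identity (# A) (# B) (# RA) (# RB) (# R₀) r α β n)
      where
      identity : ∀ a b x y z r p q n → a + b + z + ((p + x) + (q + y) + r + n) + 0 ≡ n +
        (a + b + (x + (y + z)) + (r + (p + q)))
      identity = solve-∀

    sides-cover : ∀ i → A i ≡ false → B i ≡ false → R₀ i ≡ true
    sides-cover i p q with ZA t i in za | RA i in ra | ZB t i in zb | RB i in rb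
    ... | false | false | false | false = cover i (R-cover t i za zb) ra rb

    private
      inside : ∀ Z P → (∀ z → Z z ≡ true → deg Z z ≡ 2) → (∀ w → P w ≡ true → R t w ≡ true) →
        (∀ w → P w ≡ true → deg Z w ≤ K) →
        sumOn (side Z P) (deg (side Z P)) ≤ # Z * 2 + 2 * (r * K) + r * r
      inside Z P reg P⊆R h = begin
        sumOn (side Z P) (deg (side Z P))          ≤⟨ sumOn-mono (side Z P) (λ x _ → deg-∨ Z P x) ⟩
        sumOn (side Z P) (λ x → deg Z x + deg P x) ≤⟨ sumOn-∨≤ Z P _ ⟩
        sumOn Z (λ x → deg Z x + deg P x) + sumOn P (λ x → deg Z x + deg P x)
          ≡⟨ cong₂ _+_ (sumOn-+ Z _ _) (sumOn-+ P _ _) ⟩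
        e Z Z + e Z P + (e P Z + e P P)
          ≡⟨ cong₂ (λ k l → k + l + (e P Z + e P P)) (trans (sumOn-cong Z reg) (sumOn-const Z 2)) (e-sym Z P) ⟩
        # Z * 2 + e P Z + (e P Z + e P P)          ≡⟨ lemma (# Z * 2) (e P Z) (e P P) ⟩
        # Z * 2 + 2 * e P Z + e P P                ≤⟨ +-mono-≤ (+-monoʳ-≤ (# Z * 2) (*-monoʳ-≤ 2 eP)) ePP ⟩
        # Z * 2 + 2 * (r * K) + r * r              ∎
        where
        open ≤-Reasoning
        lemma : ∀ z x y → z + x + (x + y) ≡ z + 2 * x + y
        lemma = solve-∀
        eP : e P Z ≤ r * K
        eP = ≤-trans (sumOn-≤const P (deg Z) K h) (*-monoˡ-≤ K (#-mono P⊆R))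
        ePP : e P P ≤ r * r
        ePP = ≤-trans (sumOn-≤const P (deg P) r λ w _ → ≤-trans (deg≤# P w) (#-mono P⊆R)) (*-monoˡ-≤ r (#-mono P⊆R))

    edges≤ : D ≤ 2 * e A B + 2 * (α + β) + edge-bound-constant r K + 3 * sumOn R₀ d
    edges≤ = begin
      D ≤⟨ sum≤cover A B R₀ d sides-cover ⟩
      sumOn A d + (sumOn B d + sumOn R₀ d)
        ≤⟨ +-mono-≤ (half A B sides-cover) (+-monoˡ-≤ (sumOn R₀ d) (half B A λ i p q → sides-cover i q p)) ⟩
      (sumOn A (deg A) + (e A B + s)) + ((sumOn B (deg B) + (e B A + s)) + s)
        ≤⟨ +-mono-≤ (+-monoˡ-≤ (e A B + s) (inside (ZA t) RA (λ z → ZA-regular t) RA⊆R degA))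
                    (+-monoˡ-≤ s (+-mono-≤ (inside (ZB t) RB (λ z → ZB-regular t) RB⊆R degB)
                      (+-monoˡ-≤ s (≤-reflexive (e-sym B A))))) ⟩
      (α * 2 + 2 * (r * K) + r * r + (e A B + s)) + ((β * 2 + 2 * (r * K) + r * r + (e A B + s)) + s)
        ≡⟨ lemma α β (r * K) (r * r) (e A B) s ⟩
      2 * e A B + 2 * (α + β) + (4 * (r * K) + 2 * (r * r)) + 3 * s
        ≡⟨ cong (λ k → 2 * e A B + 2 * (α + β) + k + 3 * s) (edge-bound-constant-≡ r K) ⟩
      2 * e A B + 2 * (α + β) + edge-bound-constant r K + 3 * sumOn R₀ d ∎
      where
      open ≤-Reasoning
      s : ℕ
      s = sumOn R₀ d
      lemma : ∀ a b k q x s → (a * 2 + 2 * k + q + (x + s)) + ((b * 2 + 2 * k + q + (x + s)) + s) ≡ 2 * x + 2 *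
        (a + b) + (4 * k + 2 * q) + 3 * s
      lemma = solve-∀
      half : ∀ P Q → (∀ i → P i ≡ false → Q i ≡ false → R₀ i ≡ true) → sumOn P d ≤ sumOn P (deg P) + (e P Q + s)
      half P Q cov = begin
        sumOn P d                                          ≤⟨ sumOn-mono P (λ x _ → d≤cover P Q R₀ cov x) ⟩
        sumOn P (λ x → deg P x + (deg Q x + deg R₀ x))
          ≡⟨ trans (sumOn-+ P _ _) (cong (sumOn P (deg P) +_) (sumOn-+ P _ _)) ⟩
        sumOn P (deg P) + (e P Q + e P R₀)                 ≡⟨ cong (λ k → sumOn P (deg P) + (e P Q + k)) (e-sym P R₀) ⟩
        sumOn P (deg P) + (e P Q + e R₀ P)
          ≤⟨ +-monoʳ-≤ (sumOn P (deg P)) (+-monoʳ-≤ (e P Q) (sumOn-mono R₀ λ x _ → deg≤d P x)) ⟩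
        sumOn P (deg P) + (e P Q + s)                      ∎

    -- The link of an edge of ZB containing A would properly contain the cycle ZA.
    complete-edge : ∀ {w b b′} → RA w ≡ true → adj b b′ ≡ true → (∀ a → A a ≡ true → lk b b′ a ≡ true) → ⊥
    complete-edge {w} ra bb′ A⊆lk = true≢false
      (ZA-minimal t bb′ (λ z p → A⊆lk z (∨-trueˡ p)) w (A⊆lk w (∨-trueʳ ra)))
      (R⇒¬ZA t w (RA⊆R w ra))

    codeg≡0⇒adj : ∀ P b → codeg P b ≡ 0 → ∀ a → P a ≡ true → adj b a ≡ true
    codeg≡0⇒adj P b h a p with adj b a in eq
    ... | true  = refl
    ... | false = ⊥-elim (<⇒≱ (∃⇒#>0 (λ y → P y ∧ not (adj b y)) (p ∧ᵗ cong not eq)) (≤-reflexive h))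

    -- By `complete-edge` two neighbours on ZB cannot both see all of `A`. So at most half of ZB
    -- does, and every other vertex of ZB accounts for a missing pair.
    half-incomplete : ∀ {w} → RA w ≡ true → β ≤ 2 * sumOn B (codeg A)
    half-incomplete ra = begin
      β                          ≡⟨ #-split (ZB t) full ⟩
      # F + # I                  ≤⟨ +-monoˡ-≤ (# I) (*-cancelʳ-≤ (# F) (# I) 2 twice) ⟩
      # I + # I                  ≡⟨ cong (# I +_) (sym (+-identityʳ (# I))) ⟩
      2 * # I
        ≤⟨ *-monoʳ-≤ 2 (≤-trans (≤-reflexive (sym (*-identityʳ (# I)))) (≤-trans (sumOn-≥const I (codeg A) 1 positive)
                                      (sumOn-⊆ I B (codeg A) λ b p → ∨-trueˡ (proj₁ (∧-true {ZB t b} p))))) ⟩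
      2 * sumOn B (codeg A)      ∎
      where
      open ≤-Reasoning
      full F I : Fin n → Bool
      full b = codeg A b ≡ᵇ 0
      F b = ZB t b ∧ full b
      I b = ZB t b ∧ not (full b)
      positive : ∀ b → I b ≡ true → 1 ≤ codeg A b
      positive b p with codeg A b | proj₂ (∧-true {ZB t b} p)
      ... | suc k | _ = s≤s z≤n
      F⇒ : ∀ b → F b ≡ true → codeg A b ≡ 0
      F⇒ b p = ≡ᵇ-true⇒≡ (proj₂ (∧-true {ZB t b} p))
      F-nbr : ∀ b → F b ≡ true → ∀ b′ → ZB t b′ ∧ adj b b′ ≡ true → I b′ ∧ adj b b′ ≡ true
      F-nbr b p b′ q with full b′ in eq
      ... | false = (proj₁ (∧-true q) ∧ᵗ refl) ∧ᵗ proj₂ (∧-true {ZB t b′} q)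
      ... | true  = ⊥-elim (complete-edge ra (proj₂ (∧-true {ZB t b′} q)) λ a a∈ →
                      codeg≡0⇒adj A b (F⇒ b p) a a∈ ∧ᵗ codeg≡0⇒adj A b′ (≡ᵇ-true⇒≡ eq) a a∈)
      twice : # F * 2 ≤ # I * 2
      twice = begin
        # F * 2    ≤⟨ sumOn-≥const F (deg I) 2
          (λ b p → ≤-trans (≤-reflexive (sym (ZB-regular t (proj₁ (∧-true p))))) (#-mono (F-nbr b p))) ⟩
        e F I      ≡⟨ e-sym F I ⟩
        e I F      ≤⟨ sumOn-≤const I (deg F) 2
          (λ b p → ≤-trans (deg-mono F (ZB t) b λ y q → proj₁ (∧-true q))
          (≤-reflexive (ZB-regular t (proj₁ (∧-true p))))) ⟩
        # I * 2    ∎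

  module _ {t : Tetrahedron G} {K : ℕ} {RA RB : Fin n → Bool} (S : Sides t K RA RB (λ _ → false)) where
    open Sides S

    private
      A B : Fin n → Bool
      A = side (ZA t) RA
      B = side (ZB t) RB

    -- If `b` saw all of `A`, so would its twin, against `complete-edge`.
    good⇒incomplete : ∀ {w b} → RA w ≡ true → good S b ≡ true → 0 < codeg A b
    good⇒incomplete {w} {b} ra g with codeg A b in eq
    ... | suc k = s≤s z≤n
    ... | zero  = ⊥-elim (contra
      (#>0⇒∃ (λ y → ZB t y ∧ adj b y) (subst (0 <_) (sym (ZB-regular t (proj₁ (∧-true g)))) (s≤s z≤n))))
      where
      contra : (∃ λ b′ → ZB t b′ ∧ adj b b′ ≡ true) → ⊥
      contra (b′ , p) = complete-edge S ra bb′ λ a a∈ → let ba = codeg≡0⇒adj S A b eq a a∈ in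
        ba ∧ᵗ flip (trans (sym (good⇒twins S g (proj₁ (∧-true p)) bb′ a a∈)) (flip ba))
        where bb′ = proj₂ (∧-true {ZB t b′} p)

    good-charge : ∀ {w b} → RA w ≡ true → good S b ≡ true →
      2 ≤ sumOn (λ a → A a ∧ not (adj b a)) (λ a → 1 + ⟦ not (good (oppositeSides S) a) ⟧)
    good-charge {w} {b} ra g = charge (#>0⇒∃ (λ a → A a ∧ not (adj b a)) (good⇒incomplete ra g))
      where
      P : Fin n → Bool
      P a = A a ∧ not (adj b a)
      f : Fin n → ℕ
      f a = 1 + ⟦ not (good (oppositeSides S) a) ⟧
      charge : (∃ λ a → P a ≡ true) → 2 ≤ sumOn P f
      charge (a , p) with good (oppositeSides S) a in ga
      ... | false = ≤-trans (≤-reflexive (sym (cong (λ x → 1 + ⟦ not x ⟧) ga))) (term≤sumOn P f p)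
      ... | true  = twin (#>0⇒∃ (λ y → ZA t y ∧ adj a y)
        (subst (0 <_) (sym (ZA-regular t (proj₁ (∧-true ga)))) (s≤s z≤n)))
        where
        twin : (∃ λ a′ → ZA t a′ ∧ adj a a′ ≡ true) → 2 ≤ sumOn P f
        twin (a′ , q) = ≤-trans (+-mono-≤ (s≤s z≤n) (s≤s z≤n)) (two-terms≤sumOn P f (adj⇒≢ aa′) p
          (∨-trueˡ a′∈ ∧ᵗ trans
            (cong not (sym (good⇒twins (oppositeSides S) ga a′∈ aa′ b (∨-trueˡ (proj₁ (∧-true {ZB t b} g))))))
            (proj₂ (∧-true {A a} p))))
          where
          a′∈ = proj₁ (∧-true q)
          aa′ = proj₂ (∧-true {ZA t a′} q)

    charges : ∀ {w} → RA w ≡ true → 2 * # (good S) ≤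
      sumOn B (λ b → sumOn A (λ a → ⟦ not (adj b a) ⟧ * (⟦ good S b ⟧ * (1 + ⟦ not (good (oppositeSides S) a) ⟧))))
    charges ra = begin
      2 * # (good S)     ≡⟨ *-comm 2 (# (good S)) ⟩
      # (good S) * 2     ≤⟨ sumOn-≥const (good S) inner 2 (λ b g → good-charge ra g) ⟩
      sumOn (good S) inner
        ≤⟨ sumOn-⊆ (good S) (λ b → B b ∧ good S b) inner (λ b g → ∨-trueˡ (proj₁ (∧-true {ZB t b} g)) ∧ᵗ g) ⟩
      sumOn (λ b → B b ∧ good S b) inner  ≡⟨ sumOn-∧ B (good S) inner ⟩
      sumOn B (λ b → ⟦ good S b ⟧ * inner b)
        ≡⟨ sumOn-cong B (λ b _ → trans (cong (⟦ good S b ⟧ *_) (sumOn-∧ A (λ a → not (adj b a)) _))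
             (trans (sym (sumOn-* A ⟦ good S b ⟧ _)) (sumOn-cong A λ a _ → lemma ⟦ good S b ⟧ ⟦ not (adj b a) ⟧ _))) ⟩
      sumOn B (λ b → sumOn A (λ a → ⟦ not (adj b a) ⟧ * (⟦ good S b ⟧ * (1 + ⟦ not (good (oppositeSides S) a) ⟧)))) ∎
      where
      open ≤-Reasoning
      inner : Fin n → ℕ
      inner b = sumOn (λ a → A a ∧ not (adj b a)) (λ a → 1 + ⟦ not (good (oppositeSides S) a) ⟧)
      lemma : ∀ x y z → x * (y * z) ≡ y * (x * z)
      lemma = solve-∀

-- Arithmetic for the cases of remaining vertices

count-arithmetic : ∀ n D a b eab m s E Σd → n * n + 2 * n + 18 ≤ 2 * D → D ≤ 2 * eab + 2 * s + E + 3 * Σd →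
  eab + m ≡ a * b →
  n * n + 2 * n + 18 + 4 * m ≤ (a + b) * (a + b) + 4 * s + 2 * E + 6 * Σd
count-arithmetic n D a b eab m s E Σd h₁ h₂ h₃ =
  by-slack (+-mono-≤ (+-mono-≤ (+-mono-≤ h₁ (*-monoʳ-≤ 2 h₂)) (*-monoʳ-≤ 4 (≤-reflexive h₃))) (4xy≤[x+y]² a b))
  0 (identity n D a b eab m s E Σd)
  where
  identity : ∀ n D a b x m s E t → n * n + 2 * n + 18 + 4 * m +
    (2 * D + 2 * (2 * x + 2 * s + E + 3 * t) + 4 * (a * b) + (a + b) * (a + b)) + 0
    ≡ (a + b) * (a + b) + 4 * s + 2 * E + 6 * t + (n * n + 2 * n + 18 + 2 * D + 4 * (x + m) + 4 * (a * b))
  identity = solve-∀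

-- There are at least α + β - 6T missing pairs. So 4m cancels 4(α + β) up to a bounded error, and 2n
-- on the left has no counterpart.
both-arithmetic : ∀ n a b m E α β gA gB T Ω → n * n + 2 * n + 18 + 4 * m ≤ (a + b) * (a + b) + 4 * (α + β) + 2 * E + 6 *
  0 →
  a + b ≤ n → gB + gA ≤ m → β ≤ gB + 3 * T → α ≤ gA + 3 * T → E ≤ Ω → T ≤ Ω → 400 * Ω ≤ n → ⊥
both-arithmetic n a b m E α β gA gB T Ω h₁ h₂ h₄ h₅ h₆ h₈ h₉ h₁₀ = absurd-slack
  (+-mono-≤ (+-mono-≤ (+-mono-≤
  (+-mono-≤ (+-mono-≤ (+-mono-≤ (+-mono-≤ h₁ (*-mono-≤ h₂ h₂)) (*-monoʳ-≤ 4 h₄)) (*-monoʳ-≤ 4 h₅))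
    (*-monoʳ-≤ 4 h₆)) (*-monoʳ-≤ 2 h₈)) (*-monoʳ-≤ 24 h₉)) h₁₀)
  (17 + 374 * Ω + n) (identity n a b m E α β gA gB T Ω)
  where
  identity : ∀ n a b m E α β gA gB T Ω →
    suc (((a + b) * (a + b) + 4 * (α + β) + 2 * E + 6 * 0) + n * n + 4 * m + 4 * (gB + 3 * T) + 4 * (gA + 3 * T) + 2 * Ω
    + 24 * Ω + n + (17 + 374 * Ω + n))
    ≡ (n * n + 2 * n + 18 + 4 * m) + (a + b) * (a + b) + 4 * (gB + gA) + 4 * β + 4 * α + 2 * E + 24 * T + 400 * Ω
  identity = solve-∀

-- One vertex of `R₀` lowers the square by 2n, which just balances the linear terms. The missing
-- pairs decide: 4m ≥ 2n/5 stands against 6n/32 and bounded errors.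
one-arithmetic : ∀ n N a b m s E Σd r β Ω → n ≡ suc N →
  n * n + 2 * n + 18 + 4 * m ≤ (a + b) * (a + b) + 4 * s + 2 * E + 6 * Σd →
  a + b ≤ N → s ≤ n → n ≤ 5 * β → β ≤ 2 * m → 32 * Σd ≤ n + 32 * r → E ≤ Ω → r ≤ Ω → 400 * Ω ≤ n → ⊥
one-arithmetic .(suc N) N a b m s E Σd r β Ω refl h₁ h₂ h₃ h₄ h₅ h₆ h₇ h₈ h₉ = absurd-slack
  (+-mono-≤ (+-mono-≤ (+-mono-≤
  (+-mono-≤ (+-mono-≤ (+-mono-≤ (+-mono-≤ (+-mono-≤ (*-monoʳ-≤ 16 h₁) (*-monoʳ-≤ 16 (*-mono-≤ h₂ h₂)))
    (*-monoʳ-≤ 64 h₃)) (*-monoʳ-≤ 6 h₄)) (*-monoʳ-≤ 30 h₅)) (*-monoʳ-≤ 3 h₆)) (*-monoʳ-≤ 32 h₇)) (*-monoʳ-≤ 96 h₈)) h₉)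
  (4 * m + 2 * N + 273 + 272 * Ω) (identity N a b m s E Σd r β Ω)
  where
  identity : ∀ N a b m s E t r β Ω →
    suc (16 * ((a + b) * (a + b) + 4 * s + 2 * E + 6 * t) + 16 * (N * N) + 64 * suc N + 6 * (5 * β) + 30 * (2 * m) + 3 *
    (suc N + 32 * r) + 32 * Ω + 96 * Ω + suc N + (4 * m + 2 * N + 273 + 272 * Ω))
    ≡ 16 * (suc N * suc N + 2 * suc N + 18 + 4 * m) + 16 * ((a + b) * (a + b)) + 64 * s + 6 * suc N + 30 * β + 3 *
      (32 * t) + 32 * E + 96 * r + 400 * Ω
  identity = solve-∀

-- Each vertex of `R₀` costs about 2n in the square and returns only about 6n/32. From two vertices
-- on the loss exceeds the surplus 4s - 2n ≤ 2n of the linear terms.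
many-arithmetic : ∀ n N k a b m s E Σd r Ω → n ≡ N + (2 + k) →
  n * n + 2 * n + 18 + 4 * m ≤ (a + b) * (a + b) + 4 * s + 2 * E + 6 * Σd →
  a + b ≤ N → s ≤ n → 32 * Σd ≤ (2 + k) * (n + 32 * r) → E ≤ Ω → (2 + k) * r ≤ Ω → 400 * Ω ≤ n → ⊥
many-arithmetic .(N + (2 + k)) N k a b m s E Σd r Ω refl h₁ h₂ h₃ h₆ h₇ h₈ h₉ = absurd-slack
  (+-mono-≤ (+-mono-≤ (+-mono-≤ (+-mono-≤ (+-mono-≤ (+-mono-≤ (*-monoʳ-≤ 16 h₁) (*-monoʳ-≤ 16 (*-mono-≤ h₂ h₂)))
    (*-monoʳ-≤ 64 h₃)) (*-monoʳ-≤ 3 h₆)) (*-monoʳ-≤ 32 h₇)) (*-monoʳ-≤ 96 h₈)) h₉)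
  (273 + 19 * k + 13 * k * k + 25 * N + 29 * k * N + 64 * m + 272 * Ω) (identity N k a b m s E Σd r Ω)
  where
  identity : ∀ N k a b m s E t r Ω →
    suc (16 * ((a + b) * (a + b) + 4 * s + 2 * E + 6 * t) + 16 * (N * N) + 64 * (N + (2 + k)) + 3 *
    ((2 + k) * ((N + (2 + k)) + 32 * r)) + 32 * Ω + 96 * Ω + (N + (2 + k))
      + (273 + 19 * k + 13 * k * k + 25 * N + 29 * k * N + 64 * m + 272 * Ω))
    ≡ 16 * ((N + (2 + k)) * (N + (2 + k)) + 2 * (N + (2 + k)) + 18 + 4 * m) + 16 * ((a + b) * (a + b)) + 64 * s + 3 *
      (32 * t) + 32 * E + 96 * ((2 + k) * r) + 400 * Ω
  identity = solve-∀

-- The additional vertices raise `eab` above αβ only by a constant, but they count in `n`: the left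
-- side is at least s² + 6s, the right side s² + 4s up to a constant. One additional vertex would
-- give s² + 4s on both sides, hence its separate treatment.
one-side-arithmetic : ∀ n α β k D eab E T Ω → let s = α + β in n ≡ s + (2 + k) →
  n * n + 2 * n + 18 ≤ 2 * D → D ≤ 2 * eab + 2 * s + E + 3 * 0 → eab ≤ α * β + 3 * T → T ≤ Ω → E ≤ Ω → 400 * Ω ≤ n → ⊥
one-side-arithmetic .(α + β + (2 + k)) α β k D eab E T Ω refl h₁ h₂ h₃ h₄ h₅ h₆ = absurd-slack
  (+-mono-≤ (+-mono-≤ (+-mono-≤ (+-mono-≤ (+-mono-≤ (+-mono-≤ h₁ (*-monoʳ-≤ 2 h₂)) (*-monoʳ-≤ 4 h₃)) (4xy≤[x+y]² α β))
    (*-monoʳ-≤ 12 h₄)) (*-monoʳ-≤ 2 h₅)) h₆)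
  (s + 2 * k * s + 23 + 5 * k + k * k + 386 * Ω) (identity (α + β) (α * β) k D eab E T Ω)
  where
  s = α + β
  identity : ∀ s p k D x E T Ω →
    suc (2 * D + 2 * (2 * x + 2 * s + E + 3 * 0) + 4 * (p + 3 * T) + s * s + 12 * Ω + 2 * Ω + (s + (2 + k)) +
    (s + 2 * k * s + 23 + 5 * k + k * k + 386 * Ω))
    ≡ (s + (2 + k)) * (s + (2 + k)) + 2 * (s + (2 + k)) + 18 + 2 * D + 4 * x + 4 * p + 12 * T + 2 * E + 400 * Ω
  identity = solve-∀

opaque
  -- The degrees of an outer vertex into the two cycles have product at most (4 + r)n, so if one
  -- exceeds this threshold, the other is at most n/64. Hence a vertex of `R₀` has degree at most
  -- n/32 + r, small enough for the arithmetic above.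
  rest-threshold : ℕ → ℕ
  rest-threshold r = 64 * (4 + r)

  rest-threshold-≡ : ∀ r → rest-threshold r ≡ 64 * (4 + r)
  rest-threshold-≡ r = refl

  -- The sum of all error terms of the case distinction, so that the single condition
  -- `400 * rest-constant r ≤ n` makes each of them negligible.
  rest-constant : ℕ → ℕ
  rest-constant r = let K = rest-threshold r in
    1 + r + r * r + edge-bound-constant r K + twin-constant r K + twin-constant r K * r

-- Assigning the remaining vertices and improving the tetrahedron

module Reduction {n : ℕ} (G : SphericalGraph n) where
  open Graph G
  open Cycles G
  open Twins G
  open Counting G
  open Tetrahedron

  -- A vertex outside the cycles with few neighbours on ZA counts as a further vertex of the side of ZA.
  -- By deg-product a vertex of R₀ has at most n / 64 neighbours on each of the two cycles.
  RAof RBof R₀of : Tetrahedron G → ℕ → Fin n → Bool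
  RAof t K w = R t w ∧ (deg (ZA t) w ≤ᵇ K)
  RBof t K w = (R t w ∧ not (deg (ZA t) w ≤ᵇ K)) ∧ (deg (ZB t) w ≤ᵇ K)
  R₀of t K w = (R t w ∧ not (deg (ZA t) w ≤ᵇ K)) ∧ not (deg (ZB t) w ≤ᵇ K)

  private
    x∧¬x : ∀ {a} {A : Set} → a ≡ true → not a ≡ true → A
    x∧¬x p q = true≢false p (not-true q)

  sidesOf : ∀ t K → Sides t K (RAof t K) (RBof t K) (R₀of t K)
  sidesOf t K = record
    { RA⊆R  = λ w p → proj₁ (∧-true p)
    ; RB⊆R  = λ w p → proj₁ (∧-true (proj₁ (∧-true p)))
    ; R₀⊆R  = λ w p → proj₁ (∧-true (proj₁ (∧-true p)))
    ; degA  = λ w p → ≤ᵇ-true⇒≤ (proj₂ (∧-true {R t w} p))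
    ; degB  = λ w p → ≤ᵇ-true⇒≤ (proj₂ (∧-true {R t w ∧ not (deg (ZA t) w ≤ᵇ K)} p))
    ; RA∌RB = λ w p q → x∧¬x (proj₂ (∧-true {R t w} p)) (proj₂ (∧-true {R t w} (proj₁ (∧-true q))))
    ; RA∌R₀ = λ w p q → x∧¬x (proj₂ (∧-true {R t w} p)) (proj₂ (∧-true {R t w} (proj₁ (∧-true q))))
    ; RB∌R₀ = λ w p q → x∧¬x (proj₂ (∧-true {R t w ∧ not (deg (ZA t) w ≤ᵇ K)} p))
      (proj₂ (∧-true {R t w ∧ not (deg (ZA t) w ≤ᵇ K)} q))
    ; cover = λ w → covers (R t w) (deg (ZA t) w ≤ᵇ K) (deg (ZB t) w ≤ᵇ K)
    }
    where
    covers : ∀ a b c → a ≡ true → a ∧ b ≡ false → (a ∧ not b) ∧ c ≡ false → (a ∧ not b) ∧ not c ≡ true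
    covers true false false _ _ _ = refl

  without-R₀ : ∀ {t K RA RB R₀} → Sides t K RA RB R₀ → (∀ w → R₀ w ≡ false) → Sides t K RA RB (λ _ → false)
  without-R₀ S none = record
    { RA⊆R = RA⊆R ; RB⊆R = RB⊆R ; R₀⊆R = λ _ () ; degA = degA ; degB = degB ; RA∌RB = RA∌RB
    ; RA∌R₀ = λ _ _ () ; RB∌R₀ = λ _ _ () ; cover = λ w p q s → true≢false (cover w p q s) (none w) }
    where open Sides S

  Better : Tetrahedron G → Set
  Better t = Σ (Tetrahedron G) λ t′ → weight t < weight t′

  tetrahedron : ∀ {x x′ y y′} → adj x x′ ≡ true → adj y y′ ≡ true → lk x x′ y ≡ true → lk x x′ y′ ≡ true → Tetrahedron G
  tetrahedron p q r s = record { xx′ = p ; yy′ = q ; y∈ = r ; y′∈ = s }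

  -- A bad vertex of ZB has at most α + r neighbours in `A`, so the surplus yields a good `b` with
  -- more than α. Its twin `b′` has the same neighbours in `A`; hence the link of `bb′` is longer
  -- than ZA, and `bb′` replaces `yy′`.
  improve : ∀ {t K RA RB} (S : Sides t K RA RB (λ _ → false)) →
    # (ZA t) * # (ZB t) + 3 * twin-constant (# (R t)) K * # (R t) < e (side (ZA t) RA) (ZB t) → Better t
  improve {t} {K} {RA} {RB} S lt = choose (sumOn-<⇒∃ (ZB t) (λ b → α + ⟦ not (good S b) ⟧ * r) (deg A) (begin-strict
    sumOn (ZB t) (λ b → α + ⟦ not (good S b) ⟧ * r) ≡⟨ sumOn-+ (ZB t) _ _ ⟩
    sumOn (ZB t) (λ _ → α) + sumOn (ZB t) (λ b → ⟦ not (good S b) ⟧ * r)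
      ≡⟨ cong₂ _+_ (trans (sumOn-const (ZB t) α) (*-comm β α))
        (trans (sym (sumOn-∧ (ZB t) (λ b → not (good S b)) (λ _ → r))) (sumOn-const _ r)) ⟩
    α * β + # (λ b → ZB t b ∧ not (good S b)) * r   ≤⟨ +-monoʳ-≤ (α * β) (*-monoˡ-≤ r (#bad≤ S)) ⟩
    α * β + 3 * twin-constant r K * r               <⟨ lt ⟩
    e A (ZB t)                                      ≡⟨ e-sym A (ZB t) ⟩
    sumOn (ZB t) (deg A)                            ∎))
    where
    open ≤-Reasoning
    α β r : ℕ
    α = # (ZA t)
    β = # (ZB t)
    r = # (R t)
    A : Fin n → Bool
    A = side (ZA t) RA
    #A≤α+r : # A ≤ α + r
    #A≤α+r = ≤-trans (#-∨≤ (ZA t) RA) (+-monoʳ-≤ α (#-mono (Sides.RA⊆R S)))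
    extend : ∀ {b} → ZB t b ≡ true → good S b ≡ true → α < deg A b → (∃ λ b′ → ZB t b′ ∧ adj b b′ ≡ true) → Better t
    extend {b} b∈ g α< (b′ , p) = tetrahedron (xx′ t) bb′ b∈ b′∈ ,
      +-monoʳ-< (c (x t) (x′ t)) (<-≤-trans α< (#-mono λ a q → let a∈ , ba = ∧-true {A a} q in
        ba ∧ᵗ flip (trans (sym (good⇒twins S g b′∈ bb′ a a∈)) (flip ba))))
      where
      b′∈ = proj₁ (∧-true {ZB t b′} p)
      bb′ = proj₂ (∧-true {ZB t b′} p)
    choose : (∃ λ b → ZB t b ≡ true × α + ⟦ not (good S b) ⟧ * r < deg A b) → Better t
    choose (b , b∈ , lt′) with good S b in g
    ... | false = ⊥-elim (<⇒≱ lt′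
      (≤-trans (deg≤# A b) (≤-trans #A≤α+r (≤-reflexive (cong (α +_) (sym (+-identityʳ r)))))))
    ... | true  = extend b∈ g (subst (_< deg A b) (+-identityʳ α) lt′)
                    (#>0⇒∃ (λ y → ZB t y ∧ adj b y) (subst (0 <_) (sym (ZB-regular t b∈)) (s≤s z≤n)))

  -- Each missing pair pays one unit to each good end, and a second one if the other end is bad. A good vertex
  -- misses some vertex of the other side, and if that one is good then also its twin; so it collects two units.
  both-charges : ∀ {t K RA RB w w′} (S : Sides t K RA RB (λ _ → false)) → RA w ≡ true → RB w′ ≡ true →
    # (good S) + # (good (oppositeSides S)) ≤ sumOn (side (ZB t) RB) (codeg (side (ZA t) RA))
  both-charges {t} {K} {RA} {RB} S ra rb = *-cancelˡ-≤ 2 (begin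
    2 * (# gB + # gA)         ≡⟨ *-distribˡ-+ 2 (# gB) (# gA) ⟩
    2 * # gB + 2 * # gA       ≤⟨ +-mono-≤ (charges S ra) (charges (oppositeSides S) rb) ⟩
    sumOn B (λ b → sumOn A (λ a → f b a)) + sumOn A (λ a → sumOn B (λ b → f′ a b))
      ≡⟨ cong (sumOn B (λ b → sumOn A (λ a → f b a)) +_) (sumOn-comm A B f′) ⟩
    sumOn B (λ b → sumOn A (λ a → f b a)) + sumOn B (λ b → sumOn A (λ a → f′ a b)) ≡⟨ sumOn-+ B _ _ ⟨
    sumOn B (λ b → sumOn A (λ a → f b a) + sumOn A (λ a → f′ a b)) ≡⟨ sumOn-cong B (λ b _ → sym (sumOn-+ A _ _)) ⟩
    sumOn B (λ b → sumOn A (λ a → f b a + f′ a b)) ≤⟨ sumOn-mono B (λ b _ → sumOn-mono A λ a _ → pointwise b a) ⟩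
    sumOn B (λ b → sumOn A (λ a → 2 * ⟦ not (adj b a) ⟧))
      ≡⟨ sumOn-cong B (λ b _ → trans (sumOn-* A 2 _) (cong (2 *_) (sumOn-⟦⟧ A (λ a → not (adj b a))))) ⟩
    sumOn B (λ b → 2 * codeg A b) ≡⟨ sumOn-* B 2 (codeg A) ⟩
    2 * sumOn B (codeg A) ∎)
    where
    open ≤-Reasoning
    A B gA gB : Fin n → Bool
    A = side (ZA t) RA
    B = side (ZB t) RB
    gB = good S
    gA = good (oppositeSides S)
    f f′ : Fin n → Fin n → ℕ
    f b a = ⟦ not (adj b a) ⟧ * (⟦ gB b ⟧ * (1 + ⟦ not (gA a) ⟧))
    f′ a b = ⟦ not (adj a b) ⟧ * (⟦ gA a ⟧ * (1 + ⟦ not (gB b) ⟧))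
    pointwise : ∀ b a → f b a + f′ a b ≤ 2 * ⟦ not (adj b a) ⟧
    pointwise b a rewrite adj-sym a b with adj b a | gA a | gB b
    ... | true  | _     | _     = z≤n
    ... | false | true  | true  = ≤-refl
    ... | false | true  | false = ≤-refl
    ... | false | false | true  = ≤-refl
    ... | false | false | false = z≤n

module _ (r : ℕ) where
  private
    E T Ω : ℕ
    E = edge-bound-constant r (rest-threshold r)
    T = twin-constant r (rest-threshold r)
    Ω = rest-constant r

  opaque
    unfolding rest-constant

    private
      part₄ : 1 + r + r * r + E ≤ Ω
      part₄ = ≤-trans (m≤m+n _ T) (m≤m+n _ (T * r))

    1+r≤Ω : 1 + r ≤ Ω
    1+r≤Ω = ≤-trans (m≤m+n (1 + r) (r * r)) (≤-trans (m≤m+n (1 + r + r * r) E) part₄)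

    r²≤Ω : r * r ≤ Ω
    r²≤Ω = ≤-trans (m≤n+m (r * r) (1 + r)) (≤-trans (m≤m+n (1 + r + r * r) E) part₄)

    E≤Ω : E ≤ Ω
    E≤Ω = ≤-trans (m≤n+m E (1 + r + r * r)) part₄

    T≤Ω : T ≤ Ω
    T≤Ω = ≤-trans (m≤n+m T (1 + r + r * r + E)) (m≤m+n _ (T * r))

    Tr≤Ω : T * r ≤ Ω
    Tr≤Ω = m≤n+m (T * r) (1 + r + r * r + E + T)

sumOn-false : ∀ {n} (f : Fin n → ℕ) → sumOn (λ _ → false) f ≡ 0
sumOn-false {n} f = trans (sumOn-sum (λ _ → false) f) (sum-zero n)

-- The case distinction on the remaining vertices

module Step {n : ℕ} (G : SphericalGraph n) where
  open Graph G
  open Cycles G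
  open Twins G
  open Counting G
  open Reduction G
  open Tetrahedron

  R-opposite : ∀ t → # (R (opposite t)) ≡ # (R t)
  R-opposite t = #-cong (R-swap t)

  Better-opposite : ∀ t → Better (opposite t) → Better t
  Better-opposite t (t′ , lt) = t′ , subst (_< weight t′) (+-comm (c (y t) (y′ t)) (c (x t) (x′ t))) lt

  module _ (h : n * n + 2 * n + 18 ≤ 2 * D) where

    one-sided : ∀ {t K RA RB} Ω → Sides t K RA RB (λ _ → false) → (∀ w → RB w ≡ false) →
      edge-bound-constant (# (R t)) K ≤ Ω → twin-constant (# (R t)) K * # (R t) ≤ Ω → 400 * Ω ≤ n →
      # (R t) ≤ 1 ⊎ Better t
    one-sided {t} {K} {RA} {RB} Ω S noRB E≤ T≤ big = by-size (# (R t)) refl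
      where
      α β : ℕ
      α = # (ZA t)
      β = # (ZB t)
      A B : Fin n → Bool
      A = side (ZA t) RA
      B = side (ZB t) RB
      eAB≤ : e A B ≤ e A (ZB t)
      eAB≤ = sumOn-mono A λ a _ → deg-mono B (ZB t) a λ b p → ∨-case {ZB t b} p id (λ q → true≢false q (noRB b))
      by-size : ∀ k → # (R t) ≡ k → # (R t) ≤ 1 ⊎ Better t
      by-size 0 eq = inj₁ (≤-trans (≤-reflexive eq) z≤n)
      by-size 1 eq = inj₁ (≤-reflexive eq)
      by-size (suc (suc k)) eq with α * β + 3 * twin-constant (# (R t)) K * # (R t) <? e A (ZB t)
      ... | yes lt = inj₂ (improve S lt)
      ... | no ¬lt = ⊥-elim (one-side-arithmetic n α β k D (e A B) (edge-bound-constant (# (R t)) K)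
        (twin-constant (# (R t)) K * # (R t)) Ω
          (trans (sym (#R+#Z≡n t)) (trans (+-comm (# (R t)) (α + β)) (cong (α + β +_) eq))) h
          (≤-trans (edges≤ S) (+-monoʳ-≤ (2 * e A B + 2 * (α + β) + edge-bound-constant (# (R t)) K)
            (*-monoʳ-≤ 3 (≤-reflexive (sumOn-false d)))))
          (≤-trans eAB≤ (≤-trans (≮⇒≥ ¬lt)
            (≤-reflexive (cong (α * β +_) (*-assoc 3 (twin-constant (# (R t)) K) (# (R t)))))))
          T≤ E≤ big)

    module _ (t : Tetrahedron G) (big : 400 * rest-constant (# (R t)) ≤ n) where

      private
        r K Ω α β : ℕ
        r = # (R t)
        K = rest-threshold r
        Ω = rest-constant r
        α = # (ZA t)
        β = # (ZB t)
        RA RB R₀ A B : Fin n → Bool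
        RA = RAof t K
        RB = RBof t K
        R₀ = R₀of t K
        A = side (ZA t) RA
        B = side (ZB t) RB
        S : Sides t K RA RB R₀
        S = sidesOf t K

        length-condition : ∀ r → 20 * r + 11 ≤ 400 * rest-constant r
        length-condition r = ≤-trans (≤-trans (m≤m+n _ (380 * r + 389)) (≤-reflexive (identity r)))
          (*-monoʳ-≤ 400 (1+r≤Ω r))
          where
          identity : ∀ r → 20 * r + 11 + (380 * r + 389) ≡ 400 * (1 + r)
          identity = solve-∀

        n≤5β : n ≤ 5 * β
        n≤5β = n≤5ZB t h (≤-trans (length-condition r) big)

        n≤5α : n ≤ 5 * α
        n≤5α = n≤5ZB (opposite t) h
          (≤-trans (≤-reflexive (cong (λ k → 20 * k + 11) (R-opposite t))) (≤-trans (length-condition r) big))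

        product≤ : ∀ w → deg (ZA t) w * deg (ZB t) w ≤ (4 + r) * n
        product≤ w = ≤-trans (deg-product t w) (≤-trans (+-monoˡ-≤ (3 * n) (missing≤ t h)) (≤-reflexive (identity r n)))
          where
          identity : ∀ r n → (r + 1) * n + 3 * n ≡ (4 + r) * n
          identity = solve-∀

        small-factor : ∀ p q → p * q ≤ (4 + r) * n → K < q → 64 * p ≤ n
        small-factor p q pq≤ K<q = *-cancelˡ-≤ (4 + r) (begin
          (4 + r) * (64 * p)   ≡⟨ identity r p ⟩
          p * (64 * (4 + r))   ≤⟨ *-monoʳ-≤ p (≤-trans (≤-reflexive (sym (rest-threshold-≡ r))) (<⇒≤ K<q)) ⟩
          p * q                ≤⟨ pq≤ ⟩
          (4 + r) * n          ∎)
          where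
          open ≤-Reasoning
          identity : ∀ r p → (4 + r) * (64 * p) ≡ p * (64 * (4 + r))
          identity = solve-∀

        R₀-degree : ∀ w → R₀ w ≡ true → 32 * d w ≤ n + 32 * r
        R₀-degree w p = *-cancelˡ-≤ 2
          (by-slack (+-mono-≤ (+-mono-≤ (+-mono-≤ (*-monoʳ-≤ 64 (d≤cover (ZA t) (ZB t) (R t) (R-cover t) w))
              (small-factor (deg (ZA t) w) (deg (ZB t) w) (product≤ w) t>))
              (small-factor (deg (ZB t) w) (deg (ZA t) w)
                (≤-trans (≤-reflexive (*-comm (deg (ZB t) w) (deg (ZA t) w))) (product≤ w)) s>))
              (*-monoʳ-≤ 64 (deg≤# (R t) w)))
            0 (identity (d w) (deg (ZA t) w) (deg (ZB t) w) (deg (R t) w) n r))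
          where
          s> : K < deg (ZA t) w
          s> = ≤ᵇ-false⇒> (not-true (proj₂ (∧-true {R t w} (proj₁ (∧-true p)))))
          t> : K < deg (ZB t) w
          t> = ≤ᵇ-false⇒> (not-true (proj₂ (∧-true {R t w ∧ not (deg (ZA t) w ≤ᵇ K)} p)))
          identity : ∀ x s t q n r → 2 * (32 * x) + (64 * (s + (t + q)) + n + n + 64 * r) + 0 ≡ 2 * (n + 32 * r) +
            (64 * x + 64 * s + 64 * t + 64 * q)
          identity = solve-∀

        Σ₀ : ℕ
        Σ₀ = sumOn R₀ d

        Σ₀≤ : 32 * Σ₀ ≤ # R₀ * (n + 32 * r)
        Σ₀≤ = ≤-trans (≤-reflexive (sym (sumOn-* R₀ 32 d))) (sumOn-≤const R₀ _ (n + 32 * r) R₀-degree)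

        m : ℕ
        m = sumOn A (codeg B)

        counted : n * n + 2 * n + 18 + 4 * m ≤ (# A + # B) * (# A + # B) + 4 * (α + β) + 2 * edge-bound-constant r K + 6
          * Σ₀
        counted = count-arithmetic n D (# A) (# B) (e A B) m (α + β) (edge-bound-constant r K) Σ₀ h (edges≤ S)
          (e+codeg A B)

        at-least-two : ∀ k → # R₀ ≡ 2 + k → ⊥
        at-least-two k eq = many-arithmetic n (n ∸ # R₀) k (# A) (# B) m (α + β) (edge-bound-constant r K) Σ₀ r Ω
          (trans (sym (m∸n+n≡m (#≤n R₀))) (cong (n ∸ # R₀ +_) eq))
          counted
          (m+n≤o⇒m≤o∸n (# A + # B) (#A+#B+#R₀≤n S))
          (#Z≤n t) (subst (λ k → 32 * Σ₀ ≤ k * (n + 32 * r)) eq Σ₀≤) (E≤Ω r)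
          (≤-trans (*-monoˡ-≤ r (≤-trans (≤-reflexive (sym eq)) (#-mono (Sides.R₀⊆R S)))) (r²≤Ω r)) big

        -- `γ` is the length of the cycle facing the side that has an additional vertex besides the
        -- one in `R₀`; `half-incomplete` provides the last hypothesis.
        exactly-one : # R₀ ≡ 1 → ∀ γ → n ≤ 5 * γ → γ ≤ 2 * m → ⊥
        exactly-one eq γ n≤5γ γ≤2m = one-arithmetic n (n ∸ # R₀) (# A) (# B) m (α + β) (edge-bound-constant r K) Σ₀ r γ
          Ω
          (trans (sym (m∸n+n≡m (#≤n R₀))) (trans (cong (n ∸ # R₀ +_) eq) (+-comm _ 1)))
          counted (m+n≤o⇒m≤o∸n (# A + # B) (#A+#B+#R₀≤n S)) (#Z≤n t) n≤5γ γ≤2m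
          (≤-trans Σ₀≤ (≤-reflexive (trans (cong (_* (n + 32 * r)) eq) (+-identityʳ (n + 32 * r))))) (E≤Ω r)
            (≤-trans (n≤1+n r) (1+r≤Ω r)) big

        with-one : # R₀ ≡ 1 → # RA ≡ 0 ⊎ (∃ λ w → RA w ≡ true) → # RB ≡ 0 ⊎ (∃ λ w → RB w ≡ true) → r ≤ 1
        with-one eq (inj₂ (w , ra)) _ =
          ⊥-elim (exactly-one eq β n≤5β (≤-trans (half-incomplete S ra) (≤-reflexive (cong (2 *_) (codeg-sym B A)))))
        with-one eq (inj₁ _) (inj₂ (w , rb)) = ⊥-elim (exactly-one eq α n≤5α (half-incomplete (oppositeSides S) rb))
        with-one eq (inj₁ noRA) (inj₁ noRB) =
          ≤-trans (#-mono λ w p → Sides.cover S w p (#≡0⇒false RA noRA w) (#≡0⇒false RB noRB w)) (≤-reflexive eq)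

        with-none : # R₀ ≡ 0 → # RA ≡ 0 ⊎ (∃ λ w → RA w ≡ true) → # RB ≡ 0 ⊎ (∃ λ w → RB w ≡ true) → r ≤ 1 ⊎ Better t
        with-none eq (inj₂ (w , ra)) (inj₂ (w′ , rb)) =
          ⊥-elim (both-arithmetic n (# A) (# B) m (edge-bound-constant r K) α β
          (# (good (oppositeSides S₀))) (# (good S₀)) (twin-constant r K) Ω
          (≤-trans counted (+-monoʳ-≤ ((# A + # B) * (# A + # B) + 4 * (α + β) + 2 * edge-bound-constant r K)
             (*-monoʳ-≤ 6 (≤-trans (sumOn-⊆ R₀ (λ _ → false) d (λ w p → true≢false p (none w)))
               (≤-reflexive (sumOn-false d))))))
          (≤-trans (m≤m+n _ (# R₀)) (#A+#B+#R₀≤n S))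
          (≤-trans (both-charges S₀ ra rb) (≤-reflexive (codeg-sym B A)))
          (good≥ S₀ r refl) (good≥ (oppositeSides S₀) r (R-opposite t)) (E≤Ω r) (T≤Ω r) big)
          where
          none : ∀ w → R₀ w ≡ false
          none = #≡0⇒false R₀ eq
          S₀ : Sides t K RA RB (λ _ → false)
          S₀ = without-R₀ S none
          good≥ : ∀ {t RA RB} (S : Sides t K RA RB (λ _ → false)) r → # (R t) ≡ r →
            # (ZB t) ≤ # (good S) + 3 * twin-constant r K
          good≥ {t} S .(# (R t)) refl = ≤-trans (≤-reflexive (#-split (ZB t) (good S)))
            (+-mono-≤ (#-mono λ b p → proj₂ (∧-true {ZB t b} p)) (#bad≤ S))
        with-none eq _ (inj₁ noRB) = one-sided Ω (without-R₀ S (#≡0⇒false R₀ eq)) (#≡0⇒false RB noRB) (E≤Ω r)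
          (Tr≤Ω r) big
        with-none eq (inj₁ noRA) (inj₂ _) =
          opp (one-sided Ω (oppositeSides (without-R₀ S (#≡0⇒false R₀ eq))) (#≡0⇒false RA noRA)
            (subst (λ k → edge-bound-constant k K ≤ Ω) (sym (R-opposite t)) (E≤Ω r))
            (subst (λ k → twin-constant k K * k ≤ Ω) (sym (R-opposite t)) (Tr≤Ω r)) big)
          where
          opp : # (R (opposite t)) ≤ 1 ⊎ Better (opposite t) → r ≤ 1 ⊎ Better t
          opp (inj₁ le) = inj₁ (subst (_≤ 1) (R-opposite t) le)
          opp (inj₂ b)  = inj₂ (Better-opposite t b)

        empty? : (P : Fin n → Bool) → # P ≡ 0 ⊎ (∃ λ w → P w ≡ true)
        empty? P = decide-count (# P) refl
          where
          decide-count : ∀ k → # P ≡ k → # P ≡ 0 ⊎ (∃ λ w → P w ≡ true)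
          decide-count zero    eq = inj₁ eq
          decide-count (suc k) eq = inj₂ (#>0⇒∃ P (subst (0 <_) (sym eq) (s≤s z≤n)))

        by-R₀ : ∀ k → # R₀ ≡ k → r ≤ 1 ⊎ Better t
        by-R₀ 0             eq = with-none eq (empty? RA) (empty? RB)
        by-R₀ 1             eq = inj₁ (with-one eq (empty? RA) (empty? RB))
        by-R₀ (suc (suc k)) eq = ⊥-elim (at-least-two k eq)

      small-rest-or-better : # (R t) ≤ 1 ⊎ Better t
      small-rest-or-better = by-R₀ (# R₀) refl

-- Monotonicity and size conditions

opaque
  unfolding twin-constant edge-bound-constant rest-threshold rest-constant

  -- During the descent the number of remaining vertices is known only through its initial bound, so
  -- the condition on n is imposed for that bound and carried over.
  rest-constant-mono : ∀ {r s} → r ≤ s → rest-constant r ≤ rest-constant s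
  rest-constant-mono {r} {s} r≤s =
    +-mono-≤ (+-mono-≤ (+-mono-≤ (+-mono-≤ (s≤s r≤s) (*-mono-≤ r≤s r≤s)) edge-mono) twin-mono) (*-mono-≤ twin-mono r≤s)
    where
    K≤ : rest-threshold r ≤ rest-threshold s
    K≤ = *-monoʳ-≤ 64 (+-monoʳ-≤ 4 r≤s)
    rK≤ : r * rest-threshold r ≤ s * rest-threshold s
    rK≤ = *-mono-≤ r≤s K≤
    edge-mono : edge-bound-constant r (rest-threshold r) ≤ edge-bound-constant s (rest-threshold s)
    edge-mono = +-mono-≤ (*-monoʳ-≤ 4 rK≤) (*-monoʳ-≤ 2 (*-mono-≤ r≤s r≤s))
    twin-mono : twin-constant r (rest-threshold r) ≤ twin-constant s (rest-threshold s)
    twin-mono = +-mono-≤ rK≤ (*-mono-≤ (+-mono-≤ r≤s rK≤) (*-monoʳ-≤ 6 (+-mono-≤ (+-monoˡ-≤ 2 K≤) r≤s)))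

module _ (n K L : ℕ) (400≤K : 400 ≤ K) (big : K * (10 * L + 346) ≤ n) where
  private
    346K≤n : 346 * K ≤ n
    346K≤n = ≤-trans (≤-trans (≤-reflexive (*-comm 346 K)) (*-monoʳ-≤ K (m≤n+m 346 (10 * L)))) big

  size-condition₁ : 20 * L ≤ n
  size-condition₁ = ≤-trans
    (≤-trans (≤-reflexive (*-assoc 2 10 L))
    (*-mono-≤ {2} {K} {10 * L} (≤-trans (m≤m+n 2 398) 400≤K) (m≤m+n (10 * L) 346))) big

  size-condition₃ : 15 * n + K * (10 * L + 346) ≤ K * n
  size-condition₃ = ≤-trans (+-monoʳ-≤ (15 * n) big)
    (≤-trans (≤-reflexive (+-comm (15 * n) n)) (*-monoˡ-≤ n (≤-trans (m≤m+n 16 384) 400≤K)))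

  size-condition₄ : 300 ≤ n
  size-condition₄ = ≤-trans
    (≤-trans (m≤m+n 300 46) (≤-trans (≤-reflexive (sym (*-identityʳ 346))) (*-monoʳ-≤ 346 (≤-trans (s≤s z≤n) 400≤K))))
    346K≤n

  -- The term 300n on the left requires `K` to exceed 300; with K ≥ 400 a surplus of 100n is left,
  -- and 346K ≤ n makes it exceed 1350K.
  size-condition₂ : 150 * (9 * K + 2 * n) < K * n
  size-condition₂ = by-slack (+-mono-≤ (+-mono-≤ (*-monoʳ-≤ 4 346K≤n) (*-monoˡ-≤ n 400≤K)) size-condition₄)
    (34 * K + 95 * n + 299) (identity K n)
    where
    identity : ∀ K n → suc (150 * (9 * K + 2 * n)) + (4 * n + K * n + n) + (34 * K + 95 * n + 299) ≡ K * n +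
      (4 * (346 * K) + 400 * n + 300)
    identity = solve-∀

-- Descent to at most one remaining vertex

module Existence {n : ℕ} (G : SphericalGraph n) where
  open Graph G
  open Cycles G
  open Reduction G
  open Step G
  open Rough G
  open Tetrahedron

  weight≤2n : (t : Tetrahedron G) → weight t ≤ 2 * n
  weight≤2n t = +-mono-≤ (#≤n (lk (x t) (x′ t))) (≤-trans (#≤n (lk (y t) (y′ t))) (≤-reflexive (sym (+-identityʳ n))))

  module _ (h : n * n + 2 * n + 18 ≤ 2 * D) where

    some-tetrahedron : ∀ K L → 400 ≤ K → suc L ≡ 17 * K → K * (10 * L + 346) ≤ n →
      Σ (Tetrahedron G) λ t → n ≤ weight t + (4 * L + 9)
    some-tetrahedron K L 400≤K L≡ big = from-edge (heavy-edge {{>-nonZero 0<n}} h)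
      where
      0<n : 0 < n
      0<n = ≤-trans (s≤s z≤n) (size-condition₄ n K L 400≤K big)
      20≤K : 20 ≤ K
      20≤K = ≤-trans (m≤m+n 20 380) 400≤K
      Goal : Set
      Goal = Σ (Tetrahedron G) λ t → n ≤ weight t + (4 * L + 9)
      from-typical : ∀ {A B Aₜ Bₜ} → RoughBipartition K L A B Aₜ Bₜ →
        (∃ λ x → ∃ λ y → adj x y ≡ true × ((Aₜ x ≡ true × Aₜ y ≡ true) ⊎ (Bₜ x ≡ true × Bₜ y ≡ true))) → Goal
      from-typical P (x , y , xy , inj₁ (x∈ , y∈)) = rough-tetrahedron G K L P 20≤K
        (size-condition₁ n K L 400≤K big) (size-condition₂ n K L 400≤K big) (size-condition₃ n K L 400≤K big) 0<n xy x∈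
          y∈
      from-typical P (x , y , xy , inj₂ (x∈ , y∈)) = rough-tetrahedron G K L (swap P) 20≤K
        (size-condition₁ n K L 400≤K big) (size-condition₂ n K L 400≤K big) (size-condition₃ n K L 400≤K big) 0<n xy x∈
          y∈
      from-edge : (∃ λ u → ∃ λ v → adj u v ≡ true × n + 2 * c u v < d u + d v + 10) → Goal
      from-edge (u , v , _ , lt) = from-typical P (typical-edge G K L P 20≤K
        (size-condition₁ n K L 400≤K big) (size-condition₂ n K L 400≤K big) (size-condition₃ n K L 400≤K big) 0<n)
        where P = rough-bipartition K L L≡ (size-condition₄ n K L 400≤K big) h u v lt

    -- The weight never exceeds 2n, so `k` bounds the number of improvements still possible. A
    -- larger weight preserves the bound `C` on the vertices outside the cycles.
    iterate : ∀ C → 400 * rest-constant C ≤ n → ∀ k t → n ≤ weight t + C → 2 * n ≤ weight t + k →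
      Σ (Tetrahedron G) λ t → # (R t) ≤ 1
    iterate C big k t ht hk = continue k hk
      (small-rest-or-better h t (≤-trans (*-monoʳ-≤ 400 (rest-constant-mono (#R≤ t C ht))) big))
      where
      continue : ∀ k → 2 * n ≤ weight t + k → # (R t) ≤ 1 ⊎ Better t → Σ (Tetrahedron G) λ t → # (R t) ≤ 1
      continue k       hk (inj₁ le)        = t , le
      continue zero    hk (inj₂ (t′ , lt)) =
        ⊥-elim (<⇒≱ lt (≤-trans (weight≤2n t′) (≤-trans hk (≤-reflexive (+-identityʳ (weight t))))))
      continue (suc k) hk (inj₂ (t′ , lt)) = iterate C big k t′ (≤-trans ht (+-monoˡ-≤ C (<⇒≤ lt)))
        (≤-trans hk (≤-trans (≤-reflexive (+-suc (weight t) k)) (+-monoˡ-≤ k lt)))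

    tight-tetrahedron : ∀ K L → 400 ≤ K → suc L ≡ 17 * K → K * (10 * L + 346) ≤ n →
      400 * rest-constant (4 * L + 9) ≤ n →
      Σ (Tetrahedron G) λ t → # (R t) ≤ 1
    tight-tetrahedron K L 400≤K L≡ big₁ big₂ = start (some-tetrahedron K L 400≤K L≡ big₁)
      where
      start : (Σ (Tetrahedron G) λ t → n ≤ weight t + (4 * L + 9)) → Σ (Tetrahedron G) λ t → # (R t) ≤ 1
      start (t , ht) = iterate (4 * L + 9) big₂ (2 * n) t ht (m≤n+m (2 * n) (weight t))

-- A single vertex outside the two cycles

-- The degree sum in the link of w gives E ≤ 2(s + t) - 4, so at least (s - 2)(t - 2) pairs are
-- missing. With N = n - 1 this yields 2D ≤ N² + 4N + 4(s + t - (s - 2)(t - 2)), and the last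
-- bracket equals 5 - (s - 3)(t - 3). Hence 2D ≤ n² + 2n + 17; the slack 4pq is the discarded
-- product.
one-vertex-arithmetic : ∀ n D α β X m s t S T E → n ≡ 1 + (α + β) → n * n + 2 * n + 18 ≤ 2 * D →
  D ≤ 2 * (α + β) + 2 * X + 2 * (s + t) → X + m ≡ α * β → s * t ≤ E + m →
  S + T + 2 * E + 12 ≤ 6 * (s + t) → 2 * s ≤ S + 2 → 2 * t ≤ T + 2 → 3 ≤ s → 3 ≤ t → ⊥
one-vertex-arithmetic .(1 + (α + β)) D α β X m .(3 + p) .(3 + q) S T E refl h₁ h₂ h₃ h₄ h₅ h₆ h₇
  (s≤s (s≤s (s≤s (z≤n {p})))) (s≤s (s≤s (s≤s (z≤n {q})))) =
  absurd-slack (+-mono-≤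
    (+-mono-≤ (+-mono-≤ (+-mono-≤ (+-mono-≤ (+-mono-≤ (+-mono-≤ h₁ (*-monoʳ-≤ 2 h₂)) (*-monoʳ-≤ 4 (≤-reflexive h₃)))
      (4xy≤[x+y]² α β)) (*-monoʳ-≤ 4 h₄)) (*-monoʳ-≤ 2 h₅)) (*-monoʳ-≤ 2 h₆)) (*-monoʳ-≤ 2 h₇))
    (4 * p * q) (identity D α β X m p q S T E)
  where
  identity : ∀ D α β X m p q S T E →
    suc (2 * D + 2 * (2 * (α + β) + 2 * X + 2 * ((3 + p) + (3 + q))) + 4 * (α * β) + (α + β) * (α + β) + 4 * (E + m)
      + 2 * (6 * ((3 + p) + (3 + q))) + 2 * (S + 2) + 2 * (T + 2) + 4 * p * q)
    ≡ ((1 + (α + β)) * (1 + (α + β)) + 2 * (1 + (α + β)) + 18) + 2 * D + 4 * (X + m) + 4 * (α * β) + 4 *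
      ((3 + p) * (3 + q)) + 2 * (S + T + 2 * E + 12)
      + 2 * (2 * (3 + p)) + 2 * (2 * (3 + q))
  identity = solve-∀

module Local {n : ℕ} (G : SphericalGraph n) where
  open Graph G
  open Cycles G
  open Twins G
  open Tetrahedron

  ZB-connected : ∀ t (P : Fin n → Bool) →
    (∀ b b′ → P b ≡ true → ZB t b ≡ true → ZB t b′ ≡ true → adj b b′ ≡ true → P b′ ≡ true) →
    ∀ {b₀} → ZB t b₀ ≡ true → P b₀ ≡ true → ∀ b → ZB t b ≡ true → P b ≡ true
  ZB-connected t P closed b₀∈ Pb₀ b b∈ = proj₁ (∧-true {P b} (lk-connected (xx′ t) (λ b → P b ∧ ZB t b)
    (λ b b′ p b′∈ bb′ → closed b b′ (proj₁ (∧-true {P b} p)) (proj₂ (∧-true {P b} p)) b′∈ bb′ ∧ᵗ b′∈) b₀∈ (Pb₀ ∧ᵗ b₀∈) b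
      b∈))

  -- Without a common neighbour outside the two cycles, the at least four common neighbours of a and b
  -- have to be the two cycle neighbours of a and the two cycle neighbours of b.
  cycle-neighbour : ∀ t {a b} → ZA t a ≡ true → ZB t b ≡ true → adj a b ≡ true →
    (∀ u → R t u ≡ true → adj a u ≡ true → adj b u ≡ true → ⊥) →
    ∀ b′ → ZB t b′ ≡ true → adj b b′ ≡ true → adj a b′ ≡ true
  cycle-neighbour t {a} {b} a∈ b∈ ab none b′ b′∈ bb′ = proj₂ (∧-true {ZB t b′ ∧ adj b b′}
    (⊆∧#≥⇒⊇ (λ y → (ZB t y ∧ adj b y) ∧ adj a y) (λ y → ZB t y ∧ adj b y) (λ y p → proj₁ (∧-true p)) two≤ b′
      (b′∈ ∧ᵗ bb′)))
    where
    open ≤-Reasoning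
    split : ∀ y → lk a b y ≡ true → (ZA t y ∧ adj a y) ∨ ((ZB t y ∧ adj b y) ∧ adj a y) ≡ true
    split y p with ∧-true {adj a y} p
    ... | ay , by with ZA t y in za | ZB t y in zb
    ... | true  | _     = ∨-trueˡ ay
    ... | false | true  = by ∧ᵗ ay
    ... | false | false = ⊥-elim (none y (R-cover t y za zb) ay by)
    two≤ : deg (ZB t) b ≤ # (λ y → (ZB t y ∧ adj b y) ∧ adj a y)
    two≤ = +-cancelˡ-≤ 2 _ _ (begin
      2 + deg (ZB t) b                                                   ≡⟨ cong (2 +_) (ZB-regular t b∈) ⟩
      4                                                                  ≤⟨ 4≤c ab ⟩
      c a b
        ≤⟨ #-mono {Q = λ y → (ZA t y ∧ adj a y) ∨ ((ZB t y ∧ adj b y) ∧ adj a y)} split ⟩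
      # (λ y → (ZA t y ∧ adj a y) ∨ ((ZB t y ∧ adj b y) ∧ adj a y))      ≤⟨ #-∨≤ (λ y → ZA t y ∧ adj a y) _ ⟩
      deg (ZA t) a + # (λ y → (ZB t y ∧ adj b y) ∧ adj a y)
        ≡⟨ cong (_+ # (λ y → (ZB t y ∧ adj b y) ∧ adj a y)) (ZA-regular t a∈) ⟩
      2 + # (λ y → (ZB t y ∧ adj b y) ∧ adj a y)                         ∎)

  deg≡0⇒nonadj : ∀ P v → deg P v ≡ 0 → ∀ u → P u ≡ true → adj v u ≡ true → ⊥
  deg≡0⇒nonadj P v h u p q = <⇒≱ (∃⇒#>0 (λ y → P y ∧ adj v y) (p ∧ᵗ q)) (≤-reflexive h)

  -- Some neighbour of `a` lies on ZB, for otherwise the link of `a` and a cycle neighbour would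
  -- consist of at most two vertices. From there `cycle-neighbour` spreads the adjacency around ZB.
  full-vertex : ∀ t {a} → ZA t a ≡ true → (∀ u → R t u ≡ true → adj a u ≡ true → ⊥) → ∀ b → ZB t b ≡ true →
    adj a b ≡ true
  full-vertex t {a} a∈ none = by-deg (deg (ZB t) a) refl
    where
    open ≤-Reasoning
    by-deg : ∀ k → deg (ZB t) a ≡ k → ∀ b → ZB t b ≡ true → adj a b ≡ true
    by-deg (suc k) eq = from (#>0⇒∃ (λ b → ZB t b ∧ adj a b) (subst (0 <_) (sym eq) (s≤s z≤n)))
      where
      from : (∃ λ b → ZB t b ∧ adj a b ≡ true) → ∀ b → ZB t b ≡ true → adj a b ≡ true
      from (b₀ , p) = ZB-connected t (adj a)
        (λ b b′ ab b∈ b′∈ bb′ → cycle-neighbour t a∈ b∈ ab (λ u r au _ → none u r au) b′ b′∈ bb′)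
        (proj₁ (∧-true p)) (proj₂ (∧-true {ZB t b₀} p))
    by-deg zero eq = ⊥-elim (isolated (#>0⇒∃ (λ y → ZA t y ∧ adj a y) (subst (0 <_) (sym (ZA-regular t a∈)) (s≤s z≤n))))
      where
      isolated : (∃ λ a′ → ZA t a′ ∧ adj a a′ ≡ true) → ⊥
      isolated (a′ , p) = <⇒≱ (s≤s (s≤s (s≤s z≤n))) (begin
        4                      ≤⟨ 4≤c (proj₂ (∧-true {ZA t a′} p)) ⟩
        c a a′                 ≤⟨ #-mono in-ZA ⟩
        deg (ZA t) a           ≡⟨ ZA-regular t a∈ ⟩
        2                      ∎)
        where
        in-ZA : ∀ y → lk a a′ y ≡ true → ZA t y ∧ adj a y ≡ true
        in-ZA y q with ZA t y in za | ZB t y in zb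
        ... | true  | _     = proj₁ (∧-true {adj a y} q)
        ... | false | true  = ⊥-elim (deg≡0⇒nonadj (ZB t) a eq y zb (proj₁ (∧-true {adj a y} q)))
        ... | false | false = ⊥-elim (none y (R-cover t y za zb) (proj₁ (∧-true {adj a y} q)))

  -- Here `cycle-neighbour` is applied with the cycles exchanged: `a` and `b` have no common
  -- neighbour outside the cycles, so the adjacency of `b` to `a` passes to `a′`, which itself may
  -- have neighbours outside.
  full-neighbour : ∀ t {a a′} → ZA t a ≡ true → (∀ u → R t u ≡ true → adj a u ≡ true → ⊥) → ZA t a′ ≡ true →
    adj a a′ ≡ true →
    ∀ b → ZB t b ≡ true → adj a′ b ≡ true
  full-neighbour t {a} {a′} a∈ none a′∈ aa′ b b∈ =
    flip (cycle-neighbour (opposite t) b∈ a∈ (flip (full-vertex t a∈ none b b∈))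
    (λ u r _ au → none u (trans (sym (R-swap t u)) r) au) a′ a′∈ aa′)

  module _ (t : Tetrahedron G) {w : Fin n} (w∈R : R t w ≡ true) (unique : ∀ u → R t u ≡ true → u ≡ w) where
    private
      S T : Fin n → Bool
      S a = ZA t a ∧ adj w a
      T b = ZB t b ∧ adj w b

    nonadj⇒no-R : ∀ {v} → adj w v ≡ false → ∀ u → R t u ≡ true → adj v u ≡ true → ⊥
    nonadj⇒no-R {v} wv u r vu = true≢false (trans (sym (cong (adj v) (unique u r))) vu) (trans (adj-sym v w) wv)

    -- b is an end of an arc of N(w) in ZB, b′ its cycle neighbour outside N(w), b″ the other one.
    module _ {b b′ b″ : Fin n} (b∈ : ZB t b ≡ true) (wb : adj w b ≡ true) (b′∈ : ZB t b′ ≡ true) (bb′ : adj b b′ ≡ true)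
      (wb′ : adj w b′ ≡ false)
             (b″≢b′ : b″ ≢ b′) (b″∈ : ZB t b″ ≡ true) (bb″ : adj b b″ ≡ true)
             (only : ∀ z → ZB t z ∧ adj b z ≡ true → z ≡ b′ ⊎ z ≡ b″) where

      private
        b-full : ∀ a → ZA t a ≡ true → adj b a ≡ true
        b-full = full-neighbour (opposite t) b′∈ (λ u r → nonadj⇒no-R wb′ u (trans (sym (R-swap t u)) r)) b∈ (flip bb′)

        b′-full : ∀ a → ZA t a ≡ true → adj b′ a ≡ true
        b′-full = full-vertex (opposite t) b′∈ (λ u r → nonadj⇒no-R wb′ u (trans (sym (R-swap t u)) r))

        S⊆lk : ∀ z → S z ≡ true → lk w b z ≡ true
        S⊆lk z p = proj₂ (∧-true {ZA t z} p) ∧ᵗ b-full z (proj₁ (∧-true p))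

        lk⊆S : ∀ z → lk w b z ≡ true → S z ≡ true ⊎ z ≡ b″
        lk⊆S z p with ∧-true {adj w z} p
        ... | wz , bz with ZA t z in za | ZB t z in zb
        ... | true  | _     = inj₁ wz
        ... | false | false = ⊥-elim (adj⇒≢ wz (sym (unique z (R-cover t z za zb))))
        ... | false | true  with only z (zb ∧ᵗ bz)
        ... | inj₂ z≡b″ = inj₂ z≡b″
        ... | inj₁ refl = true≢false wz wb′

      -- The link of `wb` would properly contain the cycle ZA, with `b″` as a further vertex.
      not-all-adjacent : adj w b″ ≡ true → (∀ a → ZA t a ≡ true → adj w a ≡ true) → ⊥
      not-all-adjacent wb″ all = ZA-∌ZB t (ZA-minimal t wb (λ z z∈ → all z z∈ ∧ᵗ b-full z z∈) b″ (wb″ ∧ᵗ bb″)) b″∈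

      -- In this case the link of `wb` lies inside ZA and is therefore all of ZA. For an edge `aa′`
      -- of ZA the vertices `b′`, `b″` and `w` are then three neighbours of `a′` in the link cycle
      -- of `ab`.
      isolated-end : adj w b″ ≡ false → ⊥
      isolated-end wb″ = contra (#>0⇒∃ (λ y → ZA t y ∧ adj a y) (subst (0 <_) (sym (ZA-regular t (x∈ZA t))) (s≤s z≤n)))
        where
        a = x t
        S≡lk : ∀ z → lk w b z ≡ true → S z ≡ true
        S≡lk z p with lk⊆S z p
        ... | inj₁ q    = q
        ... | inj₂ refl = true≢false (proj₁ (∧-true p)) wb″
        S-regular : ∀ z → S z ≡ true → 2 ≤ deg S z
        S-regular z p = ≤-trans (≤-reflexive (sym (lk-2-regular wb (S⊆lk z p)))) (deg-mono (lk w b) S z S≡lk)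
        all : ∀ z → ZA t z ≡ true → adj w z ≡ true
        all z z∈ = proj₂ (∧-true {ZA t z} (from (lk-nonempty wb) z z∈))
          where
          from : (∃ λ z → lk w b z ≡ true) → ∀ z → ZA t z ≡ true → S z ≡ true
          from (z₀ , p) = lk-minimal (yy′ t) S (λ z q → proj₁ (∧-true q)) S-regular (S≡lk z₀ p)
        b″-full : ∀ a → ZA t a ≡ true → adj b″ a ≡ true
        b″-full = full-vertex (opposite t) b″∈ (λ u r → nonadj⇒no-R wb″ u (trans (sym (R-swap t u)) r))
        contra : (∃ λ a′ → ZA t a′ ∧ adj a a′ ≡ true) → ⊥
        contra (a′ , p) = <⇒≱ (three-elements (λ y → lk a b y ∧ adj a′ y) (b″≢b′ ∘ sym) b′≢w b″≢w
            ((flip (b′-full a (x∈ZA t)) ∧ᵗ bb′) ∧ᵗ flip (b′-full a′ a′∈))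
            ((flip (b″-full a (x∈ZA t)) ∧ᵗ bb″) ∧ᵗ flip (b″-full a′ a′∈))
            ((flip (all a (x∈ZA t)) ∧ᵗ flip wb) ∧ᵗ flip (all a′ a′∈)))
          (≤-reflexive (lk-2-regular (flip (b-full a (x∈ZA t))) (aa′ ∧ᵗ b-full a′ a′∈)))
          where
          a′∈ = proj₁ (∧-true {ZA t a′} p)
          aa′ = proj₂ (∧-true {ZA t a′} p)
          R∌ZB : ∀ z → ZB t z ≡ true → z ≢ w
          R∌ZB z z∈ refl = true≢false z∈ (not-true (proj₂ (∧-true {not (ZA t z)} w∈R)))
          b′≢w : b′ ≢ w
          b′≢w = R∌ZB b′ b′∈
          b″≢w : b″ ≢ w
          b″≢w = R∌ZB b″ b″∈

      -- The link of `wb` is a cycle made up of `S` and `b″`. Deleting `b″` leaves a path on `S`, so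
      -- an end of an arc on ZB controls N(w) on the other cycle.
      arc-edges : 2 * # S ≤ e S S + 2
      arc-edges = begin
        2 * # S                                         ≡⟨ *-comm 2 (# S) ⟩
        # S * 2                                         ≤⟨ sumOn-≥const S (λ z → deg S z + ⟦ adj b″ z ⟧) 2 near ⟩
        sumOn S (λ z → deg S z + ⟦ adj b″ z ⟧)          ≡⟨ sumOn-+ S (deg S) _ ⟩
        e S S + sumOn S (λ z → ⟦ adj b″ z ⟧)            ≡⟨ cong (e S S +_) (sumOn-⟦⟧ S (adj b″)) ⟩
        e S S + deg S b″                                ≤⟨ +-monoʳ-≤ (e S S) degS ⟩
        e S S + 2                                       ∎
        where
        open ≤-Reasoning
        near : ∀ z → S z ≡ true → 2 ≤ deg S z + ⟦ adj b″ z ⟧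
        near z p = begin
          2                                             ≡⟨ lk-2-regular wb (S⊆lk z p) ⟨
          deg (lk w b) z
            ≤⟨ #-mono {Q = λ y → (S y ∧ adj z y) ∨ ((y == b″) ∧ adj b″ z)} split ⟩
          # (λ y → (S y ∧ adj z y) ∨ ((y == b″) ∧ adj b″ z)) ≤⟨ #-∨≤ (λ y → S y ∧ adj z y) _ ⟩
          deg S z + # (λ y → (y == b″) ∧ adj b″ z)      ≤⟨ +-monoʳ-≤ (deg S z) point ⟩
          deg S z + ⟦ adj b″ z ⟧                        ∎
          where
          split : ∀ y → lk w b y ∧ adj z y ≡ true → (S y ∧ adj z y) ∨ ((y == b″) ∧ adj b″ z) ≡ true
          split y q with lk⊆S y (proj₁ (∧-true q))
          ... | inj₁ y∈S  = ∨-trueˡ (y∈S ∧ᵗ proj₂ (∧-true {lk w b y} q))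
          ... | inj₂ refl = ∨-trueʳ (==-refl y ∧ᵗ flip (proj₂ (∧-true {lk w b y} q)))
          point : # (λ y → (y == b″) ∧ adj b″ z) ≤ ⟦ adj b″ z ⟧
          point = ≤-reflexive (trans
            (trans (#-sum _) (trans (sum-cong λ y → ⟦∧⟧ (y == b″) (adj b″ z)) (sum-* ⟦ adj b″ z ⟧ _)))
            (trans (cong (_* ⟦ adj b″ z ⟧) (sum-δ b″)) (+-identityʳ _)))
        degS : deg S b″ ≤ 2
        degS = by-lk (decide (adj w b″))
          where
          by-lk : adj w b″ ≡ true ⊎ adj w b″ ≡ false → deg S b″ ≤ 2
          by-lk (inj₁ wb″) = ≤-trans (deg-mono S (lk w b) b″ S⊆lk) (≤-reflexive (lk-2-regular wb (wb″ ∧ᵗ bb″)))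
          by-lk (inj₂ wb″) = ⊥-elim (isolated-end wb″)

      arc-length : 3 ≤ # S
      arc-length = ≤-pred (begin
        4                                  ≤⟨ 4≤c wb ⟩
        c w b                              ≤⟨ #-mono {Q = λ y → S y ∨ (y == b″)} split ⟩
        # (λ y → S y ∨ (y == b″))          ≤⟨ #-∨≤ S (_== b″) ⟩
        # S + # (_== b″)                   ≡⟨ cong (# S +_) (trans (#-sum (_== b″)) (sum-δ b″)) ⟩
        # S + 1                            ≡⟨ +-comm (# S) 1 ⟩
        suc (# S)                          ∎)
        where
        open ≤-Reasoning
        split : ∀ y → lk w b y ≡ true → S y ∨ (y == b″) ≡ true
        split y p with lk⊆S y p
        ... | inj₁ q    = ∨-trueˡ q
        ... | inj₂ refl = ∨-trueʳ (==-refl y)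

module OneVertex {n : ℕ} (G : SphericalGraph n) where
  open Graph G
  open Cycles G
  open Twins G
  open Local G
  open Tetrahedron

  module _ (t : Tetrahedron G) {w : Fin n} (w∈R : R t w ≡ true) (unique : ∀ u → R t u ≡ true → u ≡ w) where
    private
      S T : Fin n → Bool
      S a = ZA t a ∧ adj w a
      T b = ZB t b ∧ adj w b

    -- Otherwise N(w) lies in ZA. For a neighbour `a` the link of `wa` has at most two vertices, and
    -- without any neighbour the degree sum of the link of `w` reads 12 = 0.
    has-ZB-neighbour : deg (ZB t) w ≡ 0 → ⊥
    has-ZB-neighbour T≡∅ = by-deg (deg (ZA t) w) refl
      where
      open ≤-Reasoning
      in-ZA : ∀ u → adj w u ≡ true → ZA t u ≡ true
      in-ZA u wu with ZA t u in za | ZB t u in zb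
      ... | true  | _     = refl
      ... | false | true  = ⊥-elim (deg≡0⇒nonadj (ZB t) w T≡∅ u zb wu)
      ... | false | false = ⊥-elim (adj⇒≢ wu (sym (unique u (R-cover t u za zb))))
      by-deg : ∀ k → deg (ZA t) w ≡ k → ⊥
      by-deg (suc k) eq = from (#>0⇒∃ (λ a → ZA t a ∧ adj w a) (subst (0 <_) (sym eq) (s≤s z≤n)))
        where
        from : (∃ λ a → ZA t a ∧ adj w a ≡ true) → ⊥
        from (a , p) = <⇒≱ (s≤s (s≤s (s≤s z≤n))) (begin
          4              ≤⟨ 4≤c (proj₂ (∧-true {ZA t a} p)) ⟩
          c w a          ≤⟨ #-mono (λ y q → in-ZA y (proj₁ (∧-true q)) ∧ᵗ proj₂ (∧-true {adj w y} q)) ⟩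
          deg (ZA t) a   ≡⟨ ZA-regular t (proj₁ (∧-true p)) ⟩
          2              ∎)
      by-deg zero eq = <⇒≱ (s≤s z≤n) (begin
          12                             ≤⟨ m≤n+m 12 _ ⟩
          sumOn (adj w) (c w) + 12       ≡⟨ link-degree-sum w ⟩
          6 * d w                        ≤⟨ *-monoʳ-≤ 6 (#-mono λ u wu → in-ZA u wu ∧ᵗ wu) ⟩
          6 * deg (ZA t) w               ≡⟨ cong (6 *_) eq ⟩
          0                              ∎)

    -- All three parts concern N(w) on ZA, although they are derived from an end of an arc of N(w)
    -- on ZB.
    Arc : Set
    Arc = 2 * # S ≤ e S S + 2 × 3 ≤ # S × ((∀ a → ZA t a ≡ true → adj w a ≡ true) → ⊥)

    full-or-arc : (∀ b → ZB t b ≡ true → adj w b ≡ true) ⊎ Arc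
    full-or-arc = by-deg (deg (ZB t) w) refl
      where
      arc : ∀ {b b′} → ZB t b ≡ true → adj w b ≡ true → ZB t b′ ≡ true → adj b b′ ≡ true → adj w b′ ≡ false → Arc
      arc {b} {b′} b∈ wb b′∈ bb′ wb′ =
        with-other (other-element (λ y → ZB t y ∧ adj b y) (ZB-regular t b∈) (b′∈ ∧ᵗ bb′))
        where
        with-other : (∃ λ b″ → b″ ≢ b′ × ZB t b″ ∧ adj b b″ ≡ true × (∀ z → ZB t z ∧ adj b z ≡ true → z ≡ b′ ⊎ z ≡ b″))
          → Arc
        with-other (b″ , b″≢b′ , p , only) = arc-edges′ , arc-length′ , not-all (decide (adj w b″))
          where
          b″∈ = proj₁ (∧-true {ZB t b″} p)
          bb″ = proj₂ (∧-true {ZB t b″} p)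
          arc-edges′ = arc-edges t w∈R unique b∈ wb b′∈ bb′ wb′ b″≢b′ b″∈ bb″ only
          arc-length′ = arc-length t w∈R unique b∈ wb b′∈ bb′ wb′ b″≢b′ b″∈ bb″ only
          not-all : adj w b″ ≡ true ⊎ adj w b″ ≡ false → (∀ a → ZA t a ≡ true → adj w a ≡ true) → ⊥
          not-all (inj₁ wb″) = not-all-adjacent t w∈R unique b∈ wb b′∈ bb′ wb′ b″≢b′ b″∈ bb″ only wb″
          not-all (inj₂ wb″) _ = isolated-end t w∈R unique b∈ wb b′∈ bb′ wb′ b″≢b′ b″∈ bb″ only wb″
      leaving : (∃ λ b → T b ≡ true × 0 < exits t w b) → Arc
      leaving (b , p , lt) = from (#>0⇒∃ (λ b′ → (ZB t b′ ∧ adj b b′) ∧ not (adj w b′)) lt)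
        where
        from : (∃ λ b′ → (ZB t b′ ∧ adj b b′) ∧ not (adj w b′) ≡ true) → Arc
        from (b′ , q) = let r , s = ∧-true {ZB t b′ ∧ adj b b′} q in
          arc (proj₁ (∧-true p)) (proj₂ (∧-true {ZB t b} p)) (proj₁ (∧-true r)) (proj₂ (∧-true {ZB t b′} r))
            (not-true s)
      staying : sumOn T (exits t w) ≡ 0 → (∃ λ b → T b ≡ true) → ∀ b → ZB t b ≡ true → adj w b ≡ true
      staying none (b₀ , p) = ZB-connected t (adj w) closed (proj₁ (∧-true p)) (proj₂ (∧-true {ZB t b₀} p))
        where
        closed : ∀ b b′ → adj w b ≡ true → ZB t b ≡ true → ZB t b′ ≡ true → adj b b′ ≡ true → adj w b′ ≡ true
        closed b b′ wb b∈ b′∈ bb′ with adj w b′ in wb′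
        ... | true  = refl
        ... | false = ⊥-elim (<⇒≱ (∃⇒#>0 (λ b′ → (ZB t b′ ∧ adj b b′) ∧ not (adj w b′)) ((b′∈ ∧ᵗ bb′) ∧ᵗ cong not wb′))
            (≤-trans (term≤sumOn T (exits t w) {b} (b∈ ∧ᵗ wb)) (≤-reflexive none)))
      by-exits : ∀ k → sumOn T (exits t w) ≡ k → (∃ λ b → T b ≡ true) → (∀ b → ZB t b ≡ true → adj w b ≡ true) ⊎ Arc
      by-exits zero    eq b₀ = inj₁ (staying eq b₀)
      by-exits (suc k) eq b₀ = inj₂ (leaving (sumOn-<⇒∃ T (λ _ → 0) (exits t w)
        (subst₂ _<_ (sym (trans (sumOn-const T 0) (*-zeroʳ (# T)))) (sym eq) (s≤s z≤n))))
      by-deg : ∀ k → deg (ZB t) w ≡ k → (∀ b → ZB t b ≡ true → adj w b ≡ true) ⊎ Arc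
      by-deg zero    eq = ⊥-elim (has-ZB-neighbour eq)
      by-deg (suc k) eq = by-exits (sumOn T (exits t w)) refl (#>0⇒∃ T (subst (0 <_) (sym eq) (s≤s z≤n)))

    full⇒cycle : (∀ b → ZB t b ≡ true → adj w b ≡ true) → 2 * # T ≤ e T T + 2 × 3 ≤ # T
    full⇒cycle full = ≤-trans (≤-trans (≤-reflexive (*-comm 2 (# T))) (sumOn-≥const T (deg T) 2 λ b p →
        ≤-trans (≤-reflexive (sym (ZB-regular t (proj₁ (∧-true p))))) (deg-mono (ZB t) T b λ y q → q ∧ᵗ full y q)))
          (m≤m+n (e T T) 2)
      , ≤-trans (≤-trans (n≤1+n 3) (4≤c (xx′ t))) (#-mono λ b q → q ∧ᵗ full b q)

    module _ (#R≡1 : # (R t) ≡ 1) (h : n * n + 2 * n + 18 ≤ 2 * D) where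

      private
        d-w : d w ≤ # S + # T
        d-w = ≤-trans (d≤cover (ZA t) (ZB t) (R t) (R-cover t) w)
          (+-monoʳ-≤ (# S) (≤-trans (+-monoʳ-≤ (# T) (≮⇒≥ λ lt → none (#>0⇒∃ (λ u → R t u ∧ adj w u) lt)))
                  (≤-reflexive (+-identityʳ (# T)))))
          where
          none : (∃ λ u → R t u ∧ adj w u ≡ true) → ⊥
          none (u , p) = adj⇒≢ (proj₂ (∧-true {R t u} p)) (sym (unique u (proj₁ (∧-true p))))

        over-R : ∀ f k → f w ≤ k → sumOn (R t) f ≤ k
        over-R f k fw≤k = ≤-trans (sumOn-≤const (R t) f k λ u p → subst (λ u → f u ≤ k) (sym (unique u p)) fw≤k)
          (≤-reflexive (trans (cong (_* k) #R≡1) (+-identityʳ k)))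

        D-bound : D ≤ 2 * (# (ZA t) + # (ZB t)) + 2 * e (ZA t) (ZB t) + 2 * (# S + # T)
        D-bound = begin
          D ≤⟨ sum≤cover (ZA t) (ZB t) (R t) d (R-cover t) ⟩
          sumOn (ZA t) d + (sumOn (ZB t) d + sumOn (R t) d)
            ≤⟨ +-mono-≤ (≤-trans (ZA-degree-sum t)
              (+-monoʳ-≤ (# (ZA t) * 2) (+-monoʳ-≤ (e (ZA t) (ZB t)) (over-R (deg (ZA t)) (# S) ≤-refl))))
                (+-mono-≤ (≤-trans (ZB-degree-sum t)
                  (+-monoʳ-≤ (# (ZB t) * 2) (+-monoʳ-≤ (e (ZA t) (ZB t)) (over-R (deg (ZB t)) (# T) ≤-refl))))
                          (over-R d (# S + # T) d-w)) ⟩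
          (# (ZA t) * 2 + (e (ZA t) (ZB t) + # S)) + ((# (ZB t) * 2 + (e (ZA t) (ZB t) + # T)) + (# S + # T))
            ≡⟨ lemma (# (ZA t)) (# (ZB t)) (e (ZA t) (ZB t)) (# S) (# T) ⟩
          2 * (# (ZA t) + # (ZB t)) + 2 * e (ZA t) (ZB t) + 2 * (# S + # T) ∎
          where
          open ≤-Reasoning
          lemma : ∀ a b x s t → (a * 2 + (x + s)) + ((b * 2 + (x + t)) + (s + t)) ≡ 2 * (a + b) + 2 * x + 2 * (s + t)
          lemma = solve-∀

        link-edges : e S S + e T T + 2 * e S T + 12 ≤ 6 * (# S + # T)
        link-edges = begin
          e S S + e T T + 2 * e S T + 12                       ≡⟨ lemma (e S S) (e T T) (e S T) ⟩
          (e S S + e S T) + (e T T + e S T) + 12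
            ≡⟨ cong (λ k → (e S S + e S T) + (e T T + k) + 12) (e-sym S T) ⟩
          (e S S + e S T) + (e T T + e T S) + 12
            ≡⟨ cong₂ (λ k l → k + l + 12) (sumOn-+ S (deg S) (deg T)) (sumOn-+ T (deg T) (deg S)) ⟨
          sumOn S (λ z → deg S z + deg T z) + sumOn T (λ z → deg T z + deg S z) + 12
            ≤⟨ +-monoˡ-≤ 12 (+-mono-≤ (sumOn-mono S λ z _ → parts z)
              (sumOn-mono T λ z _ → ≤-trans (≤-reflexive (+-comm (deg T z) (deg S z))) (parts z))) ⟩
          sumOn S (c w) + sumOn T (c w) + 12                   ≤⟨ +-monoˡ-≤ 12 (sumOn-parts t w (c w)) ⟩
          sumOn (adj w) (c w) + 12                             ≡⟨ link-degree-sum w ⟩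
          6 * d w                                              ≤⟨ *-monoʳ-≤ 6 d-w ⟩
          6 * (# S + # T)                                      ∎
          where
          open ≤-Reasoning
          lemma : ∀ a b x → a + b + 2 * x + 12 ≡ (a + x) + (b + x) + 12
          lemma = solve-∀
          parts : ∀ z → deg S z + deg T z ≤ c w z
          parts z = begin
            deg S z + deg T z ≤⟨ +-mono-≤
                (#-mono λ y p → let q , r = ∧-true {S y} p ; q₁ , q₂ = ∧-true {ZA t y} q in (q₂ ∧ᵗ r) ∧ᵗ q₁)
                (#-mono λ y p → let q , r = ∧-true {T y} p ; q₁ , q₂ = ∧-true {ZB t y} q in (q₂ ∧ᵗ r) ∧ᵗ notZA y q₁) ⟩
            # (λ y → lk w z y ∧ ZA t y) + # (λ y → lk w z y ∧ not (ZA t y)) ≡⟨ #-split (lk w z) (ZA t) ⟨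
            c w z ∎
            where
            notZA : ∀ i → ZB t i ≡ true → not (ZA t i) ≡ true
            notZA i q with ZA t i in p
            ... | false = refl
            ... | true  = ⊥-elim (ZA-∌ZB t p q)

      arc-bounds-contradict : 2 * # S ≤ e S S + 2 → 2 * # T ≤ e T T + 2 → 3 ≤ # S → 3 ≤ # T → ⊥
      arc-bounds-contradict = one-vertex-arithmetic n D (# (ZA t)) (# (ZB t)) (e (ZA t) (ZB t)) (missing t) (# S) (# T)
        (e S S) (e T T) (e S T)
        (trans (sym (#R+#Z≡n t)) (cong (_+ (# (ZA t) + # (ZB t))) #R≡1)) h D-bound (e+codeg (ZA t) (ZB t))
        (≤-trans (≤-reflexive (sym (e+codeg S T))) (+-monoʳ-≤ (e S T) (missing-near t w))) link-edges

  no-single-vertex : n * n + 2 * n + 18 ≤ 2 * D → ∀ t → # (R t) ≡ 1 → ⊥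
  no-single-vertex h t #R≡1 = from (#>0⇒∃ (R t) (subst (0 <_) (sym #R≡1) (s≤s z≤n)))
    where
    from : (∃ λ w → R t w ≡ true) → ⊥
    from (w , w∈R) = combine (full-or-arc t w∈R unique) (full-or-arc (opposite t) w∈R′ unique′)
      where
      unique : ∀ u → R t u ≡ true → u ≡ w
      unique u p with u ≟ w
      ... | yes u≡w = u≡w
      ... | no u≢w  = ⊥-elim (<⇒≱ (s≤s (s≤s z≤n)) (≤-trans (≤-trans (two-terms≤sumOn (R t) (λ _ → 1) u≢w p w∈R)
                        (≤-reflexive (trans (sumOn-const (R t) 1) (*-identityʳ (# (R t)))))) (≤-reflexive #R≡1)))
      w∈R′ : R (opposite t) w ≡ true
      w∈R′ = trans (R-swap t w) w∈R
      unique′ : ∀ u → R (opposite t) u ≡ true → u ≡ w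
      unique′ u p = unique u (trans (sym (R-swap t u)) p)
      conclude = arc-bounds-contradict t w∈R unique #R≡1 h
      combine : (∀ b → ZB t b ≡ true → adj w b ≡ true) ⊎ Arc t w∈R unique →
        (∀ a → ZA t a ≡ true → adj w a ≡ true) ⊎ Arc (opposite t) w∈R′ unique′ → ⊥
      combine (inj₁ fullB) (inj₁ fullA) = let p , q = full⇒cycle t w∈R unique fullB ; r , s = full⇒cycle (opposite t) w∈R′ unique′ fullA in conclude r p s q
      combine (inj₂ (p , q , _)) (inj₂ (r , s , _)) = conclude p r q s
      -- The mixed cases cannot occur: an arc on one cycle prevents `w` from seeing all of the
      -- other.
      combine (inj₁ fullB) (inj₂ (_ , _ , notB)) = notB fullB
      combine (inj₂ (_ , _ , notA)) (inj₁ fullA) = notA fullA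

  complete-join : ∀ t → # (R t) ≡ 0 →
    (∀ v → ZA t v ≡ true ⊎ ZB t v ≡ true) × (∀ a b → ZA t a ≡ true → ZB t b ≡ true → adj a b ≡ true)
  complete-join t #R≡0 = covers , λ a b a∈ b∈ → full-vertex t a∈ (λ u u∈R _ → none u u∈R) b b∈
    where
    none : ∀ u → R t u ≡ true → ⊥
    none u p = <⇒≱ (∃⇒#>0 (R t) p) (≤-reflexive #R≡0)
    covers : ∀ v → ZA t v ≡ true ⊎ ZB t v ≡ true
    covers v with ZA t v in za | ZB t v in zb
    ... | true  | _     = inj₁ refl
    ... | false | true  = inj₂ refl
    ... | false | false = ⊥-elim (none v (R-cover t v za zb))

-- Cyclic enumeration of a connected 2-regular graph

module Enumeration {n : ℕ} (adj : Fin n → Fin n → Bool) (adj-sym : ∀ i j → adj i j ≡ adj j i)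
  (adj-irr : ∀ i → adj i i ≡ false)
  (Z : Fin n → Bool) (regular : ∀ {z} → Z z ≡ true → # (λ y → Z y ∧ adj z y) ≡ 2)
  (connected : ∀ (P : Fin n → Bool) → (∀ x y → P x ≡ true → Z x ≡ true → Z y ≡ true → adj x y ≡ true → P y ≡ true) →
    ∀ {z} → Z z ≡ true → P z ≡ true → ∀ y → Z y ≡ true → P y ≡ true)
  {z₀ : Fin n} (z₀∈ : Z z₀ ≡ true) where

  -- The state of the walk is a directed edge, since the next vertex depends on the previous one: it
  -- is the other neighbour of `target`.
  record Arrow : Set where
    field
      {source target} : Fin n
      source∈ : Z source ≡ true
      target∈ : Z target ≡ true
      edge∈   : adj source target ≡ true
  open Arrow

  private
    other : (s : Arrow) → ∃ λ y → y ≢ source s × Z y ∧ adj (target s) y ≡ true ×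
      (∀ z → Z z ∧ adj (target s) z ≡ true → z ≡ source s ⊎ z ≡ y)
    other s = other-element _ (regular (target∈ s)) (source∈ s ∧ᵗ trans (adj-sym (target s) (source s)) (edge∈ s))

    next : Arrow → Arrow
    next s = record { source∈ = target∈ s ; target∈ = proj₁ (∧-true p) ; edge∈ =
      proj₂ (∧-true {Z (proj₁ (other s))} p) }
      where p = proj₁ (proj₂ (proj₂ (other s)))

    first : Arrow
    first = record { source∈ = z₀∈ ; target∈ = proj₁ (∧-true (proj₂ nbr)) ; edge∈ =
      proj₂ (∧-true {Z (proj₁ nbr)} (proj₂ nbr)) }
      where nbr = #>0⇒∃ (λ y → Z y ∧ adj z₀ y) (subst (0 <_) (sym (regular z₀∈)) (s≤s z≤n))

    arrow : ℕ → Arrow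
    arrow zero    = first
    arrow (suc i) = next (arrow i)

  opaque
    walk : ℕ → Fin n
    walk i = source (arrow i)

    walk∈ : ∀ i → Z (walk i) ≡ true
    walk∈ i = source∈ (arrow i)

    walk-adj : ∀ i → adj (walk i) (walk (suc i)) ≡ true
    walk-adj i = edge∈ (arrow i)

    walk-turn : ∀ i → walk (2 + i) ≢ walk i
    walk-turn i = proj₁ (proj₂ (other (arrow i)))

    walk-nbr : ∀ i y → Z y ≡ true → adj (walk (suc i)) y ≡ true → y ≡ walk i ⊎ y ≡ walk (2 + i)
    walk-nbr i y y∈ p = proj₂ (proj₂ (proj₂ (other (arrow i)))) y (y∈ ∧ᵗ p)

  adj⇒≢ : ∀ {u v} → adj u v ≡ true → u ≢ v
  adj⇒≢ {u} uv refl = true≢false uv (adj-irr u)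

  Distinct : ℕ → Set
  Distinct k = ∀ i j → i < j → j < k → walk i ≢ walk j

  private
    FirstReturn : Set
    FirstReturn = ∃ λ k → Distinct k × ∃ λ i → i < k × walk k ≡ walk i

    -- The fuel cannot run out before a repetition, because more than `n` distinct positions
    -- contradict the pigeonhole principle.
    search : ∀ fuel k → Distinct k → n < k + fuel → FirstReturn
    search zero k dist n<k with pigeonhole (subst (n <_) (+-identityʳ k) n<k) (λ i → walk (toℕ i))
    ... | i , j , i<j , eq = ⊥-elim (dist (toℕ i) (toℕ j) i<j (toℕ<n j) eq)
    search (suc fuel) k dist n<k with anyUpTo? (λ i → walk k ≟ walk i) k
    ... | yes (i , i<k , eq) = k , dist , i , i<k , eq
    ... | no ¬return = search fuel (suc k) dist′ (subst (n <_) (+-suc k fuel) n<k)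
      where
      dist′ : Distinct (suc k)
      dist′ i j i<j (s≤s j≤k) eq with m≤n⇒m<n∨m≡n j≤k
      ... | inj₁ j<k  = dist i j i<j j<k eq
      ... | inj₂ refl = ¬return (i , i<j , sym eq)

  Period : ℕ → Set
  Period k = 3 ≤ k × Distinct k × walk k ≡ walk 0

  private
    -- After a first return to position i + 1 ≥ 1, the vertex just before the return would be a
    -- cycle neighbour of that position, hence the one at i or at i + 2. This is an earlier
    -- repetition, a loop or a reversal of the walk.
    return-at-0 : ∀ k → Distinct k → ∀ i → i < k → walk k ≡ walk i → walk k ≡ walk 0
    return-at-0 k dist zero i<k eq = eq
    return-at-0 (suc k) dist (suc i) (s≤s i<k) eq with walk-nbr i (walk k) (walk∈ k)
        (trans (adj-sym (walk (suc i)) (walk k)) (trans (cong (adj (walk k)) (sym eq)) (walk-adj k)))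
    ... | inj₁ k≡i  = ⊥-elim (dist i k i<k ≤-refl (sym k≡i))
    ... | inj₂ k≡i+2 with <-cmp k (2 + i)
    ... | tri< k<i+2 _ _ =
      ⊥-elim (adj⇒≢ (walk-adj k) (trans k≡i+2 (cong (λ j → walk (suc j)) (sym (≤-antisym (≤-pred k<i+2) i<k)))))
    ... | tri≈ _ refl _  = ⊥-elim (walk-turn (suc i) eq)
    ... | tri> _ _ k>i+2 = ⊥-elim (dist (2 + i) k k>i+2 ≤-refl (sym k≡i+2))

    return-≥3 : ∀ k → ∀ i → i < k → walk k ≡ walk 0 → 3 ≤ k
    return-≥3 1 i i<k eq = ⊥-elim (adj⇒≢ (walk-adj 0) (sym eq))
    return-≥3 2 i i<k eq = ⊥-elim (walk-turn 0 eq)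
    return-≥3 (suc (suc (suc k))) i i<k eq = s≤s (s≤s (s≤s z≤n))

  period : ∃ λ k → Period k
  period with search (suc n) 0 (λ _ _ _ ()) ≤-refl
  ... | k , dist , i , i<k , eq = k , return-≥3 k i i<k eq₀ , dist , eq₀
    where eq₀ = return-at-0 k dist i i<k eq

  module _ {k : ℕ} (P : Period k) where
    private
      3≤k = proj₁ P
      dist = proj₁ (proj₂ P)
      return = proj₂ (proj₂ P)

    walk-injective : ∀ i j → i < k → j < k → walk i ≡ walk j → i ≡ j
    walk-injective i j i<k j<k eq with <-cmp i j
    ... | tri< i<j _ _ = ⊥-elim (dist i j i<j j<k eq)
    ... | tri≈ _ i≡j _ = i≡j
    ... | tri> _ _ j<i = ⊥-elim (dist j i j<i i<k (sym eq))

    Consecutive : ℕ → ℕ → Set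
    Consecutive i j = suc i ≡ j ⊎ (suc i ≡ k × j ≡ 0)

    private
      -- Closing up happens with the right orientation: the second vertex is a neighbour of the
      -- start and differs from the last one because there are at least three positions.
      wrap : ∀ k → 3 ≤ k → walk k ≡ walk 0 → (∀ i j → i < k → j < k → walk i ≡ walk j → i ≡ j) → walk (suc k) ≡ walk 1
      wrap (suc k) (s≤s 2≤k) ret inj with walk-nbr k (walk 1) (walk∈ 1)
        (trans (cong (λ v → adj v (walk 1)) ret) (walk-adj 0))
      ... | inj₂ eq = sym eq
      ... | inj₁ eq = ⊥-elim (<⇒≢ 2≤k (inj 1 k (s≤s (≤-trans (s≤s z≤n) 2≤k)) ≤-refl eq))

      wrapped : walk (suc k) ≡ walk 1
      wrapped = wrap k 3≤k return walk-injective

    nbr-index : ∀ i → i < k → ∀ y → Z y ≡ true → adj (walk i) y ≡ true →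
      ∃ λ j → j < k × y ≡ walk j × (Consecutive i j ⊎ Consecutive j i)
    nbr-index zero _ y y∈ p = at-0 k refl
      where
      at-0 : ∀ l → l ≡ k → ∃ λ j → j < k × y ≡ walk j × (Consecutive 0 j ⊎ Consecutive j 0)
      at-0 zero    refl = ⊥-elim (<⇒≱ 3≤k z≤n)
      at-0 (suc l) refl with walk-nbr l y y∈ (trans (cong (λ v → adj v y) return) p)
      ... | inj₁ eq = l , ≤-refl , eq , inj₂ (inj₂ (refl , refl))
      ... | inj₂ eq = 1 , ≤-trans (s≤s (s≤s z≤n)) 3≤k , trans eq wrapped , inj₁ (inj₁ refl)
    nbr-index (suc i) i<k y y∈ p with walk-nbr i y y∈ p
    ... | inj₁ eq = i , ≤-trans (n≤1+n (suc i)) i<k , eq , inj₂ (inj₁ refl)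
    ... | inj₂ eq with m≤n⇒m<n∨m≡n i<k
    ... | inj₁ lt   = 2 + i , lt , eq , inj₁ (inj₁ refl)
    ... | inj₂ refl = 0 , s≤s z≤n , trans eq return , inj₁ (inj₂ (refl , refl))

    consecutive-adj : ∀ i j → Consecutive i j → adj (walk i) (walk j) ≡ true
    consecutive-adj i .(suc i) (inj₁ refl)        = walk-adj i
    consecutive-adj i .0       (inj₂ (1+i≡k , refl)) =
      subst (λ v → adj (walk i) v ≡ true) (trans (cong walk 1+i≡k) return) (walk-adj i)

    walk-surjective : ∀ v → Z v ≡ true → ∃ λ i → i < k × walk i ≡ v
    walk-surjective v v∈ = Q⇒ v (connected Q closed (walk∈ 0) (⇒Q (walk 0) (0 , ≤-trans (s≤s z≤n) 3≤k , refl)) v v∈)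
      where
      Q : Fin n → Bool
      Q v = ⌊ anyUpTo? (λ i → walk i ≟ v) k ⌋
      Q⇒ : ∀ v → Q v ≡ true → ∃ λ i → i < k × walk i ≡ v
      Q⇒ v q with anyUpTo? (λ i → walk i ≟ v) k
      ... | yes p = p
      ⇒Q : ∀ v → (∃ λ i → i < k × walk i ≡ v) → Q v ≡ true
      ⇒Q v p with anyUpTo? (λ i → walk i ≟ v) k
      ... | yes _ = refl
      ... | no ¬p = contradiction p ¬p
      closed : ∀ x y → Q x ≡ true → Z x ≡ true → Z y ≡ true → adj x y ≡ true → Q y ≡ true
      closed x y qx x∈ y∈ xy = step′ (Q⇒ x qx)
        where
        step′ : (∃ λ i → i < k × walk i ≡ x) → Q y ≡ true
        step′ (i , i<k , refl) = let j , j<k , eq , _ = nbr-index i i<k y y∈ xy in ⇒Q y (j , j<k , sym eq)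

    position : Fin k → Fin n
    position i = walk (toℕ i)

    position∈ : ∀ i → Z (position i) ≡ true
    position∈ i = walk∈ (toℕ i)

    position-injective : ∀ i j → position i ≡ position j → i ≡ j
    position-injective i j eq = toℕ-injective (walk-injective (toℕ i) (toℕ j) (toℕ<n i) (toℕ<n j) eq)

    position-surjective : ∀ v → Z v ≡ true → ∃ λ i → position i ≡ v
    position-surjective v v∈ = let i , i<k , eq = walk-surjective v v∈ in
      fromℕ< i<k , trans (cong walk (toℕ-fromℕ< i<k)) eq

    private
      cycAdj⇒ : (i j : Fin k) → cycAdj i j ≡ true → Consecutive (toℕ i) (toℕ j)
      cycAdj⇒ i j p with ∨-true {suc (toℕ i) ≡ᵇ toℕ j} p
      ... | inj₁ q = inj₁ (≡ᵇ-true⇒≡ {suc (toℕ i)} {toℕ j} q)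
      ... | inj₂ q = let r , s = ∧-true {suc (toℕ i) ≡ᵇ k} q in inj₂ (≡ᵇ-true⇒≡ {suc (toℕ i)} {k} r , ≡ᵇ-true⇒≡ {toℕ j} {0} s)

      ⇒cycAdj : (i j : Fin k) → Consecutive (toℕ i) (toℕ j) → cycAdj i j ≡ true
      ⇒cycAdj i j (inj₁ q)       = ∨-trueˡ (≡⇒≡ᵇ-true {suc (toℕ i)} {toℕ j} q)
      ⇒cycAdj i j (inj₂ (q , r)) = ∨-trueʳ {suc (toℕ i) ≡ᵇ toℕ j}
        (≡⇒≡ᵇ-true {suc (toℕ i)} {k} q ∧ᵗ ≡⇒≡ᵇ-true {toℕ j} {0} r)

    position-adj⇒ : ∀ i j → adj (position i) (position j) ≡ true → cycAdj i j ≡ true ⊎ cycAdj j i ≡ true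
    position-adj⇒ i j p with nbr-index (toℕ i) (toℕ<n i) (position j) (position∈ j) p
    ... | l , l<k , eq , con with walk-injective (toℕ j) l (toℕ<n j) l<k eq
    ... | refl with con
    ... | inj₁ q = inj₁ (⇒cycAdj i j q)
    ... | inj₂ q = inj₂ (⇒cycAdj j i q)

    position-adj : ∀ i j → cycAdj i j ≡ true ⊎ cycAdj j i ≡ true → adj (position i) (position j) ≡ true
    position-adj i j (inj₁ p) = consecutive-adj (toℕ i) (toℕ j) (cycAdj⇒ i j p)
    position-adj i j (inj₂ p) = trans (adj-sym (position i) (position j))
      (consecutive-adj (toℕ j) (toℕ i) (cycAdj⇒ j i p))

-- Polygons and joins

iff-≡ : ∀ {a b} → (a ≡ true → b ≡ true) → (b ≡ true → a ≡ true) → a ≡ b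
iff-≡ {true}  {true}  f g = refl
iff-≡ {false} {false} f g = refl
iff-≡ {true}  {false} f g = sym (f refl)
iff-≡ {false} {true}  f g = g refl

any-allFin⁺ : ∀ {m} (p : Fin m → Bool) i → p i ≡ true → any p (allFin m) ≡ true
any-allFin⁺ p i pi = Equivalence.to T-≡ (any⁺ p (lose (∈-allFin i) (Equivalence.from T-≡ pi)))

any-allFin⁻ : ∀ {m} (p : Fin m → Bool) → any p (allFin m) ≡ true → ∃ λ i → p i ≡ true
any-allFin⁻ {m} p h with find (any⁻ p (allFin m) (Equivalence.from T-≡ h))
... | i , _ , pi = i , Equivalence.to T-≡ pi

⊆ᵇ⇒ : ∀ {m} (σ τ : Subset m) → σ ⊆ᵇ τ ≡ true → ∀ i → lookup σ i ≡ true → lookup τ i ≡ true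
⊆ᵇ⇒ (true ∷ σ) (y ∷ τ) p zero    q = proj₁ (∧-true {y} p)
⊆ᵇ⇒ (x ∷ σ)    (y ∷ τ) p (suc i) q = ⊆ᵇ⇒ σ τ (proj₂ (∧-true {not x ∨ y} p)) i q

⇒⊆ᵇ : ∀ {m} (σ τ : Subset m) → (∀ i → lookup σ i ≡ true → lookup τ i ≡ true) → σ ⊆ᵇ τ ≡ true
⇒⊆ᵇ []          []      h = refl
⇒⊆ᵇ (false ∷ σ) (y ∷ τ) h = ⇒⊆ᵇ σ τ (h ∘ suc)
⇒⊆ᵇ (true ∷ σ)  (y ∷ τ) h = h zero refl ∧ᵗ ⇒⊆ᵇ σ τ (h ∘ suc)

CycleEdge : ∀ {m} → Fin m → Fin m → Set
CycleEdge i j = cycAdj i j ≡ true ⊎ cycAdj j i ≡ true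

∣∣≥2 : ∀ {m} (σ : Subset m) {i j} → i ≢ j → lookup σ i ≡ true → lookup σ j ≡ true → 2 ≤ ∣ σ ∣
∣∣≥2 σ i≢j p q = ≤-trans (two-terms≤sumOn (lookup σ) (λ _ → 1) i≢j p q)
  (≤-reflexive (trans (sumOn-const (lookup σ) 1) (trans (*-identityʳ _) (trans (#-sum (lookup σ)) (sym (∣∣≡sum σ))))))

two-members : ∀ {m} (σ : Subset m) → 2 ≤ ∣ σ ∣ → ∃ λ i → ∃ λ j → i ≢ j × lookup σ i ≡ true × lookup σ j ≡ true
two-members σ h = from (#>0⇒∃ (lookup σ) (≤-trans (s≤s z≤n) size))
  where
  size : 2 ≤ # (lookup σ)
  size = ≤-trans h (≤-reflexive (trans (∣∣≡sum σ) (sym (#-sum (lookup σ)))))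
  from : (∃ λ i → lookup σ i ≡ true) → ∃ λ i → ∃ λ j → i ≢ j × lookup σ i ≡ true × lookup σ j ≡ true
  from (i , p) with sum-<⇒∃ (λ j → ⟦ j == i ⟧) (λ j → ⟦ lookup σ j ⟧)
      (subst₂ _<_ (sym (sum-δ i)) (#-sum (lookup σ)) size)
  ... | j , lt with j ≟ i | lookup σ j in q
  ... | no j≢i | true  = i , j , j≢i ∘ sym , p , q
  ... | no _   | false = contradiction lt λ ()
  ... | yes _  | true  = contradiction lt λ { (s≤s ()) }
  ... | yes _  | false = contradiction lt λ ()

polygon⇒edges : ∀ {m} (σ : Subset m) → polygon m σ ≡ true →
  ∀ i j → lookup σ i ≡ true → lookup σ j ≡ true → i ≢ j → CycleEdge i j
polygon⇒edges {m} σ h i j p q i≢j with ∨-true {∣ σ ∣ ≤ᵇ 1} h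
... | inj₁ small = ⊥-elim (<⇒≱ (∣∣≥2 σ i≢j p q) (≤ᵇ-true⇒≤ {∣ σ ∣} small))
... | inj₂ edges with any-allFin⁻ (λ i → any (λ j → cycAdj i j ∧ (σ ==ˢ edge i j)) (allFin m)) edges
... | k , h′ with any-allFin⁻ (λ j → cycAdj k j ∧ (σ ==ˢ edge k j)) h′
... | l , r = pair (lookup-edge k l i (in-edge i p)) (lookup-edge k l j (in-edge j q))
  where
  kl = proj₁ (∧-true {cycAdj k l} r)
  in-edge : ∀ i → lookup σ i ≡ true → lookup (edge k l) i ≡ true
  in-edge = ⊆ᵇ⇒ σ (edge k l) (proj₁ (∧-true {σ ⊆ᵇ edge k l} (proj₂ (∧-true {cycAdj k l} r))))
  pair : i ≡ k ⊎ i ≡ l → j ≡ k ⊎ j ≡ l → CycleEdge i j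
  pair (inj₁ refl) (inj₁ refl) = ⊥-elim (i≢j refl)
  pair (inj₁ refl) (inj₂ refl) = inj₁ kl
  pair (inj₂ refl) (inj₁ refl) = inj₂ kl
  pair (inj₂ refl) (inj₂ refl) = ⊥-elim (i≢j refl)

-- Without triangles a set of pairwise cycle-adjacent vertices has at most two elements. The
-- triangle condition excludes `m = 3`, where the whole vertex set is a clique but not a face of the
-- polygon.
edges⇒polygon : ∀ {m} (σ : Subset m) →
  (∀ i j → lookup σ i ≡ true → lookup σ j ≡ true → i ≢ j → CycleEdge i j) →
  (∀ i j k → i ≢ j → i ≢ k → j ≢ k → CycleEdge i j → CycleEdge i k → CycleEdge j k → ⊥) → polygon m σ ≡ true
edges⇒polygon {m} σ pw no-triangle with ∣ σ ∣ ≤ᵇ 1 in eq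
... | true  = refl
... | false = from (two-members σ (≤ᵇ-false⇒> {∣ σ ∣} eq))
  where
  found : ∀ k l → cycAdj k l ≡ true → (∀ z → lookup σ z ≡ true → z ≡ k ⊎ z ≡ l) → lookup σ k ≡ true →
    lookup σ l ≡ true →
    any (λ i → any (λ j → cycAdj i j ∧ (σ ==ˢ edge i j)) (allFin m)) (allFin m) ≡ true
  found k l kl only k∈ l∈ = any-allFin⁺ _ k (any-allFin⁺ (λ j → cycAdj k j ∧ (σ ==ˢ edge k j)) l
    (kl ∧ᵗ ⇒⊆ᵇ σ (edge k l) (λ z p → in-edge z (only z p)) ∧ᵗ trans (edge⊆ᵇ k l σ) (k∈ ∧ᵗ l∈)))
    where
    in-edge : ∀ z → z ≡ k ⊎ z ≡ l → lookup (edge k l) z ≡ true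
    in-edge z (inj₁ refl) = trans (lookup-∪ ⁅ k ⁆ ⁅ l ⁆ k) (∨-trueˡ (lookup-⁅⁆ k))
    in-edge z (inj₂ refl) = trans (lookup-∪ ⁅ k ⁆ ⁅ l ⁆ l) (∨-trueʳ (lookup-⁅⁆ l))
  from : (∃ λ i → ∃ λ j → i ≢ j × lookup σ i ≡ true × lookup σ j ≡ true) →
    any (λ i → any (λ j → cycAdj i j ∧ (σ ==ˢ edge i j)) (allFin m)) (allFin m) ≡ true
  from (i , j , i≢j , p , q) = orient (pw i j p q i≢j)
    where
    only : ∀ z → lookup σ z ≡ true → z ≡ i ⊎ z ≡ j
    only z r with z ≟ i | z ≟ j
    ... | yes z≡i | _       = inj₁ z≡i
    ... | no _    | yes z≡j = inj₂ z≡j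
    ... | no z≢i  | no z≢j  = ⊥-elim (no-triangle i j z i≢j (z≢i ∘ sym) (z≢j ∘ sym)
                                (pw i j p q i≢j) (pw i z p r (z≢i ∘ sym)) (pw j z q r (z≢j ∘ sym)))
    orient : CycleEdge i j → any (λ i → any (λ j → cycAdj i j ∧ (σ ==ˢ edge i j)) (allFin m)) (allFin m) ≡ true
    orient (inj₁ ij) = found i j ij only p q
    orient (inj₂ ji) = found j i ji (λ z r → [ inj₂ , inj₁ ]′ (only z r)) q p

lookup-take : ∀ a {b} (σ : Subset (a + b)) i → lookup (take a σ) i ≡ lookup σ (i ↑ˡ b)
lookup-take a {b} σ i = trans (sym (lookup-++ˡ (take a σ) (drop a σ) i))
  (cong (λ τ → lookup τ (i ↑ˡ b)) (take++drop≡id a σ))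

lookup-drop : ∀ a {b} (σ : Subset (a + b)) i → lookup (drop a σ) i ≡ lookup σ (a ↑ʳ i)
lookup-drop a σ i = trans (sym (lookup-++ʳ (take a σ) (drop a σ) i))
  (cong (λ τ → lookup τ (a ↑ʳ i)) (take++drop≡id a σ))

-- The isomorphism with the join of two polygons

record Cycle {n : ℕ} (adj : Fin n → Fin n → Bool) (Z : Fin n → Bool) (m : ℕ) : Set where
  field
    position   : Fin m → Fin n
    position∈  : ∀ i → Z (position i) ≡ true
    injective  : ∀ i j → position i ≡ position j → i ≡ j
    surjective : ∀ v → Z v ≡ true → ∃ λ i → position i ≡ v
    adj⇒edge   : ∀ i j → adj (position i) (position j) ≡ true → CycleEdge i j
    edge⇒adj   : ∀ i j → CycleEdge i j → adj (position i) (position j) ≡ true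

module JoinIso {n : ℕ} (M : SimplicialComplex n) {adj : Fin n → Fin n → Bool}
  (C : IsCliqueComplex adj (face M) (λ _ → true)) (adj-sym : ∀ i j → adj i j ≡ adj j i)
  {ZA ZB : Fin n → Bool} (cover : ∀ v → ZA v ≡ true ⊎ ZB v ≡ true) (disjoint : ∀ v → ZA v ≡ true → ZB v ≡ true → ⊥)
  (complete : ∀ a b → ZA a ≡ true → ZB b ≡ true → adj a b ≡ true)
  (no-triangleA : ∀ x y z → ZA x ≡ true → ZA y ≡ true → ZA z ≡ true → adj x y ≡ true → adj x z ≡ true → adj y z ≡ true →
    ⊥)
  (no-triangleB : ∀ x y z → ZB x ≡ true → ZB y ≡ true → ZB z ≡ true → adj x y ≡ true → adj x z ≡ true → adj y z ≡ true →
    ⊥)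
  {a b : ℕ} (CA : Cycle adj ZA a) (CB : Cycle adj ZB b) where

  private
    module A = Cycle CA
    module B = Cycle CB

  vertex : Fin (a + b) → Fin n
  vertex i = [ A.position , B.position ]′ (splitAt a i)

  vertex-↑ˡ : ∀ i → vertex (i ↑ˡ b) ≡ A.position i
  vertex-↑ˡ i = cong [ A.position , B.position ]′ (splitAt-↑ˡ a i b)

  vertex-↑ʳ : ∀ i → vertex (a ↑ʳ i) ≡ B.position i
  vertex-↑ʳ i = cong [ A.position , B.position ]′ (splitAt-↑ʳ a b i)

  index : ∀ v → ∃ λ i → vertex i ≡ v
  index v with cover v
  ... | inj₁ v∈ = let i , eq = A.surjective v v∈ in i ↑ˡ b , trans (vertex-↑ˡ i) eq
  ... | inj₂ v∈ = let i , eq = B.surjective v v∈ in a ↑ʳ i , trans (vertex-↑ʳ i) eq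

  vertex-injective : ∀ i j → vertex i ≡ vertex j → i ≡ j
  vertex-injective i j eq with splitAt a i in p | splitAt a j in q
  ... | inj₁ k | inj₁ l = trans (sym (splitAt⁻¹-↑ˡ p)) (trans (cong (_↑ˡ b) (A.injective k l eq)) (splitAt⁻¹-↑ˡ q))
  ... | inj₂ k | inj₂ l = trans (sym (splitAt⁻¹-↑ʳ p)) (trans (cong (a ↑ʳ_) (B.injective k l eq)) (splitAt⁻¹-↑ʳ q))
  ... | inj₁ k | inj₂ l =
    ⊥-elim (disjoint (B.position l) (subst (λ v → ZA v ≡ true) eq (A.position∈ k)) (B.position∈ l))
  ... | inj₂ k | inj₁ l =
    ⊥-elim (disjoint (A.position l) (A.position∈ l) (subst (λ v → ZB v ≡ true) eq (B.position∈ k)))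

  iso : Fin n ↔ Fin (a + b)
  iso = mk↔ₛ′ (λ v → proj₁ (index v)) vertex (λ i → vertex-injective _ i (proj₂ (index (vertex i))))
    (λ v → proj₂ (index v))

  module _ (σ : Subset n) where
    private
      τ = image iso σ
      σA = take a τ
      σB = drop a τ

      lookup-A : ∀ i → lookup σA i ≡ lookup σ (A.position i)
      lookup-A i = trans (lookup-take a τ i)
        (trans (lookup∘tabulate (λ j → lookup σ (vertex j)) (i ↑ˡ b)) (cong (lookup σ) (vertex-↑ˡ i)))

      lookup-B : ∀ i → lookup σB i ≡ lookup σ (B.position i)
      lookup-B i = trans (lookup-drop a τ i)
        (trans (lookup∘tabulate (λ j → lookup σ (vertex j)) (a ↑ʳ i)) (cong (lookup σ) (vertex-↑ʳ i)))

      face⇒join : face M σ ≡ true → join (polygon a) (polygon b) τ ≡ true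
      face⇒join h =
        edges⇒polygon σA (λ i j p q i≢j →
          A.adj⇒edge i j (pairwise σ _ _ h (trans (sym (lookup-A i)) p) (trans (sym (lookup-A j)) q)
          (λ eq → i≢j (A.injective i j eq))))
          (λ i j k _ _ _ ij ik jk → no-triangleA _ _ _ (A.position∈ i) (A.position∈ j) (A.position∈ k)
            (A.edge⇒adj i j ij) (A.edge⇒adj i k ik) (A.edge⇒adj j k jk))
        ∧ᵗ
        edges⇒polygon σB (λ i j p q i≢j →
          B.adj⇒edge i j (pairwise σ _ _ h (trans (sym (lookup-B i)) p) (trans (sym (lookup-B j)) q)
          (λ eq → i≢j (B.injective i j eq))))
          (λ i j k _ _ _ ij ik jk → no-triangleB _ _ _ (B.position∈ i) (B.position∈ j) (B.position∈ k)
            (B.edge⇒adj i j ij) (B.edge⇒adj i k ik) (B.edge⇒adj j k jk))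
        where open IsCliqueComplex C

      join⇒face : join (polygon a) (polygon b) τ ≡ true → face M σ ≡ true
      join⇒face h = IsCliqueComplex.clique C σ (λ _ _ → refl) λ u v p q u≢v → adjacent u v p q u≢v (cover u) (cover v)
        where
        polyA = proj₁ (∧-true {polygon a σA} h)
        polyB = proj₂ (∧-true {polygon a σA} h)
        adjacent : ∀ u v → lookup σ u ≡ true → lookup σ v ≡ true → u ≢ v → ZA u ≡ true ⊎ ZB u ≡ true →
          ZA v ≡ true ⊎ ZB v ≡ true → adj u v ≡ true
        adjacent u v p q u≢v (inj₁ u∈) (inj₂ v∈) = complete u v u∈ v∈
        adjacent u v p q u≢v (inj₂ u∈) (inj₁ v∈) = trans (adj-sym u v) (complete v u v∈ u∈)
        adjacent u v p q u≢v (inj₁ u∈) (inj₁ v∈) with A.surjective u u∈ | A.surjective v v∈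
        ... | i , refl | j , refl = A.edge⇒adj i j
          (polygon⇒edges σA polyA i j (trans (lookup-A i) p) (trans (lookup-A j) q) (u≢v ∘ cong A.position))
        adjacent u v p q u≢v (inj₂ u∈) (inj₂ v∈) with B.surjective u u∈ | B.surjective v v∈
        ... | i , refl | j , refl = B.edge⇒adj i j
          (polygon⇒edges σB polyB i j (trans (lookup-B i) p) (trans (lookup-B j) q) (u≢v ∘ cong B.position))

    face≡join : face M σ ≡ join (polygon a) (polygon b) (image iso σ)
    face≡join = iff-≡ face⇒join join⇒face

-- From a covering pair of cycles to the join

module _ {n : ℕ} (G : SphericalGraph n) where
  open Graph G
  open Cycles G
  open Local G
  open Tetrahedron

  ZB-cycle : (t : Tetrahedron G) → ∃ λ m → 3 ≤ m × Cycle adj (ZB t) m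
  ZB-cycle t = proj₁ period , proj₁ (proj₂ period) , record
    { position = position (proj₂ period) ; position∈ = position∈ (proj₂ period)
    ; injective = position-injective (proj₂ period) ; surjective = position-surjective (proj₂ period)
    ; adj⇒edge = position-adj⇒ (proj₂ period) ; edge⇒adj = position-adj (proj₂ period) }
    where open Enumeration adj adj-sym adj-irr (ZB t) (ZB-regular t) (ZB-connected t) (y∈ t)

module _ {n : ℕ} (M : SimplicialComplex n) (flag : IsFlag M) (manifold : IsClosed3Manifold M) where
  private
    G = sphericalGraph M flag manifold
  open Graph G
  open Cycles G
  open Tetrahedron

  join-of-cycles : (t : Tetrahedron G) → # (R t) ≡ 0 → IsJoinOfTwoPolygons M
  join-of-cycles t #R≡0 = assemble (ZB-cycle G (opposite t)) (ZB-cycle G t) (OneVertex.complete-join G t #R≡0)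
    where
    assemble : (∃ λ a → 3 ≤ a × Cycle adj (ZA t) a) → (∃ λ b → 3 ≤ b × Cycle adj (ZB t) b) →
      (∀ v → ZA t v ≡ true ⊎ ZB t v ≡ true) × (∀ a b → ZA t a ≡ true → ZB t b ≡ true → adj a b ≡ true) →
        IsJoinOfTwoPolygons M
    assemble (a , 3≤a , CA) (b , 3≤b , CB) (cover , complete) = a , b , 3≤a , 3≤b , iso , face≡join
      where open JoinIso M (face-isCliqueComplex M flag) adj-sym cover (λ v → ZA-∌ZB t) complete
                   (λ u v w u∈ v∈ w∈ → lk-no-triangle (yy′ t) u∈ v∈ w∈)
                     (λ u v w u∈ v∈ w∈ → lk-no-triangle (xx′ t) u∈ v∈ w∈) CA CB

  many-edges⇒join : ∀ K L → 400 ≤ K → suc L ≡ 17 * K → K * (10 * L + 346) ≤ n → 400 * rest-constant (4 * L + 9) ≤ n →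
    n * n + 2 * n + 18 ≤ 2 * D → IsJoinOfTwoPolygons M
  many-edges⇒join K L 400≤K L≡ big₁ big₂ h = from (Existence.tight-tetrahedron G h K L 400≤K L≡ big₁ big₂)
    where
    from : (Σ (Tetrahedron G) λ t → # (R t) ≤ 1) → IsJoinOfTwoPolygons M
    from (t , #R≤1) = by-size (# (R t)) refl #R≤1
      where
      by-size : ∀ k → # (R t) ≡ k → k ≤ 1 → IsJoinOfTwoPolygons M
      by-size 0 eq _ = join-of-cycles t eq
      by-size 1 eq _ = ⊥-elim (OneVertex.no-single-vertex G h t eq)
      by-size (suc (suc k)) eq (s≤s ())

opaque
  -- 400 is the lower bound on `K` in the size conditions, and `L₀` = 17 · 400 - 1 is the matching
  -- threshold of Markov's inequality for 17n missing pairs.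
  K₀ L₀ : ℕ
  K₀ = 400
  L₀ = 6799

  400≤K₀ : 400 ≤ K₀
  400≤K₀ = ≤-refl

  1+L₀≡17K₀ : suc L₀ ≡ 17 * K₀
  1+L₀≡17K₀ = refl

theorem1p2 : Σ ℕ λ n₀ → ∀ (n : ℕ) (M : SimplicialComplex n) →
    IsFlag M → IsClosed3Manifold M → n₀ ≤ n →
    n ^ 2 + 2 * n + 17 < 4 * f₁ M →
    IsJoinOfTwoPolygons M
theorem1p2 = N₁ + N₂ , λ n M flag manifold n₀≤n many →
  many-edges⇒join M flag manifold K₀ L₀ 400≤K₀ 1+L₀≡17K₀
    (≤-trans (m≤m+n N₁ N₂) n₀≤n) (≤-trans (m≤n+m N₂ N₁) n₀≤n) (edges n (f₁ M) _ (twice-f₁ M flag) many)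
  where
  N₁ N₂ : ℕ
  N₁ = K₀ * (10 * L₀ + 346)
  N₂ = 400 * rest-constant (4 * L₀ + 9)
  -- The degree sum is twice the number of edges, and strictness in the integers raises 17 to 18.
  edges : ∀ n f D → 2 * f ≡ D → n ^ 2 + 2 * n + 17 < 4 * f → n * n + 2 * n + 18 ≤ 2 * D
  edges n f .(2 * f) refl h = subst₂ _≤_ (lemma₁ n) (lemma₂ f) h
    where
    lemma₁ : ∀ n → suc (n * (n * 1) + 2 * n + 17) ≡ n * n + 2 * n + 18
    lemma₁ = solve-∀
    lemma₂ : ∀ f → 4 * f ≡ 2 * (2 * f)
    lemma₂ = solve-∀
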